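{- Let $k\ge 3$ be an odd integer, $r$ a positive integer, and $q$ a prime power with $q\equiv 2k+1 \pmod{4k}$ and $q>8k^5\lceil r/k\rceil$. Then there exists a $\left(\frac{q-1}{2},k;r\right)$-MOHS.
   Context: Let $G$ be an abelian group of odd order $2v+1\ge 7$. A half-set of $G$ is a subset $V\subseteq G\setminus\{0\}$ containing exactly one element of each pair $\{g,-g\}$, $g\ne 0$. A $(v,k)$ Heffter system on $V$ is a partition of $V$ into blocks of size $k$, each summing to $0$ in $G$. Two Heffter systems on the same half-set are orthogonal if every block of one meets every block of the other in at most one element. A $(v,k;r)$-MOHS is a set of $r$ pairwise orthogonal $(v,k)$ Heffter systems on a common half-set of some abelian group of order $2v+1$. -}

module Defs where

open import Level using (0ℓ; _⊔_)
open import Algebra.Bundles using (AbelianGroup)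
open import Data.Fin using (Fin)
open import Data.List using (List; foldr; length)
open import Data.List.Relation.Unary.All using (All)
open import Data.List.Relation.Unary.AllPairs using (AllPairs)
open import Data.List.Relation.Unary.Any using (Any)
open import Data.Nat using (ℕ; suc; _+_; _*_; _^_; _≤_; NonZero)
open import Data.Nat.Primality using (Prime)
open import Data.Product using (_×_; ∃-syntax)
open import Data.Sum using (_⊎_)
open import Function.Bundles using (Inverse)
open import Relation.Binary.Definitions using (_Respects_)
open import Relation.Binary.PropositionalEquality as ≡ using (_≡_; _≢_)
open import Relation.Nullary using (¬_)
open import Relation.Unary using (Pred)

PrimePower : ℕ → Set
PrimePower q = ∃[ p ] ∃[ n ] Prime p × NonZero n × q ≡ p ^ n

module _ {c ℓ} (G : AbelianGroup c ℓ) where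
  open AbelianGroup G
    renaming (Carrier to ∣G∣; _∙_ to _⊕_; ε to 0#; _⁻¹ to ⊖_)
  open import Data.List.Membership.Setoid setoid using (_∈_)
  open import Data.List.Relation.Binary.Disjoint.Setoid setoid using (Disjoint)
  open import Data.List.Relation.Unary.Unique.Setoid setoid using (Unique)

  HasOrder : ℕ → Set (c ⊔ ℓ)
  HasOrder n = Inverse setoid (≡.setoid (Fin n))

  record IsHalfSet (V : Pred ∣G∣ 0ℓ) : Set (c ⊔ ℓ) where
    field
      respects    : V Respects _≈_
      0∉V         : ¬ V 0#
      exactly-one : ∀ g → ¬ (g ≈ 0#) →
                    (V g × ¬ V (⊖ g)) ⊎ (¬ V g × V (⊖ g))

  -- A block is a finite subset of G, listed without repetition (up to _≈_).
  record IsBlock (V : Pred ∣G∣ 0ℓ) (k : ℕ) (B : List ∣G∣) : Set (c ⊔ ℓ) where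
    field
      unique   : Unique B
      size     : length B ≡ k
      inside   : ∀ {x} → x ∈ B → V x
      zero-sum : foldr _⊕_ 0# B ≈ 0#

  -- A partition of V is a list of blocks; disjointness excludes repeated blocks
  -- when k ≥ 1, so the list represents a set of blocks.
  record IsHeffterSystem (V : Pred ∣G∣ 0ℓ) (k : ℕ) (H : List (List ∣G∣)) :
                         Set (c ⊔ ℓ) where
    field
      blocks   : All (IsBlock V k) H
      disjoint : AllPairs Disjoint H
      covers   : ∀ {x} → V x → Any (x ∈_) H

  Orthogonal : List (List ∣G∣) → List (List ∣G∣) → Set (c ⊔ ℓ)
  Orthogonal H H′ =
    All (λ B → All (λ B′ → ∀ {x y} → x ∈ B → x ∈ B′ → y ∈ B → y ∈ B′ → x ≈ y) H′) H

-- For k ≥ 2 and V nonempty, a Heffter system is not orthogonal to itself, so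
-- the family indexed by Fin r consists of r distinct systems.
record MOHS (v k r : ℕ) : Set₁ where
  field
    G          : AbelianGroup 0ℓ 0ℓ
    order      : HasOrder G (suc (2 * v))
    order≥7    : 7 ≤ suc (2 * v)
    V          : Pred (AbelianGroup.Carrier G) 0ℓ
    halfSet    : IsHalfSet G V
    system     : Fin r → List (List (AbelianGroup.Carrier G))
    isHeffter  : ∀ i → IsHeffterSystem G V k (system i)
    orthogonal : ∀ i j → i ≢ j → Orthogonal G (system i) (system j)

-- Write q = 2kw + 1 with k and w odd, let ζ be a primitive root of F_q and K = ⟨ζ^(2k)⟩.  As -1 is
-- not a square, the nonzero squares form a half-set V, and V/K is cyclic of order k.  If B ⊆ V is
-- a zero-sum transversal of V/K, then for every c the sets ζ^(2c) κ B with κ ∈ K form a Heffter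
-- system.  Two such systems, from blocks B, B′ and exponents c, c′, are orthogonal as soon as no
-- quotient of two elements of B or of B′ arises twice, so t = ⌈r/k⌉ blocks whose quotients are all
-- distinct give kt ≥ r systems.  The blocks are found greedily.  The first k - 2 elements of a
-- block are chosen one at a time.  The last two, y and z, lie in prescribed cosets and have a
-- prescribed sum b ≠ 0; the number N of such pairs satisfies (qN - w²)² ≤ q(q - w)² by a second
-- moment computation.  Each equation that y and z must avoid has at most one or two solutions,
-- because the coset of one of its members determines that member, and the hypothesis on q makes
-- N exceed the total number of excluded pairs.
--
-- The field F_q is a localisation of A = F_p[x]/(x^m - 1), m = q - 1.  Every element of A
-- satisfies z^q = z, so the powers z^m are idempotent.  The product of the x^(m/ℓ) - 1 over the
-- primes ℓ dividing m is nonzero, and below its m-th power there is an idempotent f that is not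
-- split by any z^m.  Localising at f gives a field in which x has order m, and x^m - 1 has at
-- most m roots, so that the field consists of 0 and the powers of x.

module Submission where

open import Defs
open import Level using (0ℓ)
open import Algebra.Bundles using (CommutativeRing; RawRing; Semiring)
import Algebra.Properties.Semiring.Exp
open import Algebra.Structures using (IsCommutativeRing)
open import Data.Fin using (Fin)
open import Data.Nat as ℕ using (ℕ; suc; NonZero)
open import Data.Nat.Divisibility using (_∣_)
open import Data.Nat.Primality using (Prime)
open import Data.Product using (∃-syntax)
open import Data.Sum using (_⊎_)
open import Relation.Binary.Definitions using (DecidableEquality)
open import Relation.Binary.PropositionalEquality using (_≡_; _≢_)
open import Relation.Nullary using (¬_)

-- Finite fields

-- The zero-sum condition is the obstacle to a purely greedy choice: once the other elements are
-- chosen it fixes the last one, and nothing then places that element in the coset still missing.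
-- Hence two elements are chosen jointly, and one must know how often b is the sum of an element of
-- one coset and an element of another. For a single b this is an additive question about
-- multiplicative cosets, but the average over all maps a ↦ b + u a is elementary; little is lost in
-- passing to a single value, since w² of the pairs (u , b), those in -K × bK, share it.
--
-- The constant balances three quantities. The number of pairs is near w²/q, about w/(2k); the error
-- is below sqrt(q), about sqrt(2kw); the excluded pairs number at most (2k - 1)(k - 1)t. If w ≥
-- 4k⁴t, the excluded pairs take up at most a quarter of w²/q and the error less than three quarters
-- of it. Multiplied by 2k, this condition reads q - 1 = 2kw ≥ 8k⁵t.

module ZMod (n : ℕ) .{{_ : NonZero n}} where
  open import Data.Fin using (toℕ)
  open import Data.Fin.Properties using (toℕ-injective; toℕ-fromℕ<; toℕ<n)
  open import Data.Nat using (_+_; _*_; _∸_; >-nonZero⁻¹)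
  open import Data.Nat.DivMod using (_%_; _mod_; m%n<n; %-distribˡ-+; %-distribˡ-*; m<n⇒m%n≡m; n%n≡0)
  open import Data.Nat.Properties
  open import Data.Product using (_,_)
  open import Relation.Binary.PropositionalEquality hiding ([_])

  [_] : ℕ → Fin n
  [ a ] = a mod n

  toℕ-[] : ∀ a → toℕ [ a ] ≡ a % n
  toℕ-[] a = toℕ-fromℕ< (m%n<n a n)

  []-cong : ∀ {a b} → a % n ≡ b % n → [ a ] ≡ [ b ]
  []-cong {a} {b} eq = toℕ-injective (trans (toℕ-[] a) (trans eq (sym (toℕ-[] b))))

  []-toℕ : ∀ i → [ toℕ i ] ≡ i
  []-toℕ i = toℕ-injective (trans (toℕ-[] (toℕ i)) (m<n⇒m%n≡m (toℕ<n i)))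

  infixl 6 _⊕_
  infixl 7 _⊗_
  infix 8 ⊖_

  _⊕_ _⊗_ : Fin n → Fin n → Fin n
  i ⊕ j = [ toℕ i + toℕ j ]
  i ⊗ j = [ toℕ i * toℕ j ]

  ⊖_ : Fin n → Fin n
  ⊖ i = [ n ∸ toℕ i ]

  []-+ : ∀ a b → [ a + b ] ≡ [ a ] ⊕ [ b ]
  []-+ a b = []-cong (trans (%-distribˡ-+ a b n)
    (cong₂ (λ x y → (x + y) % n) (sym (toℕ-[] a)) (sym (toℕ-[] b))))

  []-* : ∀ a b → [ a * b ] ≡ [ a ] ⊗ [ b ]
  []-* a b = []-cong (trans (%-distribˡ-* a b n)
    (cong₂ (λ x y → (x * y) % n) (sym (toℕ-[] a)) (sym (toℕ-[] b))))

  private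
    -- Every residue is `[ a ]` for some natural a, and `[_]` respects sums and products, so the
    -- ring laws are inherited from ℕ.
    []-elim : ∀ {p} (P : Fin n → Set p) → (∀ a → P [ a ]) → ∀ i → P i
    []-elim P f i = subst P ([]-toℕ i) (f (toℕ i))

  ⊕-assoc : ∀ i j k → i ⊕ j ⊕ k ≡ i ⊕ (j ⊕ k)
  ⊕-assoc = []-elim _ λ a → []-elim _ λ b → []-elim _ λ c → begin
    [ a ] ⊕ [ b ] ⊕ [ c ]   ≡⟨ cong (_⊕ [ c ]) ([]-+ a b) ⟨
    [ a + b ] ⊕ [ c ]       ≡⟨ []-+ (a + b) c ⟨
    [ a + b + c ]           ≡⟨ cong [_] (+-assoc a b c) ⟩
    [ a + (b + c) ]         ≡⟨ []-+ a (b + c) ⟩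
    [ a ] ⊕ [ b + c ]       ≡⟨ cong ([ a ] ⊕_) ([]-+ b c) ⟩
    [ a ] ⊕ ([ b ] ⊕ [ c ]) ∎
    where open ≡-Reasoning

  ⊗-assoc : ∀ i j k → i ⊗ j ⊗ k ≡ i ⊗ (j ⊗ k)
  ⊗-assoc = []-elim _ λ a → []-elim _ λ b → []-elim _ λ c → begin
    [ a ] ⊗ [ b ] ⊗ [ c ]   ≡⟨ cong (_⊗ [ c ]) ([]-* a b) ⟨
    [ a * b ] ⊗ [ c ]       ≡⟨ []-* (a * b) c ⟨
    [ a * b * c ]           ≡⟨ cong [_] (*-assoc a b c) ⟩
    [ a * (b * c) ]         ≡⟨ []-* a (b * c) ⟩
    [ a ] ⊗ [ b * c ]       ≡⟨ cong ([ a ] ⊗_) ([]-* b c) ⟩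
    [ a ] ⊗ ([ b ] ⊗ [ c ]) ∎
    where open ≡-Reasoning

  ⊕-comm : ∀ i j → i ⊕ j ≡ j ⊕ i
  ⊕-comm i j = cong [_] (+-comm (toℕ i) (toℕ j))

  ⊗-comm : ∀ i j → i ⊗ j ≡ j ⊗ i
  ⊗-comm i j = cong [_] (*-comm (toℕ i) (toℕ j))

  ⊕-identityˡ : ∀ i → [ 0 ] ⊕ i ≡ i
  ⊕-identityˡ = []-elim _ λ a → sym ([]-+ 0 a)

  ⊗-identityˡ : ∀ i → [ 1 ] ⊗ i ≡ i
  ⊗-identityˡ = []-elim _ λ a → trans (sym ([]-* 1 a)) (cong [_] (*-identityˡ a))

  ⊖-inverseˡ : ∀ i → ⊖ i ⊕ i ≡ [ 0 ]
  ⊖-inverseˡ i = begin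
    ⊖ i ⊕ i                       ≡⟨ cong (⊖ i ⊕_) ([]-toℕ i) ⟨
    [ n ∸ toℕ i ] ⊕ [ toℕ i ]     ≡⟨ []-+ (n ∸ toℕ i) (toℕ i) ⟨
    [ n ∸ toℕ i + toℕ i ]         ≡⟨ cong [_] (m∸n+n≡m (<⇒≤ (toℕ<n i))) ⟩
    [ n ]                         ≡⟨ []-cong (trans (n%n≡0 n) (sym (m<n⇒m%n≡m (>-nonZero⁻¹ n)))) ⟩
    [ 0 ]                         ∎
    where open ≡-Reasoning

  ⊗-distribʳ : ∀ k i j → (i ⊕ j) ⊗ k ≡ i ⊗ k ⊕ j ⊗ k
  ⊗-distribʳ = []-elim _ λ c → []-elim _ λ a → []-elim _ λ b → begin
    ([ a ] ⊕ [ b ]) ⊗ [ c ]         ≡⟨ cong (_⊗ [ c ]) ([]-+ a b) ⟨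
    [ a + b ] ⊗ [ c ]               ≡⟨ []-* (a + b) c ⟨
    [ (a + b) * c ]                 ≡⟨ cong [_] (*-distribʳ-+ c a b) ⟩
    [ a * c + b * c ]               ≡⟨ []-+ (a * c) (b * c) ⟩
    [ a * c ] ⊕ [ b * c ]           ≡⟨ cong₂ _⊕_ ([]-* a c) ([]-* b c) ⟩
    [ a ] ⊗ [ c ] ⊕ [ b ] ⊗ [ c ]   ∎
    where open ≡-Reasoning

  commutativeRing : CommutativeRing 0ℓ 0ℓ
  commutativeRing = record
    { Carrier = Fin n
    ; _≈_ = _≡_
    ; _+_ = _⊕_
    ; _*_ = _⊗_
    ; -_ = ⊖_
    ; 0# = [ 0 ]
    ; 1# = [ 1 ]
    ; isCommutativeRing = record
      { isRing = record
        { +-isAbelianGroup = record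
          { isGroup = record
            { isMonoid = record
              { isSemigroup = record
                { isMagma = record { isEquivalence = isEquivalence ; ∙-cong = cong₂ _⊕_ }
                ; assoc = ⊕-assoc }
              ; identity = ⊕-identityˡ , λ i → trans (⊕-comm i _) (⊕-identityˡ i) }
            ; inverse = ⊖-inverseˡ , λ i → trans (⊕-comm i _) (⊖-inverseˡ i)
            ; ⁻¹-cong = cong ⊖_ }
          ; comm = ⊕-comm }
        ; *-cong = cong₂ _⊗_
        ; *-assoc = ⊗-assoc
        ; *-identity = ⊗-identityˡ , λ i → trans (⊗-comm i _) (⊗-identityˡ i)
        ; distrib = (λ i j k → trans (⊗-comm i _) (trans (⊗-distribʳ i j k) (cong₂ _⊕_ (⊗-comm j i) (⊗-comm k i))))
                  , ⊗-distribʳ }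
      ; *-comm = ⊗-comm }
    }

-- Sums with at most one nonzero term

module FiniteSum {c ℓ} (A : Semiring c ℓ) where
  open import Data.Fin using (Fin; zero; suc)
  open import Data.Fin.Properties using (suc-injective)
  open import Function using (_∘_)
  open import Relation.Binary.PropositionalEquality using (_≢_)
  open Semiring A hiding (zero)
  open import Algebra.Properties.Semiring.Sum A

  sum-cong : ∀ {n} {f g : Fin n → Carrier} → (∀ i → f i ≈ g i) → sum f ≈ sum g
  sum-cong = sum-cong-≋

  sum-zero : ∀ {n} (f : Fin n → Carrier) → (∀ i → f i ≈ 0#) → sum f ≈ 0#
  sum-zero {n} f f≈0 = trans (sum-cong f≈0) (sum-replicate-zero n)

  sum-single : ∀ {n} (i : Fin n) (f : Fin n → Carrier) →
               (∀ j → j ≢ i → f j ≈ 0#) → sum f ≈ f i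
  sum-single zero f f≈0 =
    trans (+-congˡ (sum-zero (f ∘ suc) λ j → f≈0 (suc j) λ ())) (+-identityʳ _)
  sum-single (suc i) f f≈0 =
    trans (+-cong (f≈0 zero λ ()) (sum-single i (f ∘ suc) λ j j≢i → f≈0 (suc j) (j≢i ∘ suc-injective)))
          (+-identityˡ _)

-- The algebra A[x]/(x^m - 1)

module CyclicAlgebra (A : CommutativeRing 0ℓ 0ℓ) (m : ℕ) .{{_ : NonZero m}} where
  import Algebra.Construct.Pointwise as Pointwise
  import Algebra.Properties.AbelianGroup as AbelianGroupProperties
  import Algebra.Properties.Group as GroupProperties
  import Algebra.Properties.Semiring.Sum as SemiringSum
  open import Data.Fin using (Fin; zero; suc; _≟_)
  open import Data.Fin.Permutation using (Permutation′; permutation)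
  open import Data.Product using (_,_)
  open import Function using (_∘_)
  open import Relation.Binary.PropositionalEquality as ≡ using (_≡_; _≢_)
  import Relation.Binary.Reasoning.Setoid as SetoidReasoning
  open import Relation.Nullary using (yes; no; contradiction)

  private
    module A = CommutativeRing A
    module Z = CommutativeRing (ZMod.commutativeRing m)
    module ZP = AbelianGroupProperties Z.+-abelianGroup
    module ZG = GroupProperties Z.+-group
    open SemiringSum A.semiring
    open FiniteSum A.semiring
    open SetoidReasoning A.setoid

  infixl 7 _*_

  -- Convolution over Z/m: a function on `Fin m` lists the coefficients of a polynomial modulo x^m -
  -- 1, and `δ i` is x^i.
  _*_ : (Fin m → A.Carrier) → (Fin m → A.Carrier) → (Fin m → A.Carrier)
  (u * v) j = ∑[ i < m ] (u i A.* v (j Z.- i))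

  δ : Fin m → Fin m → A.Carrier
  δ i j with i ≟ j
  ... | yes _ = A.1#
  ... | no  _ = A.0#

  δ-≡ : ∀ i → δ i i ≡ A.1#
  δ-≡ i with i ≟ i
  ... | yes _ = ≡.refl
  ... | no i≢i = contradiction ≡.refl i≢i

  δ-≢ : ∀ {i j} → i ≢ j → δ i j ≡ A.0#
  δ-≢ {i} {j} i≢j with i ≟ j
  ... | yes i≡j = contradiction i≡j i≢j
  ... | no _ = ≡.refl

  private
    -‿involutive : ∀ j i → j Z.- (j Z.- i) ≡ i
    -‿involutive j i =
      ≡.trans (≡.cong (j Z.+_) (≡.trans (ZP.⁻¹-anti-homo-∙ j (Z.- i)) (≡.cong (Z._- j) (ZG.⁻¹-involutive i))))
        (≡.trans (≡.cong (j Z.+_) (Z.+-comm i (Z.- j)))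
          (≡.trans (≡.sym (Z.+-assoc j (Z.- j) i))
            (≡.trans (≡.cong (Z._+ i) (Z.-‿inverseʳ j)) (Z.+-identityˡ i))))

    +-cancel : ∀ i j → i Z.+ j Z.- j ≡ i
    +-cancel i j = ≡.trans (Z.+-assoc i j _) (≡.trans (≡.cong (i Z.+_) (Z.-‿inverseʳ j)) (Z.+-identityʳ i))

    -‿cancel : ∀ i j → i Z.- j Z.+ j ≡ i
    -‿cancel i j = ≡.trans (Z.+-assoc i _ j) (≡.trans (≡.cong (i Z.+_) (Z.-‿inverseˡ j)) (Z.+-identityʳ i))

    -‿assoc : ∀ j a b → j Z.- (b Z.+ a) ≡ j Z.- a Z.- b
    -‿assoc j a b = ≡.trans (≡.cong (j Z.+_) (ZP.⁻¹-anti-homo-∙ b a)) (≡.sym (Z.+-assoc j (Z.- a) (Z.- b)))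

    reflection : Fin m → Permutation′ m
    reflection j = permutation (λ i → j Z.- i) (λ i → j Z.- i) (-‿involutive j) (-‿involutive j)

    translation : Fin m → Permutation′ m
    translation j = permutation (Z._+ j) (Z._- j) (λ i → -‿cancel i j) (λ i → +-cancel i j)

  δ-* : ∀ s v j → (δ s * v) j A.≈ v (j Z.- s)
  δ-* s v j = begin
    ∑[ i < m ] (δ s i A.* v (j Z.- i))  ≈⟨ sum-single {m} s _ (λ i i≢s → A.trans (A.*-congʳ (A.reflexive (δ-≢ (i≢s ∘ ≡.sym)))) (A.zeroˡ _)) ⟩
    δ s s A.* v (j Z.- s)               ≈⟨ A.*-congʳ (A.reflexive (δ-≡ s)) ⟩
    A.1# A.* v (j Z.- s)                ≈⟨ A.*-identityˡ _ ⟩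
    v (j Z.- s)                         ∎

  *-comm : ∀ u v j → (u * v) j A.≈ (v * u) j
  *-comm u v j = begin
    ∑[ i < m ] (u i A.* v (j Z.- i))                        ≈⟨ sum-permute {m} {m} _ (reflection j) ⟩
    ∑[ i < m ] (u (j Z.- i) A.* v (j Z.- (j Z.- i)))        ≈⟨ sum-cong {m} (λ i → A.trans (A.*-comm _ _) (A.*-congʳ (A.reflexive (≡.cong v (-‿involutive j i))))) ⟩
    ∑[ i < m ] (v i A.* u (j Z.- i))                        ∎

  *-assoc : ∀ u v w j → (u * v * w) j A.≈ (u * (v * w)) j
  *-assoc u v w j = begin
    ∑[ i < m ] (∑[ a < m ] (u a A.* v (i Z.- a)) A.* w (j Z.- i))
      ≈⟨ sum-cong {m} (λ i → *-distribʳ-sum {m} _ _) ⟩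
    ∑[ i < m ] ∑[ a < m ] (u a A.* v (i Z.- a) A.* w (j Z.- i))
      ≈⟨ ∑-comm {m} {m} _ ⟩
    ∑[ a < m ] ∑[ i < m ] (u a A.* v (i Z.- a) A.* w (j Z.- i))
      ≈⟨ sum-cong {m} (λ a → sum-permute {m} {m} _ (translation a)) ⟩
    ∑[ a < m ] ∑[ b < m ] (u a A.* v (b Z.+ a Z.- a) A.* w (j Z.- (b Z.+ a)))
      ≈⟨ sum-cong {m} (λ a → sum-cong {m} (λ b → A.trans (A.*-assoc _ _ _) (A.*-congˡ (A.*-cong (A.reflexive (≡.cong v (+-cancel b a))) (A.reflexive (≡.cong w (-‿assoc j a b))))))) ⟩
    ∑[ a < m ] ∑[ b < m ] (u a A.* (v b A.* w (j Z.- a Z.- b)))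
      ≈⟨ sum-cong {m} (λ a → A.sym (*-distribˡ-sum {m} _ _)) ⟩
    ∑[ a < m ] (u a A.* (v * w) (j Z.- a)) ∎

  *-distribʳ : ∀ w u v j → ((λ i → u i A.+ v i) * w) j A.≈ (u * w) j A.+ (v * w) j
  *-distribʳ w u v j = A.trans (sum-cong {m} (λ i → A.distribʳ _ _ _)) (∑-distrib-+ {m} _ _)

  *-identityˡ : ∀ v j → (δ Z.0# * v) j A.≈ v j
  *-identityˡ v j = A.trans (δ-* Z.0# v j) (A.reflexive (≡.cong v (≡.trans (≡.cong (j Z.+_) ZG.ε⁻¹≈ε) (Z.+-identityʳ j))))

  δ-homo : ∀ i j k → (δ i * δ j) k A.≈ δ (i Z.+ j) k
  δ-homo i j k = A.trans (δ-* i (δ j) k) (A.reflexive (shift k))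
    where
    shift : ∀ k → δ j (k Z.- i) ≡ δ (i Z.+ j) k
    shift k with j ≟ k Z.- i | i Z.+ j ≟ k
    ... | yes _  | yes _ = ≡.refl
    ... | no  _  | no  _ = ≡.refl
    ... | yes eq | no ne = contradiction (≡.trans (≡.cong (i Z.+_) eq) (≡.trans (Z.+-comm i _) (-‿cancel k i))) ne
    ... | no ne  | yes eq = contradiction (≡.sym (≡.trans (≡.cong (Z._- i) (≡.trans (≡.sym eq) (Z.+-comm i j))) (+-cancel j i))) ne

  commutativeRing : CommutativeRing 0ℓ 0ℓ
  commutativeRing = record
    { Carrier = Fin m → A.Carrier
    ; _≈_ = λ u v → ∀ j → u j A.≈ v j
    ; _+_ = λ u v j → u j A.+ v j
    ; _*_ = _*_
    ; -_ = λ u j → A.- u j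
    ; 0# = λ _ → A.0#
    ; 1# = δ Z.0#
    ; isCommutativeRing = record
      { isRing = record
        { +-isAbelianGroup = Pointwise.isAbelianGroup (Fin m) A.+-isAbelianGroup
        ; *-cong = λ u≈u′ v≈v′ j → sum-cong {m} (λ i → A.*-cong (u≈u′ i) (v≈v′ (j Z.- i)))
        ; *-assoc = *-assoc
        ; *-identity = *-identityˡ , λ v j → A.trans (*-comm v (δ Z.0#) j) (*-identityˡ v j)
        ; distrib = (λ w u v j → A.trans (*-comm w _ j) (A.trans (*-distribʳ w u v j) (A.+-cong (*-comm u w j) (*-comm v w j))))
                  , *-distribʳ }
      ; *-comm = *-comm }
    }

  sum-apply : ∀ {n} (f : Fin n → Fin m → A.Carrier) j →
              SemiringSum.sum (CommutativeRing.semiring commutativeRing) f j ≡ sum (λ i → f i j)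
  sum-apply {ℕ.zero} f j = ≡.refl
  sum-apply {ℕ.suc n} f j = ≡.cong (f zero j A.+_) (sum-apply (f ∘ suc) j)

-- The Frobenius map in characteristic p

module Frobenius where
  open import Algebra.Bundles using (CommutativeSemiring)
  import Algebra.Properties.CommutativeSemiring.Binomial as Binomial
  import Algebra.Properties.CommutativeSemiring.Exp as Exp
  import Algebra.Properties.Semiring.Mult as Mult
  open import Data.Fin using (Fin; zero; suc; toℕ; fromℕ)
  open import Data.Fin.Properties using (toℕ<n; toℕ-fromℕ; toℕ-injective)
  open import Data.Nat as ℕ using (ℕ; zero; suc; _!; _<_; _≤_; _∸_; s≤s; z≤n; NonZero)
  open import Data.Nat.Combinatorics
  open import Data.Nat.Divisibility
  open import Data.Nat.DivMod using (m/n*n≡m)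
  open import Data.Nat.Primality
  open import Data.Nat.Properties as ℕ using (<⇒≤; m≤n⇒m≤1+n; <⇒≱; ≤∧≢⇒<; ∸-monoʳ-<; n∸n≡0; _!*_!≢0)
  open import Data.Sum using (inj₁; inj₂)
  open import Relation.Binary.PropositionalEquality as ≡ using (_≡_; _≢_)
  open import Relation.Nullary using (contradiction)

  prime∣!⇒≤ : ∀ {p} → Prime p → ∀ n → p ∣ n ! → p ≤ n
  prime∣!⇒≤ pr zero p∣1 = contradiction (≡.subst Prime (∣1⇒≡1 p∣1) pr) ¬prime[1]
  prime∣!⇒≤ pr (suc n) p∣ with euclidsLemma (suc n) (n !) pr p∣
  ... | inj₁ p∣1+n = ∣⇒≤ p∣1+n
  ... | inj₂ p∣n!  = m≤n⇒m≤1+n (prime∣!⇒≤ pr n p∣n!)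

  C*!!≡! : ∀ {n k} → k ≤ n → (n C k) ℕ.* (k ! ℕ.* (n ∸ k) !) ≡ n !
  C*!!≡! {n} {k} k≤n = ≡.trans (≡.cong (ℕ._* (k ! ℕ.* (n ∸ k) !)) (nCk≡n!/k![n-k]! k≤n)) (m/n*n≡m (k![n∸k]!∣n! k≤n))
    where instance _ = k !* (n ∸ k) !≢0

  n∣n! : ∀ n → .{{NonZero n}} → n ∣ n !
  n∣n! (suc n) = m∣m*n (n !)

  -- p divides p! = C(p,k) k! (p - k)!, but neither of the two factorials, whose arguments are below
  -- p.
  prime∣C : ∀ {p} → Prime p → ∀ {k} → 0 < k → k < p → p ∣ p C k
  prime∣C {p} pr {k} 0<k k<p
    with euclidsLemma (p C k) (k ! ℕ.* (p ∸ k) !) pr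
           (≡.subst (p ∣_) (≡.sym (C*!!≡! (<⇒≤ k<p))) (n∣n! p {{prime⇒nonZero pr}}))
  ... | inj₁ p∣C = p∣C
  ... | inj₂ p∣!! with euclidsLemma (k !) ((p ∸ k) !) pr p∣!!
  ...   | inj₁ p∣k! = contradiction (prime∣!⇒≤ pr k p∣k!) (<⇒≱ k<p)
  ...   | inj₂ p∣[p∸k]! = contradiction (prime∣!⇒≤ pr (p ∸ k) p∣[p∸k]!) (<⇒≱ (∸-monoʳ-< 0<k (<⇒≤ k<p)))

  module _ {c ℓ} (R : CommutativeSemiring c ℓ) where
    open CommutativeSemiring R hiding (zero)
    open Binomial R using (binomialTerm; theorem)
    open Exp R
    open Mult semiring

    ∣⇒×≈0 : ∀ {n k} → (∀ x → n × x ≈ 0#) → n ∣ k → ∀ x → k × x ≈ 0#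
    ∣⇒×≈0 {n} char (divides j k≡jn) x = trans (×-congˡ {x} (≡.trans k≡jn (ℕ.*-comm j n))) (trans (sym (×-assocˡ x n j)) (char _))

    -- In the binomial expansion every coefficient strictly between the ends is a multiple of p, so
    -- only the terms k = 0 and k = p survive.
    frobenius : ∀ {p} → Prime p → (∀ x → p × x ≈ 0#) → ∀ x y → (x + y) ^ p ≈ x ^ p + y ^ p
    frobenius {zero} pr = contradiction pr ¬prime[0]
    frobenius {suc p} pr char x y = trans (theorem (suc p) x y) (trans (+-cong first rest) (+-comm _ _))
      where
      first : binomialTerm x y (suc p) zero ≈ y ^ suc p
      first = trans (×-congˡ (≡.trans (nCk≡nC[n∸k] {0} {suc p} z≤n) (nCn≡1 (suc p)))) (trans (+-identityʳ _) (*-identityˡ _))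
      inner : ∀ k → k ≢ fromℕ p → binomialTerm x y (suc p) (suc k) ≈ 0#
      inner k k≢p = ∣⇒×≈0 char (prime∣C pr (s≤s z≤n) (s≤s k<p)) _
        where
        k<p : toℕ k < p
        k<p = ≤∧≢⇒< (ℕ.≤-pred (toℕ<n k)) (λ k≡p → k≢p (toℕ-injective (≡.trans k≡p (≡.sym (toℕ-fromℕ p)))))
      last : binomialTerm x y (suc p) (suc (fromℕ p)) ≈ x ^ suc p
      last = trans (×-congˡ C≡1) (trans (+-identityʳ _)
        (trans (*-congˡ (^-congʳ y ∸≡0)) (trans (*-identityʳ _) (^-congʳ x (≡.cong suc (toℕ-fromℕ p))))))
        where
        C≡1 : suc p C suc (toℕ (fromℕ p)) ≡ 1
        C≡1 = ≡.trans (≡.cong (λ k → suc p C suc k) (toℕ-fromℕ p)) (nCn≡1 (suc p))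
        ∸≡0 : p ∸ toℕ (fromℕ p) ≡ 0
        ∸≡0 = ≡.trans (≡.cong (p ∸_) (toℕ-fromℕ p)) (n∸n≡0 p)
      rest = trans (FiniteSum.sum-single semiring (fromℕ p) _ inner) last

    frobenius^ : ∀ {p} → Prime p → (∀ x → p × x ≈ 0#) → ∀ n x y →
                 (x + y) ^ (p ℕ.^ n) ≈ x ^ (p ℕ.^ n) + y ^ (p ℕ.^ n)
    frobenius^ pr char zero x y = trans (*-identityʳ _) (+-cong (sym (*-identityʳ _)) (sym (*-identityʳ _)))
    frobenius^ {p} pr char (suc n) x y = begin
      (x + y) ^ (p ℕ.* q)              ≈⟨ ^-assocʳ (x + y) p q ⟨
      ((x + y) ^ p) ^ q                ≈⟨ ^-congˡ q (frobenius pr char x y) ⟩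
      (x ^ p + y ^ p) ^ q              ≈⟨ frobenius^ pr char n _ _ ⟩
      (x ^ p) ^ q + (y ^ p) ^ q        ≈⟨ +-cong (^-assocʳ x p q) (^-assocʳ y p q) ⟩
      x ^ (p ℕ.* q) + y ^ (p ℕ.* q)    ∎
      where
      q = p ℕ.^ n
      open import Relation.Binary.Reasoning.Setoid setoid

-- Multiples and divisibility of residues

module ModularArithmetic where
  import Algebra.Properties.Semiring.Mult as Mult
  open import Data.Fin using (toℕ)
  open import Data.Nat using (zero)
  open import Data.Nat.Divisibility
  open import Relation.Binary.PropositionalEquality as ≡ using (refl)

  ×-[] : ∀ n .{{_ : NonZero n}} c a → let open CommutativeRing (ZMod.commutativeRing n) in
         Mult._×_ semiring c (ZMod.[_] n a) ≡ ZMod.[_] n (c ℕ.* a)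
  ×-[] n zero a = refl
  ×-[] n (suc c) a = ≡.trans (≡.cong (ZMod._⊕_ n (ZMod.[_] n a)) (×-[] n c a)) (≡.sym (ZMod.[]-+ n a (c ℕ.* a)))

  [n*]≡0 : ∀ n .{{_ : NonZero n}} a → ZMod.[_] n (n ℕ.* a) ≡ ZMod.[_] n 0
  [n*]≡0 n a = ZMod.[]-cong n (≡.trans (n∣m⇒m%n≡0 (n ℕ.* a) n (m∣m*n a)) (≡.sym (n∣m⇒m%n≡0 0 n (n ∣0))))

  module _ (n : ℕ) .{{_ : NonZero n}} {c : ℕ} (c∣n : c ∣ n) where
    open ZMod n

    -- As c divides n, divisibility by c does not depend on the representative modulo n; this is how
    -- supports in Z/m and parities of classes are handled later.
    ∣toℕ[]⇒∣ : ∀ {a} → c ∣ toℕ [ a ] → c ∣ a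
    ∣toℕ[]⇒∣ {a} d = ∣n∣m%n⇒∣m c∣n (≡.subst (c ∣_) (toℕ-[] a) d)

    ∣⇒∣toℕ[] : ∀ {a} → c ∣ a → c ∣ toℕ [ a ]
    ∣⇒∣toℕ[] {a} d = ≡.subst (c ∣_) (≡.sym (toℕ-[] a)) (%-presˡ-∣ d c∣n)

    ∣-⊕ : ∀ {i j} → c ∣ toℕ i → c ∣ toℕ j → c ∣ toℕ (i ⊕ j)
    ∣-⊕ d e = ∣⇒∣toℕ[] (∣m∣n⇒∣m+n d e)

    ∣⊖⇒∣ : ∀ i → c ∣ toℕ (⊖ i) → c ∣ toℕ i
    ∣⊖⇒∣ i d = ∣m+n∣m⇒∣n (∣toℕ[]⇒∣ (≡.subst (λ j → c ∣ toℕ j) (≡.sym (⊖-inverseˡ i)) (∣⇒∣toℕ[] (c ∣0)))) d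

-- The algebra F_p[x]/(x^m - 1) with m = pⁿ - 1

module CyclotomicAlgebra (p : ℕ) (p-prime : Prime p) (n m : ℕ) .{{_ : NonZero m}} (1+m≡pⁿ : suc m ≡ p ℕ.^ n) where
  import Algebra.Properties.CommutativeSemiring.Exp as Exp
  import Algebra.Properties.CommutativeSemigroup as CommutativeSemigroupProperties
  import Algebra.Properties.Group as GroupProperties
  import Algebra.Properties.Ring as RingProperties
  import Algebra.Properties.Semiring.Mult as Mult
  import Algebra.Properties.Semiring.Sum as Sum
  open import Data.Fin as Fin using (Fin; zero; suc; toℕ)
  open import Data.Fin.Properties using (all?)
  open import Data.Nat using (zero; _<_)
  open import Data.Nat.Divisibility
  open import Data.Nat.Primality
  open import Data.Nat.Properties as ℕ using (m≤n⇒m≤1+n; n≮0)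
  open import Data.Product using (_×_; _,_; ∃-syntax)
  open import Data.Sum using (inj₁; inj₂)
  open import Function using (_∘_)
  open import Relation.Binary.PropositionalEquality as ≡ using (_≡_; _≢_; refl)
  open import Relation.Nullary using (¬_; Dec; yes; no; contradiction; _×-dec_)
  open ModularArithmetic

  instance
    p-nonZero : NonZero p
    p-nonZero = prime⇒nonZero p-prime

  module A = CommutativeRing (ZMod.commutativeRing p)
  module Z = CommutativeRing (ZMod.commutativeRing m)
  open CyclicAlgebra (ZMod.commutativeRing p) m using (δ; δ-≡; δ-≢; δ-*; δ-homo; sum-apply)

  ring : CommutativeRing _ _
  ring = CyclicAlgebra.commutativeRing (ZMod.commutativeRing p) m

  open CommutativeRing ring hiding (zero; refl; ring)
  open Exp commutativeSemiring
  open Mult semiring renaming (_×_ to _·_)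
  open Sum semiring using (sum)

  _≈?_ : ∀ u v → Dec (u ≈ v)
  u ≈? v = all? λ j → u j Fin.≟ v j

  ·-apply : ∀ c u j → (c · u) j ≡ Mult._×_ A.semiring c (u j)
  ·-apply zero u j = refl
  ·-apply (suc c) u j = ≡.cong (u j A.+_) (·-apply c u j)

  characteristic : ∀ u → p · u ≈ 0#
  characteristic u j = ≡.trans (·-apply p u j) (≡.trans (≡.cong (Mult._×_ A.semiring p) (≡.sym (ZMod.[]-toℕ p (u j))))
    (≡.trans (×-[] p p (toℕ (u j))) ([n*]≡0 p (toℕ (u j)))))

  Fixed : Carrier → Set
  Fixed u = u ^ suc m ≈ u

  fixed-0 : Fixed 0#
  fixed-0 = zeroˡ (0# ^ m)

  fixed-+ : ∀ {u v} → Fixed u → Fixed v → Fixed (u + v)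
  fixed-+ {u} {v} fu fv = trans (^-congʳ (u + v) 1+m≡pⁿ) (trans (Frobenius.frobenius^ commutativeSemiring p-prime characteristic n u v)
    (+-cong (trans (^-congʳ u (≡.sym 1+m≡pⁿ)) fu) (trans (^-congʳ v (≡.sym 1+m≡pⁿ)) fv)))

  fixed-· : ∀ c {u} → Fixed u → Fixed (c · u)
  fixed-· zero fu = fixed-0
  fixed-· (suc c) fu = fixed-+ fu (fixed-· c fu)

  fixed-sum : ∀ {k} (f : Fin k → Carrier) → (∀ i → Fixed (f i)) → Fixed (sum f)
  fixed-sum {zero} f ff = fixed-0
  fixed-sum {suc k} f ff = fixed-+ (ff zero) (fixed-sum (f ∘ suc) (ff ∘ suc))

  δ-^ : ∀ i e → δ i ^ e ≈ δ (Mult._×_ Z.semiring e i)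
  δ-^ i zero j = refl
  δ-^ i (suc e) = trans (*-congˡ {δ i} (δ-^ i e)) (δ-homo i _)

  δ-[]-^ : ∀ e → δ (ZMod.[_] m 1) ^ e ≈ δ (ZMod.[_] m e)
  δ-[]-^ e = trans (δ-^ _ e) (reflexive (≡.cong δ (≡.trans (×-[] m e 1) (≡.cong (ZMod.[_] m) (ℕ.*-identityʳ e)))))

  fixed-δ : ∀ i → Fixed (δ i)
  fixed-δ i = trans (δ-^ i (suc m)) (reflexive (≡.cong δ (≡.trans (≡.cong (i Z.+_)
    (≡.trans (≡.cong (Mult._×_ Z.semiring m) (≡.sym (ZMod.[]-toℕ m i))) (≡.trans (×-[] m m (toℕ i)) ([n*]≡0 m (toℕ i))))) (Z.+-identityʳ i))))

  -- u is the sum of its coefficients times powers of x. The q-th power map is additive, being an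
  -- iterate of Frobenius, and fixes each `δ i` because m i = 0 in Z/m; a coefficient acts as
  -- repeated addition, so additivity covers it as well.
  fixed : ∀ u → Fixed u
  fixed u = trans (^-congˡ (suc m) expand) (trans (fixed-sum _ λ i → fixed-· (toℕ (u i)) (fixed-δ i)) (sym expand))
    where
    term : Fin m → Carrier
    term i = toℕ (u i) · δ i
    diagonal : ∀ j → term j j ≡ u j
    diagonal j = ≡.trans (·-apply (toℕ (u j)) (δ j) j) (≡.trans (≡.cong (Mult._×_ A.semiring (toℕ (u j))) (δ-≡ j))
      (≡.trans (×-[] p (toℕ (u j)) 1) (≡.trans (≡.cong (ZMod.[_] p) (ℕ.*-identityʳ _)) (ZMod.[]-toℕ p (u j)))))
    off : ∀ j i → i ≢ j → term i j ≡ A.0#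
    off j i i≢j = ≡.trans (·-apply (toℕ (u i)) (δ i) j) (≡.trans (≡.cong (Mult._×_ A.semiring (toℕ (u i))) (δ-≢ i≢j))
      (≡.trans (×-[] p (toℕ (u i)) 0) (≡.cong (ZMod.[_] p) (ℕ.*-zeroʳ (toℕ (u i))))))
    expand : u ≈ sum term
    expand j = ≡.sym (≡.trans (sum-apply term j) (≡.trans (FiniteSum.sum-single A.semiring {m} j (λ i → term i j) (off j)) (diagonal j)))

  -- The support of the product of the x^(m/ℓ) - 1 over the primes ℓ < j lies in
  -- the multiples of c = m/ρ, where ρ is the product of these ℓ; as c ∤ m/ℓ for
  -- the next prime ℓ, the constant coefficient only changes its sign.
  record Truncation (j : ℕ) : Set where
    field
      value     : Carrier
      c ρ       : ℕ
      m≡cρ      : m ≡ c ℕ.* ρ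
      ρ-smooth  : ∀ {ℓ} → Prime ℓ → ℓ ∣ ρ → ℓ < j
      support   : ∀ i → value i ≢ A.0# → c ∣ toℕ i
      constant  : value Z.0# ≢ A.0#
      divisible : ∀ {ℓ} → Prime ℓ → ℓ < j → ∀ e → m ≡ e ℕ.* ℓ →
                  ∃[ v ] value ≈ (δ (ZMod.[_] m e) - 1#) * v

  1≢0 : A.1# ≢ A.0#
  1≢0 eq = ¬prime[1] (≡.subst Prime (∣1⇒≡1 (∣toℕ[]⇒∣ p ∣-refl (≡.subst (λ i → p ∣ toℕ i) (≡.sym eq) (∣⇒∣toℕ[] p ∣-refl (p ∣0))))) p-prime)

  truncation : ∀ j → Truncation j
  truncation zero = record
    { value = 1# ; c = m ; ρ = 1 ; m≡cρ = ≡.sym (ℕ.*-identityʳ m)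
    ; ρ-smooth = λ pr d → contradiction (≡.subst Prime (∣1⇒≡1 d) pr) ¬prime[1]
    ; support = supp
    ; constant = λ eq → 1≢0 (≡.trans (≡.sym (δ-≡ Z.0#)) eq)
    ; divisible = λ _ ℓ<0 → contradiction ℓ<0 n≮0 }
    where
    supp : ∀ i → 1# i ≢ A.0# → m ∣ toℕ i
    supp i ne with Z.0# Fin.≟ i
    ... | yes refl = ∣⇒∣toℕ[] m ∣-refl (m ∣0)
    ... | no _ = contradiction refl ne
  truncation (suc j) with prime? j ×-dec (j ∣? m)
  ... | no ¬j = record
    { value = value ; c = c ; ρ = ρ ; m≡cρ = m≡cρ
    ; ρ-smooth = λ pr d → m≤n⇒m≤1+n (ρ-smooth pr d)
    ; support = support ; constant = constant ; divisible = div }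
    where
    open Truncation (truncation j)
    div : ∀ {ℓ} → Prime ℓ → ℓ < suc j → ∀ e → m ≡ e ℕ.* ℓ → ∃[ v ] value ≈ (δ (ZMod.[_] m e) - 1#) * v
    div {ℓ} pr ℓ<1+j e eq with ℕ.m<1+n⇒m<n∨m≡n ℓ<1+j
    ... | inj₁ ℓ<j = divisible pr ℓ<j e eq
    ... | inj₂ refl = contradiction (pr , divides e eq) ¬j
  ... | yes (j-prime , divides e m≡ej) = record
    { value = (δ s - 1#) * value ; c = c′ ; ρ = ρ ℕ.* j
    ; m≡cρ = ≡.trans m≡ej (≡.trans (≡.cong (ℕ._* j) e≡c′ρ) (ℕ.*-assoc c′ ρ j))
    ; ρ-smooth = smooth
    ; support = supp
    ; constant = const
    ; divisible = div }
    where
    open Truncation (truncation j)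
    s = ZMod.[_] m e

    -- j divides m = c ρ but not ρ, whose prime factors are all smaller than j.
    j∣c : j ∣ c
    j∣c with euclidsLemma c ρ j-prime (≡.subst (j ∣_) m≡cρ (divides e m≡ej))
    ... | inj₁ d = d
    ... | inj₂ d = contradiction (ρ-smooth j-prime d) (ℕ.<-irrefl refl)

    instance
      j-nonZero : NonZero j
      j-nonZero = prime⇒nonZero j-prime

    c′ = quotient j∣c
    c≡c′j : c ≡ c′ ℕ.* j
    c≡c′j = _∣_.equality j∣c

    e≡c′ρ : e ≡ c′ ℕ.* ρ
    e≡c′ρ = ℕ.*-cancelʳ-≡ e (c′ ℕ.* ρ) j (≡.trans (≡.sym m≡ej) (≡.trans m≡cρ (≡.trans (≡.cong (ℕ._* ρ) c≡c′j)
      (≡.trans (ℕ.*-assoc c′ j ρ) (≡.trans (≡.cong (c′ ℕ.*_) (ℕ.*-comm j ρ)) (≡.sym (ℕ.*-assoc c′ ρ j)))))))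

    c∣m : c ∣ m
    c∣m = divides ρ (≡.trans m≡cρ (ℕ.*-comm c ρ))
    c′∣c : c′ ∣ c
    c′∣c = divides j (≡.trans c≡c′j (ℕ.*-comm c′ j))
    c′∣m : c′ ∣ m
    c′∣m = ∣-trans c′∣c c∣m

    -- As e = c′ ρ and c = c′ j, divisibility of e by c would give j ∣ ρ.
    c∤e : ¬ c ∣ e
    c∤e (divides f e≡fc) = ℕ.<-irrefl refl (ρ-smooth j-prime (divides f (ℕ.*-cancelˡ-≡ ρ (f ℕ.* j) c′ {{c′-nonZero}} c′ρ≡c′fj)))
      where
      c′-nonZero : NonZero c′
      c′-nonZero = ℕ.≢-nonZero λ c′≡0 → ℕ.≢-nonZero⁻¹ m (≡.trans m≡ej (≡.cong (ℕ._* j) (≡.trans e≡c′ρ (≡.cong (ℕ._* ρ) c′≡0))))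
      c′ρ≡c′fj : c′ ℕ.* ρ ≡ c′ ℕ.* (f ℕ.* j)
      c′ρ≡c′fj = ≡.trans (≡.sym e≡c′ρ) (≡.trans e≡fc (≡.trans (≡.cong (f ℕ.*_) c≡c′j)
        (≡.trans (≡.sym (ℕ.*-assoc f c′ j)) (≡.trans (≡.cong (ℕ._* j) (ℕ.*-comm f c′)) (ℕ.*-assoc c′ f j)))))

    -- Multiplication by x^s shifts the coefficients, so multiplication by x^s - 1 takes a
    -- difference.
    apply : ∀ i → ((δ s - 1#) * value) i ≡ value (i Z.- s) A.- value i
    apply i = ≡.trans (RingProperties.[y-z]x≈yx-zx (CommutativeRing.ring ring) value (δ s) 1# i)
      (≡.cong₂ A._-_ (δ-* s value i) (*-identityˡ value i))

    smooth : ∀ {ℓ} → Prime ℓ → ℓ ∣ ρ ℕ.* j → ℓ < suc j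
    smooth {ℓ} pr d with euclidsLemma ρ j pr d
    ... | inj₁ ℓ∣ρ = m≤n⇒m≤1+n (ρ-smooth pr ℓ∣ρ)
    ... | inj₂ ℓ∣j = ℕ.s≤s (∣⇒≤ ℓ∣j)

    supp : ∀ i → ((δ s - 1#) * value) i ≢ A.0# → c′ ∣ toℕ i
    supp i ne with value i Fin.≟ A.0# | value (i Z.- s) Fin.≟ A.0#
    ... | no vi≢0 | _ = ∣-trans c′∣c (support i vi≢0)
    ... | yes vi≡0 | yes vis≡0 = contradiction (≡.trans (apply i) (≡.trans (≡.cong₂ A._-_ vis≡0 vi≡0) (A.-‿inverseʳ A.0#))) ne
    ... | yes _ | no vis≢0 = ≡.subst (λ i → c′ ∣ toℕ i)
            (≡.trans (Z.+-assoc i (Z.- s) s) (≡.trans (≡.cong (i Z.+_) (Z.-‿inverseˡ s)) (Z.+-identityʳ i)))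
            (∣-⊕ m c′∣m (∣-trans c′∣c (support _ vis≢0)) (∣⇒∣toℕ[] m c′∣m (≡.subst (c′ ∣_) (≡.sym e≡c′ρ) (m∣m*n ρ))))

    -- The index -s is not a multiple of c, so its coefficient vanishes by `support`, and the new
    -- constant term is minus the old one.
    const : ((δ s - 1#) * value) Z.0# ≢ A.0#
    const eq with value (Z.0# Z.- s) Fin.≟ A.0#
    ... | no v≢0 = c∤e (∣toℕ[]⇒∣ m c∣m (∣⊖⇒∣ m c∣m s (≡.subst (λ i → c ∣ toℕ i) (Z.+-identityˡ (Z.- s)) (support _ v≢0))))
    ... | yes v≡0 = constant (A-group.⁻¹-injective (≡.trans (≡.sym (≡.trans (apply Z.0#) (≡.trans (≡.cong (A._- value Z.0#) v≡0) (A.+-identityˡ _)))) (≡.trans eq (≡.sym A-group.ε⁻¹≈ε))))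
      where module A-group = GroupProperties A.+-group

    div : ∀ {ℓ} → Prime ℓ → ℓ < suc j → ∀ e′ → m ≡ e′ ℕ.* ℓ → ∃[ v ] (δ s - 1#) * value ≈ (δ (ZMod.[_] m e′) - 1#) * v
    div {ℓ} pr ℓ<1+j e′ eq with ℕ.m<1+n⇒m<n∨m≡n ℓ<1+j
    ... | inj₂ refl = value , reflexive (≡.cong (λ x → (δ (ZMod.[_] m x) - 1#) * value) (ℕ.*-cancelʳ-≡ e e′ j (≡.trans (≡.sym m≡ej) eq)))
    ... | inj₁ ℓ<j with divisible pr ℓ<j e′ eq
    ...   | v , value≈ = (δ s - 1#) * v , trans (*-congˡ {δ s - 1#} value≈)
            (CommutativeSemigroupProperties.x∙yz≈y∙xz *-commutativeSemigroup (δ s - 1#) (δ (ZMod.[_] m e′) - 1#) v)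

-- Localising at an idempotent f that no z^m splits further makes every z^m
-- either 0 or 1, so that z^(m-1) inverts every nonzero z.
module Localisation (R : CommutativeRing 0ℓ 0ℓ) where
  open CommutativeRing R
  open import Algebra.Properties.CommutativeSemiring.Exp commutativeSemiring
  open import Algebra.Properties.CommutativeSemigroup *-commutativeSemigroup using (x∙yz≈y∙xz)
  open import Algebra.Properties.Ring ring using (-‿distribʳ-*)
  open import Data.List using (List; []; _∷_)
  open import Data.List.Relation.Unary.All as All using (All; []; _∷_)
  open import Data.Nat as ℕ using (suc)
  open import Data.Product using (_×_; _,_; ∃-syntax)
  open import Data.Sum using (_⊎_; inj₁; inj₂)
  open import Relation.Binary.Definitions using (Decidable)
  import Relation.Binary.PropositionalEquality as ≡
  open import Relation.Binary.Reasoning.Setoid setoid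
  open import Relation.Nullary using (¬_; yes; no)

  module _ (_≈?_ : Decidable _≈_) (l : ℕ) (fixed : ∀ z → z ^ suc (suc l) ≈ z) where

    private
      m = suc l

    idempotent : ∀ z → z ^ m * z ^ m ≈ z ^ m
    idempotent z = begin
      z ^ m * z ^ m           ≈⟨ *-assoc z (z ^ l) (z ^ m) ⟩
      z * (z ^ l * z ^ m)     ≈⟨ x∙yz≈y∙xz z (z ^ l) (z ^ m) ⟩
      z ^ l * (z * z ^ m)     ≈⟨ *-congˡ (fixed z) ⟩
      z ^ l * z               ≈⟨ *-comm _ _ ⟩
      z ^ m                   ∎

    Unsplit : Carrier → Carrier → Set
    Unsplit f z = f * z ^ m ≈ 0# ⊎ f * z ^ m ≈ f

    -- The start y^m makes y a unit after localising. A z with f z^m ≠ 0 is absorbed by passing from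
    -- f to f z^m, on which the idempotent z^m acts as 1; the alternatives settled for earlier
    -- elements survive this multiplication.
    unsplit : ∀ y → ¬ y ≈ 0# → (zs : List Carrier) →
              ∃[ f ] ¬ f ≈ 0# × f * y ^ m ≈ f × All (Unsplit f) zs
    unsplit y y≉0 [] = y ^ m , (λ eq → y≉0 (trans (sym (fixed y)) (trans (*-congˡ eq) (zeroʳ y)))) , idempotent y , []
    unsplit y y≉0 (z ∷ zs) with unsplit y y≉0 zs
    ... | f , f≉0 , fy≈f , all with (f * z ^ m) ≈? 0#
    ...   | yes fz≈0 = f , f≉0 , fy≈f , inj₁ fz≈0 ∷ all
    ...   | no fz≉0 = f * z ^ m , fz≉0 , trans (swap f _ _) (*-congʳ fy≈f)
                    , inj₂ (trans (*-assoc _ _ _) (*-congˡ (idempotent z))) ∷ All.map weaken all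
      where
      swap : ∀ a b c → a * b * c ≈ a * c * b
      swap a b c = trans (*-assoc a b c) (trans (*-congˡ (*-comm b c)) (sym (*-assoc a c b)))
      weaken : ∀ {z′} → Unsplit f z′ → Unsplit (f * z ^ m) z′
      weaken (inj₁ eq) = inj₁ (trans (swap f _ _) (trans (*-congʳ eq) (zeroˡ _)))
      weaken (inj₂ eq) = inj₂ (trans (swap f _ _) (*-congʳ eq))

  module _ (f : Carrier) where
    infix 4 _∼_
    -- Localising keeps the carrier and coarsens the equality. The quotient is R/Ann(f), which for
    -- an idempotent f is the localisation at f.
    _∼_ : Carrier → Carrier → Set
    a ∼ b = f * a ≈ f * b

    ≈⇒∼ : ∀ {a b} → a ≈ b → a ∼ b
    ≈⇒∼ = *-congˡ

    localisation : CommutativeRing 0ℓ 0ℓ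
    localisation = record
      { Carrier = Carrier ; _≈_ = _∼_ ; _+_ = _+_ ; _*_ = _*_ ; -_ = -_ ; 0# = 0# ; 1# = 1#
      ; isCommutativeRing = record
        { isRing = record
          { +-isAbelianGroup = record
            { isGroup = record
              { isMonoid = record
                { isSemigroup = record
                  { isMagma = record
                    { isEquivalence = record { refl = refl ; sym = sym ; trans = trans }
                    ; ∙-cong = λ {a} {b} {c} {d} a∼b c∼d → trans (distribˡ f a c) (trans (+-cong a∼b c∼d) (sym (distribˡ f b d))) }
                  ; assoc = λ a b c → ≈⇒∼ (+-assoc a b c) }
                ; identity = (λ a → ≈⇒∼ (+-identityˡ a)) , (λ a → ≈⇒∼ (+-identityʳ a)) }
              ; inverse = (λ a → ≈⇒∼ (-‿inverseˡ a)) , (λ a → ≈⇒∼ (-‿inverseʳ a))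
              ; ⁻¹-cong = λ {a} {b} a∼b → trans (sym (-‿distribʳ-* f a)) (trans (-‿cong a∼b) (-‿distribʳ-* f b)) }
            ; comm = λ a b → ≈⇒∼ (+-comm a b) }
          ; *-cong = λ {a} {b} {c} {d} a∼b c∼d → begin
              f * (a * c)   ≈⟨ *-assoc f a c ⟨
              f * a * c     ≈⟨ *-congʳ a∼b ⟩
              f * b * c     ≈⟨ *-assoc f b c ⟩
              f * (b * c)   ≈⟨ x∙yz≈y∙xz f b c ⟩
              b * (f * c)   ≈⟨ *-congˡ c∼d ⟩
              b * (f * d)   ≈⟨ x∙yz≈y∙xz b f d ⟩
              f * (b * d)   ∎
          ; *-assoc = λ a b c → ≈⇒∼ (*-assoc a b c)
          ; *-identity = (λ a → ≈⇒∼ (*-identityˡ a)) , (λ a → ≈⇒∼ (*-identityʳ a))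
          ; distrib = (λ a b c → ≈⇒∼ (distribˡ a b c)) , (λ a b c → ≈⇒∼ (distribʳ a b c)) }
        ; *-comm = λ a b → ≈⇒∼ (*-comm a b) }
      }

    module LocalExp = Algebra.Properties.Semiring.Exp (CommutativeRing.semiring localisation)

    local-^ : ∀ a n → a LocalExp.^ n ≡ a ^ n
    local-^ a 0 = ≡.refl
    local-^ a (suc n) = ≡.cong (a *_) (local-^ a n)

    ∼1 : ∀ {a} → f * a ≈ f → a ∼ 1#
    ∼1 fa≈f = trans fa≈f (sym (*-identityʳ f))

    ∼0 : ∀ {a} → f * a ≈ 0# → a ∼ 0#
    ∼0 fa≈0 = trans fa≈0 (sym (zeroʳ f))

    1≁0 : ¬ f ≈ 0# → ¬ 1# ∼ 0#
    1≁0 f≉0 eq = f≉0 (trans (sym (*-identityʳ f)) (trans eq (zeroʳ f)))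


-- The parameter is m = q - 1 because later arguments compute with exponents of ζ modulo m. Inverses
-- come from `logarithm` and `ζ^m≡1`: the inverse of ζ^a is ζ^(a (m - 1)).
record FiniteField (m : ℕ) : Set where
  infixl 6 _+_
  infixl 7 _*_
  infix 8 -_
  field
    _+_ _*_ : Fin (suc m) → Fin (suc m) → Fin (suc m)
    -_      : Fin (suc m) → Fin (suc m)
    0# 1# ζ : Fin (suc m)
    isCommutativeRing : IsCommutativeRing _≡_ _+_ _*_ -_ 0# 1#

  commutativeRing : CommutativeRing 0ℓ 0ℓ
  commutativeRing = record { isCommutativeRing = isCommutativeRing }

  open CommutativeRing commutativeRing public using (semiring; commutativeSemiring)
  open Algebra.Properties.Semiring.Exp semiring public using (_^_)

  field
    1≢0         : 1# ≢ 0#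
    logarithm   : ∀ x → x ≢ 0# → ∃[ e ] x ≡ ζ ^ e
    ζ^m≡1       : ζ ^ m ≡ 1#
    ζ^d≡1⇒m∣d   : ∀ d → ζ ^ d ≡ 1# → m ∣ d

-- An element of order m and its powers

module PrimitiveRoot (F : CommutativeRing 0ℓ 0ℓ) (l : ℕ) where
  open CommutativeRing F hiding (zero)
  open import Algebra.Properties.CommutativeSemiring.Exp commutativeSemiring
  open import Algebra.Properties.CommutativeSemigroup +-commutativeSemigroup using (x∙yz≈y∙xz)
  open import Algebra.Properties.Ring ring using (-‿distribˡ-*; x∙y⁻¹≈ε⇒x≈y)
  open import Algebra.Morphism.Structures using (IsRingMonomorphism)
  import Algebra.Morphism.RingMonomorphism as RingMonomorphism
  open import Data.Empty using (⊥-elim)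
  open import Data.Fin using (zero; suc; toℕ; fromℕ<)
  open import Data.Fin.Properties using (any?; toℕ<n; toℕ-injective; toℕ-fromℕ<)
  open import Data.List using (List; []; _∷_; length; applyUpTo; replicate; _++_)
  open import Data.List.Properties using (length-applyUpTo; length-++; length-replicate)
  open import Data.List.Relation.Unary.All as All using (All; []; _∷_)
  import Data.List.Relation.Unary.All.Properties as All
  open import Data.List.Relation.Unary.AllPairs using (AllPairs; []; _∷_)
  import Data.List.Relation.Unary.AllPairs.Properties as AllPairs
  open import Data.Nat using (zero; _≤_; _<_; _∸_; s≤s)
  open import Data.Nat.Divisibility using (divides; ∣⇒≤)
  open import Data.Nat.ListAction using (product)
  open import Data.Nat.GCD using (module Bézout; GCD)
  open import Data.Nat.Primality.Factorisation using (factorise)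
  import Data.Nat.Properties as ℕ
  open import Data.Product using (_×_; _,_; proj₁; proj₂)
  open import Data.Sum using (inj₁; inj₂)
  open import Relation.Binary.Definitions using (Decidable; tri<; tri≈; tri>)
  import Relation.Binary.PropositionalEquality as ≡
  open import Relation.Binary.Reasoning.Setoid setoid
  open import Relation.Nullary using (yes; no; contradiction)

  private
    m = suc l

  eval : List Carrier → Carrier → Carrier
  eval [] x = 0#
  eval (a ∷ as) x = a + x * eval as x

  -- Synthetic division by X - r: with the constant coefficient first, the coefficients of the
  -- quotient are the values at r of the successive tails.
  quotientBy : Carrier → List Carrier → List Carrier
  quotientBy r [] = []
  quotientBy r (a ∷ []) = []
  quotientBy r (a ∷ as@(_ ∷ _)) = eval as r ∷ quotientBy r as

  length-quotientBy : ∀ r a as → length (quotientBy r (a ∷ as)) ≡ length as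
  length-quotientBy r a [] = ≡.refl
  length-quotientBy r a (b ∷ as) = ≡.cong suc (length-quotientBy r b as)

  -- P(z) - P(r) = (z - r) Q(z) with the negative terms moved across.
  eval-quotientBy : ∀ r z as → let q = eval (quotientBy r as) z in eval as z + r * q ≈ eval as r + z * q
  eval-quotientBy r z [] = +-congˡ (trans (zeroʳ r) (sym (zeroʳ z)))
  eval-quotientBy r z (a ∷ []) = +-cong (+-congˡ (trans (zeroʳ z) (sym (zeroʳ r)))) (trans (zeroʳ r) (sym (zeroʳ z)))
  eval-quotientBy r z (a ∷ as@(_ ∷ _)) = begin
    (a + z * P) + r * (P₀ + z * Q)         ≈⟨ +-congˡ (distribˡ r P₀ (z * Q)) ⟩
    (a + z * P) + (r * P₀ + r * (z * Q))   ≈⟨ +-assoc a _ _ ⟩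
    a + (z * P + (r * P₀ + r * (z * Q)))   ≈⟨ +-congˡ (x∙yz≈y∙xz _ _ _) ⟩
    a + (r * P₀ + (z * P + r * (z * Q)))   ≈⟨ +-congˡ (+-congˡ (+-congˡ (trans (sym (*-assoc r z Q)) (trans (*-congʳ (*-comm r z)) (*-assoc z r Q))))) ⟩
    a + (r * P₀ + (z * P + z * (r * Q)))   ≈⟨ +-congˡ (+-congˡ (distribˡ z P (r * Q))) ⟨
    a + (r * P₀ + z * (P + r * Q))         ≈⟨ +-congˡ (+-congˡ (*-congˡ (eval-quotientBy r z as))) ⟩
    a + (r * P₀ + z * (P₀ + z * Q))        ≈⟨ +-assoc a _ _ ⟨
    (a + r * P₀) + z * (P₀ + z * Q)        ∎
    where
    P = eval as z
    P₀ = eval as r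
    Q = eval (quotientBy r as) z

  -- P = (X - r) Q + P(r), so the coefficients of P vanish as soon as P(r) and those of Q do.
  quotientBy≈0 : ∀ r as → eval as r ≈ 0# → All (_≈ 0#) (quotientBy r as) → All (_≈ 0#) as
  quotientBy≈0 r [] _ _ = []
  quotientBy≈0 r (a ∷ []) root _ = trans (sym (trans (+-congˡ (zeroʳ r)) (+-identityʳ a))) root ∷ []
  quotientBy≈0 r (a ∷ as@(_ ∷ _)) root (P≈0 ∷ q≈0) =
    trans (sym (trans (+-congˡ (trans (*-congˡ P≈0) (zeroʳ r))) (+-identityʳ a))) root ∷ quotientBy≈0 r as P≈0 q≈0

  ^-1 : ∀ n → 1# ^ n ≈ 1#
  ^-1 zero = refl
  ^-1 (suc n) = trans (*-identityˡ _) (^-1 n)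

  module _ (_≈?_ : Decidable _≈_) (1≉0 : ¬ 1# ≈ 0#) (power : ∀ z → z ≈ 0# ⊎ z ^ suc l ≈ 1#) where

    *-cancelˡ : ∀ {z} a b → z ^ m ≈ 1# → z * a ≈ z * b → a ≈ b
    *-cancelˡ {z} a b z^m≈1 eq = trans (lemma a) (trans (*-congˡ eq) (sym (lemma b)))
      where
      lemma : ∀ a → a ≈ z ^ l * (z * a)
      lemma a = begin
        a                 ≈⟨ *-identityˡ a ⟨
        1# * a            ≈⟨ *-congʳ z^m≈1 ⟨
        (z * z ^ l) * a   ≈⟨ *-congʳ (*-comm z (z ^ l)) ⟩
        (z ^ l * z) * a   ≈⟨ *-assoc _ _ _ ⟩
        z ^ l * (z * a)   ∎

    noZeroDivisors : ∀ a b → a * b ≈ 0# → a ≈ 0# ⊎ b ≈ 0#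
    noZeroDivisors a b ab≈0 with power a
    ... | inj₁ a≈0 = inj₁ a≈0
    ... | inj₂ a^m≈1 = inj₂ (*-cancelˡ b 0# a^m≈1 (trans ab≈0 (sym (zeroʳ a))))

    -- Induction on the roots: division by X - r shortens the coefficient list by one, and the other
    -- roots, being different from r, remain roots of the quotient because there are no zero
    -- divisors.
    root-bound : ∀ as rs → AllPairs (λ r s → ¬ r ≈ s) rs → All (λ r → eval as r ≈ 0#) rs →
                 length as ≤ length rs → All (_≈ 0#) as
    root-bound [] rs _ _ _ = []
    root-bound as@(a ∷ as′) (r ∷ rs) (r≉rs ∷ distinct) (root ∷ roots) (s≤s len) =
      quotientBy≈0 r as root
        (root-bound (quotientBy r as) rs distinct (All.zipWith quotient-root (r≉rs , roots))
          (≡.subst (_≤ length rs) (≡.sym (length-quotientBy r a as′)) len))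
      where
      quotient-root : ∀ {z} → ¬ r ≈ z × eval as z ≈ 0# → eval (quotientBy r as) z ≈ 0#
      quotient-root {z} (r≉z , zroot) with noZeroDivisors (r - z) q (trans (distribʳ q r (- z)) (trans (+-cong rq≈zq (sym (-‿distribˡ-* z q))) (-‿inverseʳ _)))
        where
        q = eval (quotientBy r as) z
        rq≈zq : r * q ≈ z * q
        rq≈zq = trans (sym (trans (+-congʳ zroot) (+-identityˡ _))) (trans (eval-quotientBy r z as) (trans (+-congʳ root) (+-identityˡ _)))
      ... | inj₁ r-z≈0 = ⊥-elim (r≉z (x∙y⁻¹≈ε⇒x≈y r z r-z≈0))
      ... | inj₂ q≈0 = q≈0

    module _ (x : Carrier) (x^m≈1 : x ^ suc l ≈ 1#)
      (x^[m/ℓ]≉1 : ∀ {ℓ} → Prime ℓ → ∀ e → suc l ≡ e ℕ.* ℓ → ¬ x ^ e ≈ 1#) where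

      x^m*≈1 : ∀ b → x ^ (b ℕ.* m) ≈ 1#
      x^m*≈1 b = trans (^-congʳ x (ℕ.*-comm b m)) (trans (sym (^-assocʳ x m b)) (trans (^-congˡ b x^m≈1) (^-1 b)))

      -- With g = gcd(d, m), Bézout gives x^g = 1. If m/g had a prime factor ℓ, then g would divide
      -- m/ℓ and x^(m/ℓ) would be 1; hence g = m.
      order : ∀ d → x ^ d ≈ 1# → m ∣ d
      order d x^d≈1 with Bézout.lemma d m
      ... | Bézout.result g gcd identity = m∣d
        where
        x^d*≈1 : ∀ b → x ^ (b ℕ.* d) ≈ 1#
        x^d*≈1 b = trans (^-congʳ x (ℕ.*-comm b d)) (trans (sym (^-assocʳ x d b)) (trans (^-congˡ b x^d≈1) (^-1 b)))
        cancel : ∀ g c e → x ^ c ≈ 1# → x ^ e ≈ 1# → g ℕ.+ c ≡ e → x ^ g ≈ 1#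
        cancel g c e xc xe eq = begin
          x ^ g             ≈⟨ *-identityʳ _ ⟨
          x ^ g * 1#        ≈⟨ *-congˡ xc ⟨
          x ^ g * x ^ c     ≈⟨ ^-homo-* x g c ⟨
          x ^ (g ℕ.+ c)     ≈⟨ ^-congʳ x eq ⟩
          x ^ e             ≈⟨ xe ⟩
          1#                ∎
        x^gcd≈1 : Bézout.Identity g d m → x ^ g ≈ 1#
        x^gcd≈1 (Bézout.+- a b eq) = cancel g (b ℕ.* m) (a ℕ.* d) (x^m*≈1 b) (x^d*≈1 a) eq
        x^gcd≈1 (Bézout.-+ a b eq) = cancel g (a ℕ.* d) (b ℕ.* m) (x^d*≈1 a) (x^m*≈1 b) eq
        x^g≈1 = x^gcd≈1 identity
        m∣d : m ∣ d
        m∣d with GCD.gcd∣n gcd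
        ... | divides h m≡hg with factorise h {{ℕ.≢-nonZero λ h≡0 → ℕ.1+n≢0 (≡.trans m≡hg (≡.cong (ℕ._* g) h≡0))}}
        ...   | record { factors = [] ; isFactorisation = h≡1 } =
                  ≡.subst (_∣ d) (≡.sym (≡.trans m≡hg (≡.trans (≡.cong (ℕ._* g) h≡1) (ℕ.*-identityˡ g)))) (GCD.gcd∣m gcd)
        ...   | record { factors = ℓ ∷ ℓs ; isFactorisation = h≡ℓf ; factorsPrime = pr ∷ _ } =
                  ⊥-elim (x^[m/ℓ]≉1 pr (f ℕ.* g) m≡fgℓ (trans (^-congʳ x (ℕ.*-comm f g)) (trans (sym (^-assocʳ x g f)) (trans (^-congˡ f x^g≈1) (^-1 f)))))
          where
          f = product ℓs
          m≡fgℓ : m ≡ f ℕ.* g ℕ.* ℓ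
          m≡fgℓ = ≡.trans m≡hg (≡.trans (≡.cong (ℕ._* g) h≡ℓf) (≡.trans (ℕ.*-assoc ℓ f g) (ℕ.*-comm ℓ (f ℕ.* g))))

      powers-distinct : ∀ {i j} → i < j → j < m → ¬ x ^ i ≈ x ^ j
      powers-distinct {i} {j} i<j j<m eq = ℕ.<⇒≱ (ℕ.<-≤-trans (s≤s (ℕ.m∸n≤m j i)) j<m) (∣⇒≤ {{ℕ.>-nonZero (ℕ.m<n⇒0<n∸m i<j)}} (order (j ∸ i) x^[j-i]≈1))
        where
        x^i^m≈1 : (x ^ i) ^ m ≈ 1#
        x^i^m≈1 = trans (^-assocʳ x i m) (x^m*≈1 i)
        x^[j-i]≈1 : x ^ (j ∸ i) ≈ 1#
        x^[j-i]≈1 = *-cancelˡ _ _ x^i^m≈1 (trans (sym (^-homo-* x i (j ∸ i))) (trans (^-congʳ x (ℕ.m+[n∸m]≡n (ℕ.<⇒≤ i<j))) (trans (sym eq) (sym (*-identityʳ _)))))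

      x^m-1 : List Carrier
      x^m-1 = - 1# ∷ (replicate l 0# ++ 1# ∷ [])

      eval-monomial : ∀ n z → eval (replicate n 0# ++ 1# ∷ []) z ≈ z ^ n
      eval-monomial zero z = trans (+-congˡ (zeroʳ z)) (+-identityʳ 1#)
      eval-monomial (suc n) z = trans (+-identityˡ _) (*-congˡ (eval-monomial n z))

      x^m-1-root : ∀ z → z ^ m ≈ 1# → eval x^m-1 z ≈ 0#
      x^m-1-root z z^m≈1 = trans (+-congˡ (trans (*-congˡ (eval-monomial l z)) z^m≈1)) (-‿inverseˡ 1#)

      -- Otherwise z and the m powers of x would be m + 1 distinct roots of X^m - 1, and all its m +
      -- 1 coefficients would vanish, the leading 1 included.
      logarithm : ∀ z → ¬ z ≈ 0# → ∃[ i ] z ≈ x ^ toℕ {m} i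
      logarithm z z≉0 with power z | any? (λ (i : Fin m) → z ≈? (x ^ toℕ i))
      ... | inj₁ z≈0 | _ = contradiction z≈0 z≉0
      ... | _ | yes log = log
      ... | inj₂ z^m≈1 | no ¬log = contradiction (last (All.++⁻ʳ (replicate l 0#) (tail zeros))) 1≉0
        where
        last : All (_≈ 0#) (1# ∷ []) → 1# ≈ 0#
        last (eq ∷ []) = eq
        tail : All (_≈ 0#) x^m-1 → All (_≈ 0#) (replicate l 0# ++ 1# ∷ [])
        tail (_ ∷ eqs) = eqs
        powers = applyUpTo (x ^_) m
        zeros : All (_≈ 0#) x^m-1
        zeros = root-bound x^m-1 (z ∷ powers)
          (All.applyUpTo⁺₁ (x ^_) m (λ {i} i<m z≈x^i → ¬log (fromℕ< i<m , trans z≈x^i (^-congʳ x (≡.sym (toℕ-fromℕ< i<m)))))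
            ∷ AllPairs.applyUpTo⁺₁ (x ^_) m powers-distinct)
          (x^m-1-root z z^m≈1 ∷ All.applyUpTo⁺₁ (x ^_) m (λ {i} _ → x^m-1-root (x ^ i) (trans (^-assocʳ x i m) (x^m*≈1 i))))
          (ℕ.≤-reflexive (≡.cong suc (≡.trans (length-++ (replicate l 0#)) (≡.trans (≡.cong (ℕ._+ 1) (length-replicate l)) (≡.trans (ℕ.+-comm l 1) (≡.sym (length-applyUpTo (x ^_) m)))))))

      -- 0 followed by x^0, ..., x^(m-1). The ring structure is pulled back along this enumeration,
      -- and its injectivity reflects the ring laws.
      fromFin : Fin (suc m) → Carrier
      fromFin zero = 0#
      fromFin (suc i) = x ^ toℕ i

      toFin : Carrier → Fin (suc m)
      toFin z with z ≈? 0#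
      ... | yes _ = zero
      ... | no z≉0 = suc (proj₁ (logarithm z z≉0))

      fromFin-toFin : ∀ z → fromFin (toFin z) ≈ z
      fromFin-toFin z with z ≈? 0#
      ... | yes z≈0 = sym z≈0
      ... | no z≉0 = sym (proj₂ (logarithm z z≉0))

      x^≉0 : ∀ i → ¬ x ^ i ≈ 0#
      x^≉0 i x^i≈0 = 1≉0 (begin
        1#               ≈⟨ x^m*≈1 i ⟨
        x ^ (i ℕ.* m)    ≈⟨ ^-assocʳ x i m ⟨
        (x ^ i) ^ m      ≈⟨ *-congʳ x^i≈0 ⟩
        0# * _           ≈⟨ zeroˡ _ ⟩
        0#               ∎)

      fromFin-injective : ∀ {i j} → fromFin i ≈ fromFin j → i ≡ j
      fromFin-injective {zero} {zero} _ = ≡.refl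
      fromFin-injective {zero} {suc j} eq = ⊥-elim (x^≉0 (toℕ j) (sym eq))
      fromFin-injective {suc i} {zero} eq = ⊥-elim (x^≉0 (toℕ i) eq)
      fromFin-injective {suc i} {suc j} eq with ℕ.<-cmp (toℕ i) (toℕ j)
      ... | tri< i<j _ _ = ⊥-elim (powers-distinct i<j (toℕ<n j) eq)
      ... | tri≈ _ i≡j _ = ≡.cong suc (toℕ-injective i≡j)
      ... | tri> _ _ i>j = ⊥-elim (powers-distinct i>j (toℕ<n i) (sym eq))

      finRawRing : RawRing 0ℓ 0ℓ
      finRawRing = record
        { Carrier = Fin (suc m) ; _≈_ = _≡_
        ; _+_ = λ i j → toFin (fromFin i + fromFin j)
        ; _*_ = λ i j → toFin (fromFin i * fromFin j)
        ; -_ = λ i → toFin (- fromFin i) ; 0# = zero ; 1# = toFin 1# }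

      isRingMonomorphism : IsRingMonomorphism finRawRing (CommutativeRing.rawRing F) fromFin
      isRingMonomorphism = record
        { isRingHomomorphism = record
          { isSemiringHomomorphism = record
            { isNearSemiringHomomorphism = record
              { +-isMonoidHomomorphism = record
                { isMagmaHomomorphism = record
                  { isRelHomomorphism = record { cong = λ { ≡.refl → refl } }
                  ; homo = λ _ _ → fromFin-toFin _ }
                ; ε-homo = refl }
              ; *-homo = λ _ _ → fromFin-toFin _ }
            ; 1#-homo = fromFin-toFin 1# }
          ; -‿homo = λ _ → fromFin-toFin _ }
        ; injective = fromFin-injective }

      finRing : CommutativeRing 0ℓ 0ℓ
      finRing = record { isCommutativeRing = RingMonomorphism.isCommutativeRing isRingMonomorphism isCommutativeRing }

      private
        module Fin-ring = CommutativeRing finRing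
        open Algebra.Properties.Semiring.Exp Fin-ring.semiring using () renaming (_^_ to _^′_)

      fromFin-^ : ∀ e → fromFin (toFin x ^′ e) ≈ x ^ e
      fromFin-^ zero = fromFin-toFin 1#
      fromFin-^ (suc e) = trans (fromFin-toFin _) (*-cong (fromFin-toFin x) (fromFin-^ e))

      finiteField : FiniteField m
      finiteField = record
        { ζ = toFin x
        ; isCommutativeRing = Fin-ring.isCommutativeRing
        ; 1≢0 = λ eq → 1≉0 (trans (sym (fromFin-toFin 1#)) (reflexive (≡.cong fromFin eq)))
        ; logarithm = λ i i≢0 → let e , eq = logarithm (fromFin i) (λ eq → i≢0 (fromFin-injective eq))
                                in toℕ e , fromFin-injective (trans eq (sym (fromFin-^ (toℕ e))))
        ; ζ^m≡1 = fromFin-injective (trans (fromFin-^ m) (trans x^m≈1 (sym (fromFin-toFin 1#))))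
        ; ζ^d≡1⇒m∣d = λ d eq → order d (trans (sym (fromFin-^ d)) (trans (reflexive (≡.cong fromFin eq)) (fromFin-toFin 1#)))
        }

-- A field as a localisation of a finite ring

module FieldQuotient (R : CommutativeRing 0ℓ 0ℓ) (l : ℕ) where
  open CommutativeRing R
  open import Algebra.Properties.CommutativeSemiring.Exp commutativeSemiring
  open import Algebra.Properties.Ring ring using (x[y-z]≈xy-xz)
  open import Data.List using (tabulate)
  open import Data.List.Relation.Unary.All using (All)
  open import Data.List.Relation.Unary.All.Properties using (tabulate⁻)
  open import Data.Product using (_,_)
  open import Data.Sum using (inj₁; inj₂; [_,_]′)
  open import Relation.Binary.Definitions using (Decidable)
  open import Relation.Binary.Reasoning.Setoid setoid

  -- Since `elem` reaches all of R, every z^m becomes 0 or 1 after localising at the unsplit f. If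
  -- x^(m/ℓ) became 1, then y, a multiple of x^(m/ℓ) - 1, would become 0, whereas f y^m = f makes
  -- y^m become 1.
  finiteField :
    Decidable _≈_ → (∀ z → z ^ suc (suc l) ≈ z) →
    ∀ {N} (elem : Fin N → Carrier) → (∀ z → ∃[ i ] elem i ≈ z) →
    ∀ x → x ^ suc l ≈ 1# → ∀ y → ¬ y ≈ 0# →
    (∀ {ℓ} → Prime ℓ → ∀ e → suc l ≡ e ℕ.* ℓ → ∃[ v ] y ≈ (x ^ e - 1#) * v) →
    FiniteField (suc l)
  finiteField _≈?_ fixed elem surjective x x^m≈1 y y≉0 divisible
    with f , f≉0 , fy^m≈f , all ← Localisation.unsplit R _≈?_ l fixed y y≉0 (tabulate elem) =
    PrimitiveRoot.finiteField (localisation f) l (λ a b → (f * a) ≈? (f * b)) (1≁0 f f≉0)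
      (λ z → [ inj₁ , (λ eq → inj₂ (trans (local z (suc l)) eq)) ]′ (power z))
      x (trans (local x (suc l)) (≈⇒∼ f x^m≈1)) (λ pr e eq x^e∼1 → x^e≁1 pr e eq (trans (sym (local x e)) x^e∼1))
    where
    open Localisation R
    local : ∀ z n → f * (LocalExp._^_ f z n) ≈ f * z ^ n
    local z n = *-congˡ (reflexive (local-^ f z n))
    power : ∀ z → f * z ≈ f * 0# ⊎ f * z ^ suc l ≈ f * 1#
    power z with i , elemᵢ≈z ← surjective z with tabulate⁻ all i
    ... | inj₂ eq = inj₂ (∼1 f (trans (*-congˡ (^-congˡ (suc l) (sym elemᵢ≈z))) eq))
    ... | inj₁ eq = inj₁ (∼0 f (begin
      f * z                       ≈⟨ *-congˡ (fixed z) ⟨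
      f * (z * z ^ suc l)         ≈⟨ *-congˡ (*-comm _ _) ⟩
      f * (z ^ suc l * z)         ≈⟨ *-assoc _ _ _ ⟨
      f * z ^ suc l * z           ≈⟨ *-congʳ (trans (*-congˡ (^-congˡ (suc l) (sym elemᵢ≈z))) eq) ⟩
      0# * z                      ≈⟨ zeroˡ z ⟩
      0#                          ∎))
    x^e≁1 : ∀ {ℓ} → Prime ℓ → ∀ e → suc l ≡ e ℕ.* ℓ → ¬ f * x ^ e ≈ f * 1#
    x^e≁1 pr e eq x^e∼1 with v , y≈ ← divisible pr e eq = f≉0 (begin
      f                             ≈⟨ fy^m≈f ⟨
      f * (y * y ^ l)               ≈⟨ *-assoc _ _ _ ⟨
      f * y * y ^ l                 ≈⟨ *-congʳ (*-congˡ y≈) ⟩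
      f * ((x ^ e - 1#) * v) * y ^ l  ≈⟨ *-congʳ (*-assoc _ _ _) ⟨
      f * (x ^ e - 1#) * v * y ^ l  ≈⟨ *-congʳ (*-congʳ (x[y-z]≈xy-xz f (x ^ e) 1#)) ⟩
      (f * x ^ e - f * 1#) * v * y ^ l  ≈⟨ *-congʳ (*-congʳ (+-congʳ x^e∼1)) ⟩
      (f * 1# - f * 1#) * v * y ^ l  ≈⟨ *-congʳ (*-congʳ (-‿inverseʳ _)) ⟩
      0# * v * y ^ l                ≈⟨ *-congʳ (zeroˡ v) ⟩
      0# * y ^ l                    ≈⟨ zeroˡ _ ⟩
      0#                            ∎)

-- The field with pⁿ elements

module GaloisField where
  open import Data.Fin using (finToFun; funToFin)
  open import Data.Fin.Properties using (finToFun-funToFin)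
  open import Data.Nat.Divisibility using (∣⇒≤; divides)
  import Data.Nat.Properties as ℕ
  open import Data.Product using (_,_)
  open import Relation.Binary.PropositionalEquality as ≡ using (cong)

  galoisField : ∀ {p} → Prime p → ∀ n {l} → suc (suc l) ≡ p ℕ.^ n → FiniteField (suc l)
  galoisField {p} p-prime n {l} q≡pⁿ =
    FieldQuotient.finiteField C.ring l C._≈?_ C.fixed finToFun (λ z → funToFin z , finToFun-funToFin z)
      x x^m≈1 value (λ eq → constant (eq _)) div
    where
    m = suc l
    module C = CyclotomicAlgebra p p-prime n m q≡pⁿ
    open CommutativeRing C.ring
    -- Every prime divisor of m is at most m, so the bound `suc m` takes in all of them.
    open C.Truncation (C.truncation (suc m))
    open import Algebra.Properties.Semiring.Exp semiring using (_^_)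
    x = CyclicAlgebra.δ (ZMod.commutativeRing p) m (ZMod.[_] m 1)
    x^m≈1 : x ^ m ≈ 1#
    x^m≈1 = trans (C.δ-[]-^ m) (reflexive (cong (CyclicAlgebra.δ (ZMod.commutativeRing p) m)
      (≡.trans (cong (ZMod.[_] m) (≡.sym (ℕ.*-identityʳ m))) (ModularArithmetic.[n*]≡0 m 1))))
    div : ∀ {ℓ} → Prime ℓ → ∀ e → m ≡ e ℕ.* ℓ → ∃[ v ] value ≈ (x ^ e - 1#) * v
    div pr e m≡eℓ with v , eq ← divisible pr (ℕ.s≤s (∣⇒≤ (divides e m≡eℓ))) e m≡eℓ =
      v , trans eq (*-congʳ {v} (+-congʳ { - 1# } (sym (C.δ-[]-^ e))))

-- Cyclotomic classes

module IntegerSum (n : ℕ) where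
  open import Data.Fin using (Fin; zero; suc)
  open import Data.Fin.Permutation using (permutation)
  open import Data.Integer hiding (suc)
  open import Data.Integer.Properties
  open import Data.Bool using (if_then_else_)
  open import Data.List using (tabulate; filter; length)
  open import Function using (_∘_; id)
  open import Relation.Binary.PropositionalEquality
  open import Relation.Nullary using (¬_; Dec; yes; no; does; contradiction; _×-dec_)
  open import Relation.Unary using (Decidable)
  open import Algebra.Properties.Semiring.Sum +-*-semiring using (sum; sum-cong-≗; ∑-distrib-+; ∑-comm; sum-permute; *-distribˡ-sum)

  private
    const-sum : ∀ k c → sum {k} (λ _ → c) ≡ + k * c
    const-sum ℕ.zero c = refl
    const-sum (suc k) c = trans (cong (λ x → c + x) (const-sum k c)) (sym (suc-* (+ k) c))

    mono-sum : ∀ {k} {f g : Fin k → ℤ} → (∀ i → f i ≤ g i) → sum f ≤ sum g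
    mono-sum {ℕ.zero} f≤g = ≤-refl
    mono-sum {suc k} f≤g = +-mono-≤ (f≤g zero) (mono-sum (f≤g ∘ suc))

  abstract
    Σ : (Fin n → ℤ) → ℤ
    Σ = sum

    Σ≡sum : ∀ f → Σ f ≡ sum f
    Σ≡sum f = refl

    Σ-cong : ∀ {f g} → (∀ i → f i ≡ g i) → Σ f ≡ Σ g
    Σ-cong = sum-cong-≗

    Σ-+ : ∀ f g → Σ (λ i → f i + g i) ≡ Σ f + Σ g
    Σ-+ = ∑-distrib-+

    Σ-* : ∀ c f → Σ (λ i → c * f i) ≡ c * Σ f
    Σ-* c f = sym (*-distribˡ-sum c f)

    Σ-*ʳ : ∀ c f → Σ (λ i → f i * c) ≡ Σ f * c
    Σ-*ʳ c f = trans (Σ-cong (λ i → *-comm (f i) c)) (trans (Σ-* c f) (*-comm c (Σ f)))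

    Σ-swap : ∀ (f : Fin n → Fin n → ℤ) → Σ (λ i → Σ (f i)) ≡ Σ (λ j → Σ (λ i → f i j))
    Σ-swap = ∑-comm

    Σ-reindex : ∀ (φ ψ : Fin n → Fin n) → (∀ i → φ (ψ i) ≡ i) → (∀ i → ψ (φ i) ≡ i) → ∀ f → Σ (f ∘ φ) ≡ Σ f
    Σ-reindex φ ψ φψ ψφ f = sym (sum-permute f (permutation φ ψ φψ ψφ))

    Σ-single : ∀ i f → (∀ j → j ≢ i → f j ≡ 0ℤ) → Σ f ≡ f i
    Σ-single = FiniteSum.sum-single +-*-semiring

    Σ-0 : ∀ f → (∀ i → f i ≡ 0ℤ) → Σ f ≡ 0ℤ
    Σ-0 = FiniteSum.sum-zero +-*-semiring

    Σ-const : ∀ c → Σ (λ _ → c) ≡ + n * c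
    Σ-const = const-sum n

    Σ-mono : ∀ {f g} → (∀ i → f i ≤ g i) → Σ f ≤ Σ g
    Σ-mono = mono-sum

    𝟙 : ∀ {p} {P : Set p} → Dec P → ℤ
    𝟙 P? = if does P? then 1ℤ else 0ℤ

    Σ-𝟙 : ∀ {p} {P : Fin n → Set p} (P? : Decidable P) → Σ (λ i → 𝟙 (P? i)) ≡ + length (filter P? (tabulate id))
    Σ-𝟙 P? = count id
      where
      count : ∀ {k} (f : Fin k → Fin n) → sum (λ i → 𝟙 (P? (f i))) ≡ + length (filter P? (tabulate f))
      count {ℕ.zero} f = refl
      count {suc k} f with P? (f zero)
      ... | yes _ = cong (λ x → 1ℤ + x) (count (f ∘ suc))
      ... | no _ = trans (+-identityˡ _) (count (f ∘ suc))

    𝟙-true : ∀ {p} {P : Set p} (P? : Dec P) → P → 𝟙 P? ≡ 1ℤ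
    𝟙-true (yes _) _ = refl
    𝟙-true (no ¬p) p = contradiction p ¬p

    𝟙-false : ∀ {p} {P : Set p} (P? : Dec P) → ¬ P → 𝟙 P? ≡ 0ℤ
    𝟙-false (yes p) ¬p = contradiction p ¬p
    𝟙-false (no _) _ = refl

    𝟙-cong : ∀ {p q} {P : Set p} {Q : Set q} (P? : Dec P) (Q? : Dec Q) → (P → Q) → (Q → P) → 𝟙 P? ≡ 𝟙 Q?
    𝟙-cong (yes p) Q? f g = sym (𝟙-true Q? (f p))
    𝟙-cong (no ¬p) Q? f g = sym (𝟙-false Q? (λ q → ¬p (g q)))

    𝟙-idem : ∀ {p} {P : Set p} (P? : Dec P) → 𝟙 P? * 𝟙 P? ≡ 𝟙 P?
    𝟙-idem (yes _) = refl
    𝟙-idem (no _) = refl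

    𝟙-≤1 : ∀ {p} {P : Set p} (P? : Dec P) → 𝟙 P? ≤ 1ℤ
    𝟙-≤1 (yes _) = +≤+ (ℕ.s≤s ℕ.z≤n)
    𝟙-≤1 (no _) = +≤+ ℕ.z≤n

    𝟙-×-dec : ∀ {p q} {P : Set p} {Q : Set q} (P? : Dec P) (Q? : Dec Q) → 𝟙 (P? ×-dec Q?) ≡ 𝟙 P? * 𝟙 Q?
    𝟙-×-dec (yes _) (yes _) = refl
    𝟙-×-dec (yes _) (no _) = refl
    𝟙-×-dec (no _) (yes _) = refl
    𝟙-×-dec (no _) (no _) = refl

-- Discrete logarithms and cosets of K

module Cyclotomy {l : ℕ} (FF : FiniteField (suc l)) (e w : ℕ) .{{_ : NonZero e}} .{{_ : NonZero w}}
                 (m≡ew : suc l ≡ e ℕ.* w) where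
  open import Data.Fin using (Fin; _≟_)
  open import Data.Nat.Divisibility
  import Data.Nat.Properties as ℕ
  open import Data.Product using (_×_; _,_; proj₁; proj₂)
  open import Relation.Binary.PropositionalEquality as ≡ hiding ([_])
  open import Relation.Nullary using (Dec; yes; no; contradiction; ¬?; _×-dec_)

  private
    m = suc l
    q = suc m

  module F = CommutativeRing (FiniteField.commutativeRing FF)
  open F using (_+_; _*_; _-_; -_; 0#; 1#; ring; commutativeSemiring; *-commutativeSemigroup) public
  open FiniteField FF using (ζ; _^_; 1≢0; logarithm; ζ^m≡1; ζ^d≡1⇒m∣d) public
  open import Algebra.Properties.CommutativeSemiring.Exp commutativeSemiring using (^-homo-*; ^-assocʳ; ^-congˡ)
  private
    module Z = CommutativeRing (ZMod.commutativeRing e)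
    open import Algebra.Properties.Group Z.+-group using () renaming (∙-cancelˡ to ⊕-cancelˡ; ∙-cancelʳ to ⊕-cancelʳ)
  open ZMod e using ([_]; _⊕_; []-cong; []-+)

  1^n : ∀ n → 1# ^ n ≡ 1#
  1^n ℕ.zero = refl
  1^n (suc n) = trans (F.*-identityˡ _) (1^n n)

  ζ^[*m] : ∀ a → ζ ^ (a ℕ.* m) ≡ 1#
  ζ^[*m] a = trans (cong (ζ ^_) (ℕ.*-comm a m)) (trans (sym (^-assocʳ ζ m a)) (trans (^-congˡ a ζ^m≡1) (1^n a)))

  ζ^-inverse : ∀ a → ζ ^ a * ζ ^ (a ℕ.* l) ≡ 1#
  ζ^-inverse a = trans (sym (^-homo-* ζ a (a ℕ.* l))) (trans (cong (ζ ^_) (sym (ℕ.*-suc a l))) (ζ^[*m] a))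

  lg : Fin q → ℕ
  lg x with x ≟ 0#
  -- A default value, which makes `cls 0#` meaningless; this is why `_∈C_` also demands x ≢ 0#.
  ... | yes _ = 0
  ... | no x≢0 = proj₁ (logarithm x x≢0)

  ζ^lg : ∀ {x} → x ≢ 0# → ζ ^ lg x ≡ x
  ζ^lg {x} x≢0 with x ≟ 0#
  ... | yes x≡0 = contradiction x≡0 x≢0
  ... | no x≢0′ = sym (proj₂ (logarithm x x≢0′))

  infix 9 _⁻¹
  -- With l = m - 1 this is x^(m-1) for x ≠ 0; at 0 it takes the default value ζ^0 = 1.
  _⁻¹ : Fin q → Fin q
  x ⁻¹ = ζ ^ (lg x ℕ.* l)

  *-inverseʳ : ∀ {x} → x ≢ 0# → x * x ⁻¹ ≡ 1#
  *-inverseʳ {x} x≢0 = trans (cong (_* x ⁻¹) (sym (ζ^lg x≢0))) (ζ^-inverse (lg x))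

  *-inverseˡ : ∀ {x} → x ≢ 0# → x ⁻¹ * x ≡ 1#
  *-inverseˡ {x} x≢0 = trans (F.*-comm _ x) (*-inverseʳ x≢0)

  x⁻¹*[x*y] : ∀ {x} → x ≢ 0# → ∀ y → x ⁻¹ * (x * y) ≡ y
  x⁻¹*[x*y] {x} x≢0 y = trans (sym (F.*-assoc _ x y)) (trans (cong (_* y) (*-inverseˡ x≢0)) (F.*-identityˡ y))

  x*[x⁻¹*y] : ∀ {x} → x ≢ 0# → ∀ y → x * (x ⁻¹ * y) ≡ y
  x*[x⁻¹*y] {x} x≢0 y = trans (sym (F.*-assoc x _ y)) (trans (cong (_* y) (*-inverseʳ x≢0)) (F.*-identityˡ y))

  *-cancelˡ : ∀ {x} y z → x ≢ 0# → x * y ≡ x * z → y ≡ z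
  *-cancelˡ {x} y z x≢0 eq = trans (sym (x⁻¹*[x*y] x≢0 y)) (trans (cong (x ⁻¹ *_) eq) (x⁻¹*[x*y] x≢0 z))

  *-cancelʳ : ∀ {x} y z → x ≢ 0# → y * x ≡ z * x → y ≡ z
  *-cancelʳ {x} y z x≢0 eq = *-cancelˡ y z x≢0 (trans (F.*-comm x y) (trans eq (F.*-comm z x)))

  *-≢0 : ∀ {x y} → x ≢ 0# → y ≢ 0# → x * y ≢ 0#
  *-≢0 {x} {y} x≢0 y≢0 xy≡0 = y≢0 (*-cancelˡ y 0# x≢0 (trans xy≡0 (sym (F.zeroʳ x))))

  ζ^≢0 : ∀ a → ζ ^ a ≢ 0#
  ζ^≢0 a eq = 1≢0 (trans (sym (ζ^-inverse a)) (trans (cong (_* ζ ^ (a ℕ.* l)) eq) (F.zeroˡ _)))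

  -1≢0 : - 1# ≢ 0#
  -1≢0 eq = 1≢0 (trans (sym (F.+-identityˡ 1#)) (trans (cong (_+ 1#) (sym eq)) (F.-‿inverseˡ 1#)))

  e∣m : e ∣ m
  e∣m = divides w (trans m≡ew (ℕ.*-comm e w))

  ∣⇒[]≡0 : ∀ {a} → e ∣ a → [ a ] ≡ [ 0 ]
  ∣⇒[]≡0 {a} d = []-cong (trans (n∣m⇒m%n≡0 a e d) (sym (n∣m⇒m%n≡0 0 e (e ∣0))))

  -- Adding a l to both exponents replaces subtraction: a + a l = a m and b + a l are both multiples
  -- of m, hence of e, and a l cancels in Z/e.
  ζ^-injective : ∀ a b → ζ ^ a ≡ ζ ^ b → [ a ] ≡ [ b ]
  ζ^-injective a b eq = ⊕-cancelʳ [ a ℕ.* l ] [ a ] [ b ] (trans (sym ([]-+ a (a ℕ.* l)))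
    (trans (trans (∣⇒[]≡0 (∣-trans e∣m (divides a (sym (ℕ.*-suc a l))))) (sym (∣⇒[]≡0 (∣-trans e∣m m∣b+al)))) ([]-+ b (a ℕ.* l))))
    where
    m∣b+al : m ∣ b ℕ.+ a ℕ.* l
    m∣b+al = ζ^d≡1⇒m∣d _ (trans (^-homo-* ζ b (a ℕ.* l)) (trans (cong (_* ζ ^ (a ℕ.* l)) (sym eq)) (ζ^-inverse a)))

  abstract
    -- On nonzero elements this is the isomorphism of F*/K with Z/e, where K is generated by ζ^e.
    cls : Fin q → Fin e
    cls x = [ lg x ]

    cls≡[lg] : ∀ x → cls x ≡ [ lg x ]
    cls≡[lg] x = refl

  cls-ζ^ : ∀ a → cls (ζ ^ a) ≡ [ a ]
  cls-ζ^ a = trans (cls≡[lg] (ζ ^ a)) (ζ^-injective (lg (ζ ^ a)) a (ζ^lg (ζ^≢0 a)))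

  cls-* : ∀ {x y} → x ≢ 0# → y ≢ 0# → cls (x * y) ≡ cls x ⊕ cls y
  cls-* {x} {y} x≢0 y≢0 = trans (cls≡[lg] (x * y)) (trans (ζ^-injective (lg (x * y)) (lg x ℕ.+ lg y) (trans (ζ^lg (*-≢0 x≢0 y≢0))
    (trans (cong₂ _*_ (sym (ζ^lg x≢0)) (sym (ζ^lg y≢0))) (sym (^-homo-* ζ (lg x) (lg y))))))
    (trans ([]-+ (lg x) (lg y)) (cong₂ _⊕_ (sym (cls≡[lg] x)) (sym (cls≡[lg] y)))))

  cls-cancelˡ : ∀ {x x′ y y′} → x ≢ 0# → x′ ≢ 0# → y ≢ 0# → y′ ≢ 0# →
                cls x ≡ cls x′ → cls (x * y) ≡ cls (x′ * y′) → cls y ≡ cls y′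
  cls-cancelˡ {x} {x′} {y} {y′} x≢0 x′≢0 y≢0 y′≢0 eq eq′ = ⊕-cancelˡ (cls x) _ _
    (trans (sym (cls-* x≢0 y≢0)) (trans eq′ (trans (cls-* x′≢0 y′≢0) (cong (_⊕ cls y′) (sym eq)))))

  infix 4 _∈C_ _∈C?_
  _∈C_ : Fin q → Fin e → Set
  x ∈C α = x ≢ 0# × cls x ≡ α

  _∈C?_ : ∀ x α → Dec (x ∈C α)
  x ∈C? α = ¬? (x ≟ 0#) ×-dec (cls x ≟ α)

  ∈C-*ζ : ∀ {x α} → x ∈C α → ∀ a → ζ ^ a * x ∈C [ a ] ⊕ α
  ∈C-*ζ (x≢0 , refl) a = *-≢0 (ζ^≢0 a) x≢0 , trans (cls-* (ζ^≢0 a) x≢0) (cong (_⊕ _) (cls-ζ^ a))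

  module Affine (b : Fin q) {u : Fin q} (u≢0 : u ≢ 0#) where
    to from : Fin q → Fin q
    to x = b + u * x
    from y = u ⁻¹ * (y - b)

    to-from : ∀ y → to (from y) ≡ y
    to-from y = trans (cong (b +_) (x*[x⁻¹*y] u≢0 (y - b))) (trans (F.+-comm b _) (trans (F.+-assoc y _ b) (trans (cong (y +_) (F.-‿inverseˡ b)) (F.+-identityʳ y))))

    from-to : ∀ x → from (to x) ≡ x
    from-to x = trans (cong (λ y → u ⁻¹ * y) (trans (cong (_- b) (F.+-comm b (u * x))) (trans (F.+-assoc (u * x) b _) (trans (cong (u * x +_) (F.-‿inverseʳ b)) (F.+-identityʳ _))))) (x⁻¹*[x*y] u≢0 x)

  open IntegerSum q public

  Σ-affine : ∀ b {u} → u ≢ 0# → ∀ f → Σ (λ x → f (b + u * x)) ≡ Σ f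
  Σ-affine b u≢0 = Σ-reindex to from to-from from-to
    where open Affine b u≢0

  Σ-translate : ∀ b f → Σ (λ x → f (x + b)) ≡ Σ f
  Σ-translate b f = trans (Σ-cong λ x → cong f (trans (F.+-comm x b) (cong (b +_) (sym (F.*-identityˡ x))))) (Σ-affine b 1≢0 f)

  Σ-scale : ∀ {u} → u ≢ 0# → ∀ f → Σ (λ x → f (u * x)) ≡ Σ f
  Σ-scale {u} u≢0 f = trans (Σ-cong λ x → cong f (sym (F.+-identityˡ (u * x)))) (Σ-affine 0# u≢0 f)

-- The sums S u b = Σ_{a ∈ A} g(b + u a), with g the centred indicator of a coset of K, have
-- pairwise uncorrelated terms on average over all (u , b).  As |S| is invariant under
-- multiplication of u or b by K, every single value is bounded by the mean square.
module SecondMoment {l : ℕ} (FF : FiniteField (suc l)) (e w : ℕ) .{{_ : NonZero e}} .{{_ : NonZero w}}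
                    (m≡ew : suc l ≡ e ℕ.* w) where
  open Cyclotomy FF e w m≡ew
  open import Algebra.Properties.CommutativeMonoid.Sum using (∑-comm)
  open import Data.Fin using (Fin; _≟_)
  open import Data.Integer as ℤ using (ℤ; +_; 0ℤ; 1ℤ)
  import Data.Integer.Properties as ℤ
  open import Data.Integer.Tactic.RingSolver using (solve-∀)
  open import Data.Product using (_,_; proj₁; proj₂)
  open import Relation.Binary.PropositionalEquality as ≡ hiding ([_])
  open import Relation.Nullary using (Dec; yes; no)
  private
    m = suc l
    q = suc m
    module Z = CommutativeRing (ZMod.commutativeRing e)
    module Sₑ = IntegerSum e
    W Q : ℤ
    W = + w
    Q = + q
  open import Algebra.Properties.Group Z.+-group using (∙-cancelˡ; ∙-cancelʳ)
  open ZMod e using ([_]; _⊕_; []-toℕ)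
  open import Algebra.Properties.Ring ring using (x∙y⁻¹≈ε⇒x≈y; -1*x≈-x; -‿involutive)
  import Data.Nat.Properties as ℕ

  I : Fin e → Fin q → ℤ
  I α x = 𝟙 (x ∈C? α)

  I-idem : ∀ α x → I α x ℤ.* I α x ≡ I α x
  I-idem α x = 𝟙-idem (x ∈C? α)

  I-scale : ∀ a α x → I ([ a ] ⊕ α) (ζ ^ a * x) ≡ I α x
  I-scale a α x = 𝟙-cong (ζ ^ a * x ∈C? ([ a ] ⊕ α)) (x ∈C? α) back (λ x∈ → ∈C-*ζ x∈ a)
    where
    back : ζ ^ a * x ∈C [ a ] ⊕ α → x ∈C α
    back (ax≢0 , eq) = x≢0 , ∙-cancelˡ [ a ] _ _ (trans (sym (trans (cls-* (ζ^≢0 a) x≢0) (cong (_⊕ cls x) (cls-ζ^ a)))) eq)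
      where
      x≢0 : x ≢ 0#
      x≢0 x≡0 = ax≢0 (trans (cong (ζ ^ a *_) x≡0) (F.zeroʳ _))

  ΣI-const : ∀ α → Σ (I α) ≡ Σ (I [ 0 ])
  ΣI-const α = sym (trans (Σ-cong λ x → trans (sym (I-scale a [ 0 ] x)) (cong (λ β → I β (ζ ^ a * x)) (trans (Z.+-identityʳ _) ([]-toℕ α))))
    (Σ-scale (ζ^≢0 a) (I α)))
    where
    a = Data.Fin.toℕ α

  -- Multiplication by powers of ζ permutes the e classes transitively, so they have equal size;
  -- together they exhaust the m = e w nonzero elements.
  ΣI : ∀ α → Σ (I α) ≡ W
  ΣI α = trans (ΣI-const α) (ℤ.*-cancelˡ-≡ (+ e) (Σ (I [ 0 ])) W (begin
    + e ℤ.* Σ (I [ 0 ])                         ≡⟨ Sₑ.Σ-const _ ⟨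
    Sₑ.Σ (λ _ → Σ (I [ 0 ]))                    ≡⟨ Sₑ.Σ-cong (λ α → sym (ΣI-const α)) ⟩
    Sₑ.Σ (λ α → Σ (I α))                        ≡⟨ swap ⟩
    Σ (λ x → Sₑ.Σ (λ α → I α x))                ≡⟨ Σ-cong column ⟩
    Σ (λ x → 1ℤ ℤ.+ ℤ.- 𝟙 (x ≟ 0#))             ≡⟨ Σ-+ (λ _ → 1ℤ) (λ x → ℤ.- 𝟙 (x ≟ 0#)) ⟩
    Σ (λ _ → 1ℤ) ℤ.+ Σ (λ x → ℤ.- 𝟙 (x ≟ 0#))   ≡⟨ cong₂ ℤ._+_ (Σ-const 1ℤ) (trans (Σ-single 0# (λ x → ℤ.- 𝟙 (x ≟ 0#)) (λ x x≢0 → cong ℤ.-_ (𝟙-false (x ≟ 0#) x≢0))) (cong ℤ.-_ (𝟙-true (0# ≟ 0#) refl))) ⟩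
    Q ℤ.* 1ℤ ℤ.+ ℤ.- 1ℤ                         ≡⟨ cong (ℤ._+ ℤ.- 1ℤ) (ℤ.*-identityʳ Q) ⟩
    + m                                         ≡⟨ cong +_ m≡ew ⟩
    + (e ℕ.* w)                                 ≡⟨ ℤ.pos-* e w ⟩
    + e ℤ.* W                                   ∎))
    where
    open ≡-Reasoning
    swap : Sₑ.Σ (λ α → Σ (I α)) ≡ Σ (λ x → Sₑ.Σ (λ α → I α x))
    swap = trans (Sₑ.Σ-cong λ α → Σ≡sum (I α)) (trans (Sₑ.Σ≡sum _) (trans (∑-comm ℤ.+-0-commutativeMonoid {e} {q} I)
      (trans (sym (Σ≡sum _)) (Σ-cong λ x → sym (Sₑ.Σ≡sum (λ α → I α x))))))
    column : ∀ x → Sₑ.Σ (λ α → I α x) ≡ 1ℤ ℤ.+ ℤ.- 𝟙 (x ≟ 0#)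
    column x = by-cases (x ≟ 0#)
      where
      by-cases : Dec (x ≡ 0#) → Sₑ.Σ (λ α → I α x) ≡ 1ℤ ℤ.+ ℤ.- 𝟙 (x ≟ 0#)
      by-cases (yes x≡0) = trans (Sₑ.Σ-0 (λ α → I α x) (λ α → 𝟙-false (x ∈C? α) (λ x∈ → proj₁ x∈ x≡0)))
        (sym (cong (λ n → 1ℤ ℤ.+ ℤ.- n) (𝟙-true (x ≟ 0#) x≡0)))
      by-cases (no x≢0) = trans (Sₑ.Σ-single (cls x) (λ α → I α x) (λ α α≢ → 𝟙-false (x ∈C? α) (λ x∈ → α≢ (sym (proj₂ x∈)))))
        (trans (𝟙-true (x ∈C? cls x) (x≢0 , refl)) (sym (cong (λ n → 1ℤ ℤ.+ ℤ.- n) (𝟙-false (x ≟ 0#) x≢0))))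

  I-invariant : ∀ {κ} → κ ∈C [ 0 ] → ∀ α x → I α (κ * x) ≡ I α x
  I-invariant {κ} (κ≢0 , κ∈K) α x = trans
    (cong₂ (λ β y → I β (y * x)) (sym (trans (cong (_⊕ α) (trans (sym (cls≡[lg] κ)) κ∈K)) (Z.+-identityˡ α))) (sym (ζ^lg κ≢0)))
    (I-scale (lg κ) α x)

  Σ-product : ∀ f g → Σ f ℤ.* Σ g ≡ Σ λ i → Σ λ j → f i ℤ.* g j
  Σ-product f g = trans (sym (Σ-*ʳ (Σ g) f)) (Σ-cong λ i → sym (Σ-* (f i) g))

  Σ-swap₃ : ∀ (h : Fin q → Fin q → Fin q → ℤ) →
            (Σ λ u → Σ λ b → Σ λ a → h u b a) ≡ (Σ λ a → Σ λ u → Σ λ b → h u b a)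
  Σ-swap₃ h = trans (Σ-cong λ u → Σ-swap (h u)) (Σ-swap (λ u a → Σ λ b → h u b a))

  square-≥0 : ∀ i → 0ℤ ℤ.≤ i ℤ.* i
  square-≥0 (+ n) = ℤ.≤-trans (ℤ.+≤+ ℕ.z≤n) (ℤ.≤-reflexive (ℤ.pos-* n n))
  square-≥0 ℤ.-[1+ n ] = ℤ.+≤+ ℕ.z≤n

  Σ-≥0 : ∀ f → (∀ x → 0ℤ ℤ.≤ f x) → 0ℤ ℤ.≤ Σ f
  Σ-≥0 f f≥0 = ℤ.≤-trans (ℤ.≤-reflexive (sym (Σ-0 (λ _ → 0ℤ) (λ _ → refl)))) (Σ-mono f≥0)

  *-weaken : ∀ {i j} → i ℤ.≤ 1ℤ → 0ℤ ℤ.≤ j → i ℤ.* j ℤ.≤ j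
  *-weaken {i} {j} i≤1 0≤j = ℤ.≤-trans (ℤ.*-monoʳ-≤-nonNeg j {{ℤ.nonNegative 0≤j}} i≤1) (ℤ.≤-reflexive (ℤ.*-identityˡ j))

  +-cancelˡ-≤ : ∀ k i j → k ℤ.+ i ℤ.≤ k ℤ.+ j → i ℤ.≤ j
  +-cancelˡ-≤ k i j le = subst₂ ℤ._≤_ (cancel k i) (cancel k j) (ℤ.+-monoʳ-≤ (ℤ.- k) le)
    where
    cancel : ∀ k i → ℤ.- k ℤ.+ (k ℤ.+ i) ≡ i
    cancel = solve-∀

  -- At u = -1 the argument b + u a is b - a, so that the sum counts the ways to write b as a sum of
  -- elements of two given classes.
  -1# : Fin q
  -1# = - 1#

  -1*-1 : ∀ x → -1# * (-1# * x) ≡ x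
  -1*-1 x = trans (-1*x≈-x _) (trans (cong -_ (-1*x≈-x x)) (-‿involutive x))

  module _ (α γ : Fin e) where
    -- The centred indicator 1 - w/q or -w/q, scaled by q to stay in the integers.
    g : Fin q → ℤ
    g s = Q ℤ.* I γ s ℤ.+ ℤ.- W

    Σg≡0 : Σ g ≡ 0ℤ
    Σg≡0 = begin
      Σ g                                               ≡⟨ Σ-+ (λ s → Q ℤ.* I γ s) (λ _ → ℤ.- W) ⟩
      Σ (λ s → Q ℤ.* I γ s) ℤ.+ Σ (λ _ → ℤ.- W)         ≡⟨ cong₂ ℤ._+_ (trans (Σ-* Q (I γ)) (cong (Q ℤ.*_) (ΣI γ))) (Σ-const (ℤ.- W)) ⟩
      Q ℤ.* W ℤ.+ Q ℤ.* ℤ.- W                           ≡⟨ cancel Q W ⟩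
      0ℤ                                                ∎
      where
      open ≡-Reasoning
      cancel : ∀ x y → x ℤ.* y ℤ.+ x ℤ.* ℤ.- y ≡ 0ℤ
      cancel = solve-∀

    D : ℤ
    D = Σ λ s → g s ℤ.* g s

    D≡ : D ≡ Q ℤ.* W ℤ.* (Q ℤ.- W)
    D≡ = begin
      D                                                      ≡⟨ Σ-cong (λ s → trans (expand Q W (I γ s)) (cong (λ i → Q ℤ.* Q ℤ.* i ℤ.- (+ 2) ℤ.* (Q ℤ.* W) ℤ.* I γ s ℤ.+ W ℤ.* W) (I-idem γ s))) ⟩
      Σ (λ s → Q ℤ.* Q ℤ.* I γ s ℤ.- (+ 2) ℤ.* (Q ℤ.* W) ℤ.* I γ s ℤ.+ W ℤ.* W) ≡⟨ Σ-cong (λ s → collect Q W (I γ s)) ⟩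
      Σ (λ s → c ℤ.* I γ s ℤ.+ W ℤ.* W)                      ≡⟨ Σ-+ (λ s → c ℤ.* I γ s) (λ _ → W ℤ.* W) ⟩
      Σ (λ s → c ℤ.* I γ s) ℤ.+ Σ (λ _ → W ℤ.* W)            ≡⟨ cong₂ ℤ._+_ (trans (Σ-* c (I γ)) (cong (c ℤ.*_) (ΣI γ))) (Σ-const (W ℤ.* W)) ⟩
      c ℤ.* W ℤ.+ Q ℤ.* (W ℤ.* W)                            ≡⟨ finish Q W ⟩
      Q ℤ.* W ℤ.* (Q ℤ.- W)                                  ∎
      where
      open ≡-Reasoning
      c = Q ℤ.* Q ℤ.- (+ 2) ℤ.* (Q ℤ.* W)
      expand : ∀ x y i → (x ℤ.* i ℤ.+ ℤ.- y) ℤ.* (x ℤ.* i ℤ.+ ℤ.- y) ≡ x ℤ.* x ℤ.* (i ℤ.* i) ℤ.- (+ 2) ℤ.* (x ℤ.* y) ℤ.* i ℤ.+ y ℤ.* y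
      expand = solve-∀
      collect : ∀ x y i → x ℤ.* x ℤ.* i ℤ.- (+ 2) ℤ.* (x ℤ.* y) ℤ.* i ℤ.+ y ℤ.* y ≡ (x ℤ.* x ℤ.- (+ 2) ℤ.* (x ℤ.* y)) ℤ.* i ℤ.+ y ℤ.* y
      collect = solve-∀
      finish : ∀ x y → (x ℤ.* x ℤ.- (+ 2) ℤ.* (x ℤ.* y)) ℤ.* y ℤ.+ x ℤ.* (y ℤ.* y) ≡ x ℤ.* y ℤ.* (x ℤ.- y)
      finish = solve-∀

    correlation : Fin q → Fin q → ℤ
    correlation a a′ = Σ λ u → Σ λ b → g (b + u * a) ℤ.* g (b + u * a′)

    correlation-diagonal : ∀ a → correlation a a ≡ Q ℤ.* D
    correlation-diagonal a = trans (Σ-cong λ u → Σ-translate (u * a) (λ s → g s ℤ.* g s)) (Σ-const D)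

    -- After translating b by u a, the second argument is b + (a′ - a) u. For fixed b it runs over
    -- the whole field with u, and g sums to 0.
    correlation-off-diagonal : ∀ a a′ → a′ ≢ a → correlation a a′ ≡ 0ℤ
    correlation-off-diagonal a a′ a′≢a = begin
      correlation a a′                                           ≡⟨ Σ-cong (λ u → Σ-cong λ b → cong (λ s → g (b + u * a) ℤ.* g s) (shift u b)) ⟩
      (Σ λ u → Σ λ b → g (b + u * a) ℤ.* g (b + u * a + d * u))  ≡⟨ Σ-cong (λ u → Σ-translate (u * a) (λ s → g s ℤ.* g (s + d * u))) ⟩
      (Σ λ u → Σ λ b → g b ℤ.* g (b + d * u))                    ≡⟨ Σ-swap (λ u b → g b ℤ.* g (b + d * u)) ⟩
      (Σ λ b → Σ λ u → g b ℤ.* g (b + d * u))                    ≡⟨ Σ-0 _ (λ b → trans (Σ-* (g b) (λ u → g (b + d * u))) (trans (cong (g b ℤ.*_) (trans (Σ-affine b d≢0 g) Σg≡0)) (ℤ.*-zeroʳ (g b)))) ⟩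
      0ℤ                                                         ∎
      where
      open ≡-Reasoning
      d = a′ - a
      d≢0 : d ≢ 0#
      d≢0 d≡0 = a′≢a (x∙y⁻¹≈ε⇒x≈y a′ a d≡0)
      shift : ∀ u b → b + u * a′ ≡ b + u * a + d * u
      shift u b = sym (trans (F.+-assoc b (u * a) (d * u)) (cong (λ s → b + s) (trans (cong (λ s → u * a + s) (F.*-comm d u)) (trans (sym (F.distribˡ u a d))
        (cong (u *_) (trans (F.+-comm a d) (trans (F.+-assoc a′ (- a) a) (trans (cong (λ s → a′ + s) (F.-‿inverseˡ a)) (F.+-identityʳ a′)))))))))

    S : Fin q → Fin q → ℤ
    S u b = Σ λ a → I α a ℤ.* g (b + u * a)

    Φ : Fin q → ℤ
    Φ u = Σ λ b → S u b ℤ.* S u b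

    -- Expanding the square and summing over u and b first, only the pairs a = a′ survive: w terms,
    -- each equal to q D.
    ΣΦ : Σ Φ ≡ W ℤ.* (Q ℤ.* D)
    ΣΦ = begin
      (Σ λ u → Σ λ b → S u b ℤ.* S u b)
        ≡⟨ Σ-cong (λ u → Σ-cong λ b → trans (Σ-product _ _) (Σ-cong λ a → Σ-cong λ a′ → interchange (I α a) _ (I α a′) _)) ⟩
      (Σ λ u → Σ λ b → Σ λ a → Σ λ a′ → X a a′ u b)                ≡⟨ Σ-swap₃ (λ u b a → Σ λ a′ → X a a′ u b) ⟩
      (Σ λ a → Σ λ u → Σ λ b → Σ λ a′ → X a a′ u b)                ≡⟨ Σ-cong (λ a → Σ-swap₃ (λ u b a′ → X a a′ u b)) ⟩
      (Σ λ a → Σ λ a′ → Σ λ u → Σ λ b → X a a′ u b)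
        ≡⟨ Σ-cong (λ a → Σ-cong λ a′ → trans (Σ-cong λ u → Σ-* (I α a ℤ.* I α a′) _) (Σ-* (I α a ℤ.* I α a′) _)) ⟩
      (Σ λ a → Σ λ a′ → I α a ℤ.* I α a′ ℤ.* correlation a a′)
        ≡⟨ Σ-cong (λ a → Σ-single a _ (λ a′ a′≢a → trans (cong (I α a ℤ.* I α a′ ℤ.*_) (correlation-off-diagonal a a′ a′≢a)) (ℤ.*-zeroʳ (I α a ℤ.* I α a′)))) ⟩
      (Σ λ a → I α a ℤ.* I α a ℤ.* correlation a a)
        ≡⟨ Σ-cong (λ a → cong₂ ℤ._*_ (I-idem α a) (correlation-diagonal a)) ⟩
      (Σ λ a → I α a ℤ.* (Q ℤ.* D))                                ≡⟨ Σ-*ʳ (Q ℤ.* D) (I α) ⟩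
      Σ (I α) ℤ.* (Q ℤ.* D)                                        ≡⟨ cong (ℤ._* (Q ℤ.* D)) (ΣI α) ⟩
      W ℤ.* (Q ℤ.* D)                                              ∎
      where
      open ≡-Reasoning
      X : Fin q → Fin q → Fin q → Fin q → ℤ
      X a a′ u b = I α a ℤ.* I α a′ ℤ.* (g (b + u * a) ℤ.* g (b + u * a′))
      interchange : ∀ i x j y → i ℤ.* x ℤ.* (j ℤ.* y) ≡ i ℤ.* j ℤ.* (x ℤ.* y)
      interchange = solve-∀

    -- At u = 0 every term of S is g(b). Subtracting this known part of the total is what turns one
    -- factor q of the final bound into q - w.
    Φ-0 : Φ 0# ≡ W ℤ.* W ℤ.* D
    Φ-0 = trans (Σ-cong λ b → trans (cong₂ ℤ._*_ (S-0 b) (S-0 b)) (rearrange W (g b))) (Σ-* (W ℤ.* W) (λ b → g b ℤ.* g b))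
      where
      S-0 : ∀ b → S 0# b ≡ W ℤ.* g b
      S-0 b = trans (Σ-cong λ a → cong (λ s → I α a ℤ.* g s) (trans (cong (λ s → b + s) (F.zeroˡ a)) (F.+-identityʳ b)))
        (trans (Σ-*ʳ (g b) (I α)) (cong (ℤ._* g b) (ΣI α)))
      rearrange : ∀ x y → x ℤ.* y ℤ.* (x ℤ.* y) ≡ x ℤ.* x ℤ.* (y ℤ.* y)
      rearrange = solve-∀

    Φ-≥0 : ∀ u → 0ℤ ℤ.≤ Φ u
    Φ-≥0 u = Σ-≥0 _ (λ b → square-≥0 (S u b))

    factor : ∀ κ b a → κ * b + -1# * κ * a ≡ κ * (b + -1# * a)
    factor κ b a = sym (trans (F.distribˡ κ b (-1# * a)) (cong (λ s → κ * b + s) (trans (sym (F.*-assoc κ -1# a)) (cong (_* a) (F.*-comm κ -1#)))))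

    g-invariant : ∀ {κ} → κ ∈C [ 0 ] → ∀ s → g (κ * s) ≡ g s
    g-invariant κ∈K s = cong (λ i → Q ℤ.* i ℤ.+ ℤ.- W) (I-invariant κ∈K γ s)

    Φ-invariant : ∀ {κ} → κ ∈C [ 0 ] → Φ (-1# * κ) ≡ Φ -1#
    Φ-invariant {κ} κ∈K = trans (sym (Σ-scale (proj₁ κ∈K) (λ b → S (-1# * κ) b ℤ.* S (-1# * κ) b)))
      (Σ-cong λ b → cong₂ ℤ._*_ (S-κ b) (S-κ b))
      where
      S-κ : ∀ b → S (-1# * κ) (κ * b) ≡ S -1# b
      S-κ b = Σ-cong λ a → cong (I α a ℤ.*_) (trans (cong g (factor κ b a)) (g-invariant κ∈K _))

    S-invariant : ∀ {κ} → κ ∈C [ 0 ] → ∀ b → S -1# (κ * b) ≡ S -1# b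
    S-invariant {κ} κ∈K b = trans (sym (Σ-scale (proj₁ κ∈K) (λ a → I α a ℤ.* g (κ * b + -1# * a))))
      (Σ-cong λ a → cong₂ ℤ._*_ (I-invariant κ∈K α a)
        (trans (cong g (trans (cong (λ s → κ * b + s) (sym (F.*-assoc -1# κ a))) (factor κ b a))) (g-invariant κ∈K _)))

    -- 0 lies outside -K, the w elements of -K all give the value Φ(-1), and every other term is
    -- nonnegative.
    Φ-lower : Φ 0# ℤ.+ W ℤ.* Φ -1# ℤ.≤ Σ Φ
    Φ-lower = ℤ.≤-trans (ℤ.≤-reflexive (sym (trans (Σ-+ _ _) (cong₂ ℤ._+_ at-0 at-K)))) (Σ-mono pointwise)
      where
      K : Fin q → ℤ
      -- The indicator of -K.
      K u = I [ 0 ] (-1# * u)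
      at-0 : Σ (λ u → 𝟙 (u ≟ 0#) ℤ.* Φ u) ≡ Φ 0#
      at-0 = trans (Σ-single 0# (λ u → 𝟙 (u ≟ 0#) ℤ.* Φ u) (λ u u≢0 → cong (ℤ._* Φ u) (𝟙-false (u ≟ 0#) u≢0)))
        (trans (cong (ℤ._* Φ 0#) (𝟙-true (0# ≟ 0#) refl)) (ℤ.*-identityˡ _))
      at-K : Σ (λ u → K u ℤ.* Φ u) ≡ W ℤ.* Φ -1#
      at-K = trans (sym (Σ-scale -1≢0 (λ u → K u ℤ.* Φ u))) (trans (Σ-cong reflect) (trans (Σ-*ʳ (Φ -1#) (I [ 0 ])) (cong (ℤ._* Φ -1#) (ΣI [ 0 ]))))
        where
        by-cases : ∀ u → Dec (u ∈C [ 0 ]) → I [ 0 ] u ℤ.* Φ (-1# * u) ≡ I [ 0 ] u ℤ.* Φ -1#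
        by-cases u (yes u∈K) = cong (I [ 0 ] u ℤ.*_) (Φ-invariant u∈K)
        by-cases u (no u∉K) = trans (cong (ℤ._* Φ (-1# * u)) I≡0) (sym (cong (ℤ._* Φ -1#) I≡0))
          where I≡0 = 𝟙-false (u ∈C? [ 0 ]) u∉K
        reflect : ∀ u → K (-1# * u) ℤ.* Φ (-1# * u) ≡ I [ 0 ] u ℤ.* Φ -1#
        reflect u = trans (cong (λ x → I [ 0 ] x ℤ.* Φ (-1# * u)) (-1*-1 u)) (by-cases u (u ∈C? [ 0 ]))
      pointwise : ∀ u → 𝟙 (u ≟ 0#) ℤ.* Φ u ℤ.+ K u ℤ.* Φ u ℤ.≤ Φ u
      pointwise u = by-cases (u ≟ 0#)
        where
        by-cases : Dec (u ≡ 0#) → 𝟙 (u ≟ 0#) ℤ.* Φ u ℤ.+ K u ℤ.* Φ u ℤ.≤ Φ u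
        by-cases (yes u≡0) = ℤ.≤-reflexive (trans (cong₂ (λ i j → i ℤ.* Φ u ℤ.+ j ℤ.* Φ u) (𝟙-true (u ≟ 0#) u≡0)
          (𝟙-false (-1# * u ∈C? [ 0 ]) (λ u∈ → proj₁ u∈ (trans (cong (-1# *_) u≡0) (F.zeroʳ -1#)))))
          (trans (ℤ.+-identityʳ _) (ℤ.*-identityˡ _)))
        by-cases (no u≢0) = ℤ.≤-trans (ℤ.≤-reflexive (trans (cong (λ i → i ℤ.* Φ u ℤ.+ K u ℤ.* Φ u) (𝟙-false (u ≟ 0#) u≢0)) (ℤ.+-identityˡ _)))
          (*-weaken (𝟙-≤1 (-1# * u ∈C? [ 0 ])) (Φ-≥0 u))

    module _ {b₀ : Fin q} (b₀≢0 : b₀ ≢ 0#) where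
      count : ℤ
      count = Σ λ a → I α a ℤ.* I γ (b₀ + -1# * a)

      S≡count : S -1# b₀ ≡ Q ℤ.* count ℤ.- W ℤ.* W
      S≡count = begin
        S -1# b₀                                                  ≡⟨ Σ-cong (λ a → expand Q W (I α a) _) ⟩
        (Σ λ a → Q ℤ.* (I α a ℤ.* I γ (b₀ + -1# * a)) ℤ.+ I α a ℤ.* ℤ.- W)  ≡⟨ Σ-+ (λ a → Q ℤ.* (I α a ℤ.* I γ (b₀ + -1# * a))) (λ a → I α a ℤ.* ℤ.- W) ⟩
        Σ (λ a → Q ℤ.* (I α a ℤ.* I γ (b₀ + -1# * a))) ℤ.+ Σ (λ a → I α a ℤ.* ℤ.- W) ≡⟨ cong₂ ℤ._+_ (Σ-* Q (λ a → I α a ℤ.* I γ (b₀ + -1# * a))) (trans (Σ-*ʳ (ℤ.- W) (I α)) (cong (ℤ._* ℤ.- W) (ΣI α))) ⟩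
        Q ℤ.* count ℤ.+ W ℤ.* ℤ.- W                               ≡⟨ cong (λ s → Q ℤ.* count ℤ.+ s) (sym (ℤ.neg-distribʳ-* W W)) ⟩
        Q ℤ.* count ℤ.- W ℤ.* W                                   ∎
        where
        open ≡-Reasoning
        expand : ∀ x y i j → i ℤ.* (x ℤ.* j ℤ.+ ℤ.- y) ≡ x ℤ.* (i ℤ.* j) ℤ.+ i ℤ.* ℤ.- y
        expand = solve-∀

      Φ-1-lower : W ℤ.* (S -1# b₀ ℤ.* S -1# b₀) ℤ.≤ Φ -1#
      Φ-1-lower = ℤ.≤-trans (ℤ.≤-reflexive (sym (trans (Σ-cong on-coset) (trans (Σ-*ʳ (S -1# b₀ ℤ.* S -1# b₀) (I β)) (cong (ℤ._* (S -1# b₀ ℤ.* S -1# b₀)) (ΣI β))))))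
        (Σ-mono λ b → *-weaken (𝟙-≤1 (b ∈C? β)) (square-≥0 (S -1# b)))
        where
        β = cls b₀
        by-cases : ∀ b → Dec (b ∈C β) → I β b ℤ.* (S -1# b ℤ.* S -1# b) ≡ I β b ℤ.* (S -1# b₀ ℤ.* S -1# b₀)
        by-cases b (no b∉) = trans (cong (ℤ._* (S -1# b ℤ.* S -1# b)) I≡0) (sym (cong (ℤ._* (S -1# b₀ ℤ.* S -1# b₀)) I≡0))
          where I≡0 = 𝟙-false (b ∈C? β) b∉
        by-cases b (yes (b≢0 , b∈)) = cong (λ s → I β b ℤ.* (s ℤ.* s)) (trans (cong (S -1#) (sym κb₀≡b)) (S-invariant κ∈K b₀))
          where
          κ = b * b₀ ⁻¹
          κb₀≡b : κ * b₀ ≡ b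
          κb₀≡b = trans (F.*-assoc b _ b₀) (trans (cong (b *_) (*-inverseˡ b₀≢0)) (F.*-identityʳ b))
          κ≢0 : κ ≢ 0#
          κ≢0 = *-≢0 b≢0 (ζ^≢0 (lg b₀ ℕ.* l))
          κ∈K : κ ∈C [ 0 ]
          κ∈K = κ≢0 , ∙-cancelʳ β (cls κ) [ 0 ] (trans (sym (cls-* κ≢0 b₀≢0)) (trans (cong cls κb₀≡b) (trans b∈ (sym (Z.+-identityˡ β)))))
        on-coset : ∀ b → I β b ℤ.* (S -1# b ℤ.* S -1# b) ≡ I β b ℤ.* (S -1# b₀ ℤ.* S -1# b₀)
        on-coset b = by-cases b (b ∈C? β)

      -- The pairs in -K × b₀K contribute w² S² and the line u = 0 contributes w² D to the total w q
      -- D. What is left is w² S² ≤ w (q - w) D, and D = q w (q - w) lets w² cancel.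
      deviation : let E = Q ℤ.* count ℤ.- W ℤ.* W in E ℤ.* E ℤ.≤ Q ℤ.* ((Q ℤ.- W) ℤ.* (Q ℤ.- W))
      deviation = ℤ.*-cancelˡ-≤-pos _ _ (W ℤ.* W) {{W*W-pos}} (+-cancelˡ-≤ (W ℤ.* W ℤ.* D) _ _ (begin
        W ℤ.* W ℤ.* D ℤ.+ W ℤ.* W ℤ.* (E ℤ.* E)              ≡⟨ cong₂ (λ x s → x ℤ.+ W ℤ.* W ℤ.* (s ℤ.* s)) (sym Φ-0) (sym S≡count) ⟩
        Φ 0# ℤ.+ W ℤ.* W ℤ.* (S₀ ℤ.* S₀)                     ≡⟨ cong (λ s → Φ 0# ℤ.+ s) (ℤ.*-assoc W W (S₀ ℤ.* S₀)) ⟩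
        Φ 0# ℤ.+ W ℤ.* (W ℤ.* (S₀ ℤ.* S₀))                   ≤⟨ ℤ.+-monoʳ-≤ (Φ 0#) (ℤ.*-monoˡ-≤-nonNeg W Φ-1-lower) ⟩
        Φ 0# ℤ.+ W ℤ.* Φ -1#                                 ≤⟨ Φ-lower ⟩
        Σ Φ                                                  ≡⟨ ΣΦ ⟩
        W ℤ.* (Q ℤ.* D)                                      ≡⟨ split W Q D ⟩
        W ℤ.* W ℤ.* D ℤ.+ W ℤ.* (Q ℤ.- W) ℤ.* D              ≡⟨ cong (λ d → W ℤ.* W ℤ.* D ℤ.+ W ℤ.* (Q ℤ.- W) ℤ.* d) D≡ ⟩
        W ℤ.* W ℤ.* D ℤ.+ W ℤ.* (Q ℤ.- W) ℤ.* (Q ℤ.* W ℤ.* (Q ℤ.- W)) ≡⟨ cong (λ s → W ℤ.* W ℤ.* D ℤ.+ s) (regroup W Q) ⟩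
        W ℤ.* W ℤ.* D ℤ.+ W ℤ.* W ℤ.* (Q ℤ.* ((Q ℤ.- W) ℤ.* (Q ℤ.- W))) ∎))
        where
        open ℤ.≤-Reasoning
        E = Q ℤ.* count ℤ.- W ℤ.* W
        S₀ = S -1# b₀
        W*W-pos : ℤ.Positive (W ℤ.* W)
        W*W-pos = subst ℤ.Positive (ℤ.pos-* w w) (ℤ.positive (ℤ.+<+ (ℕ.>-nonZero⁻¹ (w ℕ.* w) {{ℕ.m*n≢0 w w}})))
        split : ∀ x y z → x ℤ.* (y ℤ.* z) ≡ x ℤ.* x ℤ.* z ℤ.+ x ℤ.* (y ℤ.- x) ℤ.* z
        split = solve-∀
        regroup : ∀ x y → x ℤ.* (y ℤ.- x) ℤ.* (y ℤ.* x ℤ.* (y ℤ.- x)) ≡ x ℤ.* x ℤ.* (y ℤ.* ((y ℤ.- x) ℤ.* (y ℤ.- x)))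
        regroup = solve-∀

-- Sidon transversals

module Supply {a} {A : Set a} (_≟_ : DecidableEquality A) where
  open import Level using (_⊔_)
  open import Data.List using (List; []; _∷_; length; filter)
  open import Data.List.Membership.Propositional using (_∈_)
  open import Data.List.Relation.Unary.All as All using (All; []; _∷_)
  import Data.List.Relation.Unary.All.Properties as All
  open import Data.List.Relation.Unary.Any using (here; there)
  open import Data.List.Relation.Unary.AllPairs using ([]; _∷_)
  open import Data.List.Relation.Unary.Unique.Propositional using (Unique)
  import Data.List.Relation.Unary.Unique.Propositional.Properties as Unique
  open import Data.Nat using (_≤_; _+_; z≤n; s≤s)
  import Data.Nat.Properties as ℕ
  open import Data.Product using (_×_; _,_; ∃-syntax)
  open import Relation.Binary.PropositionalEquality as ≡ using (_≢_; refl)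
  open import Relation.Nullary using (¬_; yes; no; contradiction; ¬?)
  open import Relation.Unary using (Pred; Decidable)

  -- The index n is a budget: each equation to be avoided lowers it by the number of its solutions,
  -- so that the total cost can be read off from the type.
  record Supply {r} (R : Pred A r) (n : ℕ) : Set (a ⊔ r) where
    constructor supply
    field
      elements : List A
      unique   : Unique elements
      sound    : All R elements
      enough   : n ≤ length elements

  choose : ∀ {r} {R : Pred A r} {n} → Supply R (suc n) → ∃[ y ] R y
  choose (supply (y ∷ _) _ (Ry ∷ _) _) = y , Ry

  weaken : ∀ {r s} {R : Pred A r} {S : Pred A s} {n} → (∀ {y} → R y → S y) → Supply R n → Supply S n
  weaken f (supply ys u s e) = supply ys u (All.map f s) e

  fewer : ∀ {r} {R : Pred A r} {m n} → m ≤ n → Supply R n → Supply R m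
  fewer m≤n (supply ys u s e) = supply ys u s (ℕ.≤-trans m≤n e)

  module _ {r p} {R : Pred A r} {P : Pred A p} (P? : Decidable P) where

    private
      remaining : List A → List A
      remaining = filter (λ y → ¬? (P? y))

      keeps-all : ∀ ys → All (λ y → ¬ P y) ys → length ys ≤ length (remaining ys)
      keeps-all [] [] = z≤n
      keeps-all (y ∷ ys) (¬Py ∷ ¬P) with P? y
      ... | yes Py = contradiction Py ¬Py
      ... | no _ = s≤s (keeps-all ys ¬P)

    loses-≤1 : (∀ {y y′} → R y → R y′ → P y → P y′ → y ≡ y′) →
               ∀ ys → Unique ys → All R ys → length ys ≤ suc (length (remaining ys))
    loses-≤1 unique [] _ _ = z≤n
    loses-≤1 unique (y ∷ ys) (y∉ ∷ u) (Ry ∷ Rys) with P? y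
    ... | no _ = s≤s (loses-≤1 unique ys u Rys)
    ... | yes Py = s≤s (keeps-all ys (All.zipWith (λ (y≢ , Ry′) Py′ → y≢ (unique Ry Ry′ Py Py′)) (y∉ , Rys)))

    -- Uniqueness is asked only of elements satisfying R: it is the class of y, already recorded in
    -- R, that leaves an equation a single solution.
    prune : (∀ {y y′} → R y → R y′ → P y → P y′ → y ≡ y′) →
            ∀ {n} → Supply R (suc n) → Supply (λ y → R y × ¬ P y) n
    prune unique (supply ys u s e) = supply (remaining ys) (Unique.filter⁺ _ u)
      (All.zip (All.filter⁺ _ s , All.all-filter _ ys))
      (ℕ.≤-pred (ℕ.≤-trans e (loses-≤1 unique ys u s)))

  -- Removing one solution first leaves a predicate with at most one solution.
  prune₂ : ∀ {r p} {R : Pred A r} {P : Pred A p} → Decidable P →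
           (∀ {y y′ y″} → R y → R y′ → R y″ → P y → P y′ → P y″ → y ≢ y′ → y ≢ y″ → y′ ≡ y″) →
           ∀ {n} → Supply R (2 + n) → Supply (λ y → R y × ¬ P y) n
  prune₂ {R = R} {P} P? unique {n} S@(supply ys u s e) with Data.List.Relation.Unary.Any.any? P? ys
  ... | no ¬any = supply ys u (All.zip (s , All.¬Any⇒All¬ ys ¬any)) (ℕ.≤-trans (ℕ.m≤n+m n 2) e)
  ... | yes any with y₀ , y₀∈ , Py₀ ← Data.List.Membership.Propositional.find any =
    weaken (λ ((Ry , _) , ¬P) → Ry , ¬P)
      (prune P? (λ (Ry , y≢) (Ry′ , y′≢) Py Py′ → unique (All.lookup s y₀∈) Ry Ry′ Py₀ Py Py′ (λ eq → y≢ (≡.sym eq)) (λ eq → y′≢ (≡.sym eq)))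
        (prune (_≟ y₀) (λ { _ _ refl refl → refl }) S))

  pruneAll : ∀ {r p i} {R : Pred A r} {J : Set i} {P : J → Pred A p} → (∀ j → Decidable (P j)) → ∀ js →
             (∀ {j} → j ∈ js → ∀ {y y′} → R y → R y′ → P j y → P j y′ → y ≡ y′) →
             ∀ {n} → Supply R (length js + n) → Supply (λ y → R y × ∀ {j} → j ∈ js → ¬ P j y) n
  pruneAll P? [] unique S = weaken (λ Ry → Ry , λ ()) S
  pruneAll P? (j ∷ js) unique S =
    weaken (λ ((Ry , ¬Pj) , ¬P) → Ry , λ { (here refl) → ¬Pj ; (there j∈) → ¬P j∈ })
      (pruneAll P? js (λ j∈ (Ry , _) (Ry′ , _) → unique (there j∈) Ry Ry′)
        (prune (P? j) (unique (here refl)) S))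

-- Supplies of field elements and the equations to avoid

module SidonSets {l : ℕ} (FF : FiniteField (suc l)) (e w : ℕ) .{{_ : NonZero e}} .{{_ : NonZero w}}
                 (m≡ew : suc l ≡ e ℕ.* w) where
  open Cyclotomy FF e w m≡ew
  open SecondMoment FF e w m≡ew using (I; ΣI; deviation; count)
  open import Data.Fin using (Fin; _≟_)
  open import Data.Integer as ℤ using (+_)
  import Data.Integer.Properties as ℤ
  open import Data.Integer.Tactic.RingSolver using (solve-∀)
  open import Data.List using (List; length; allFin; filter)
  import Data.List.Relation.Unary.All.Properties as All
  import Data.List.Relation.Unary.Unique.Propositional.Properties as Unique
  open import Data.Nat using (_≤_; _<_)
  import Data.Nat.Properties as ℕ
  open import Data.Product using (_×_; _,_)
  open import Relation.Binary.PropositionalEquality as ≡ hiding ([_])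
  open import Relation.Nullary using (¬_; _×-dec_)
  open import Relation.Unary using (Decidable)
  open import Algebra.Properties.Ring ring using (x∙y⁻¹≈ε⇒x≈y; -1*x≈-x; [y-z]x≈yx-zx; -‿distribʳ-*; -‿involutive)
  open import Algebra.Properties.CommutativeSemigroup *-commutativeSemigroup using (interchange)
  open Supply (_≟_ {suc (suc l)}) public
  open ZMod e using ([_])
  private
    m = suc l
    q = suc m
    module Z = CommutativeRing (ZMod.commutativeRing e)

  supplyOf : ∀ {p} {P : Fin q → Set p} (P? : Decidable P) {n} → n ≤ length (filter P? (allFin q)) → Supply P n
  supplyOf P? = supply (filter P? (allFin q)) (Unique.filter⁺ P? (Unique.allFin⁺ q)) (All.all-filter P? (allFin q))

  classSupply : ∀ α → Supply (_∈C α) w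
  classSupply α = supplyOf (_∈C? α) (ℕ.≤-reflexive (sym (ℤ.+-injective (trans (sym (Σ-𝟙 (_∈C? α))) (ΣI α)))))

  -- Here r = q - w and δ = w² - q M. If the number N of pairs were at most M, then w² - q N ≥ δ,
  -- and the second moment bound would give δ² ≤ q r².
  pairSupply : ∀ α γ {b} → b ≢ 0# → ∀ M {r δ} → q ≡ w ℕ.+ r → w ℕ.* w ≡ q ℕ.* M ℕ.+ δ →
               q ℕ.* (r ℕ.* r) < δ ℕ.* δ → Supply (λ y → y ∈C α × b - y ∈C γ) (suc M)
  pairSupply α γ {b} b≢0 M {r} {δ} q≡w+r w²≡qM+δ qr²<δ² = supplyOf pair? (ℕ.≰⇒> N≰M)
    where
    pair? : Decidable (λ y → y ∈C α × b - y ∈C γ)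
    pair? y = (y ∈C? α) ×-dec (b - y ∈C? γ)
    N = length (filter pair? (allFin q))
    count≡N : count α γ b≢0 ≡ + N
    count≡N = trans (Σ-cong λ y → trans (cong (λ z → I α y ℤ.* I γ (b + z)) (-1*x≈-x y)) (sym (𝟙-×-dec (y ∈C? α) (b - y ∈C? γ)))) (Σ-𝟙 pair?)
    N≰M : ¬ N ≤ M
    N≰M N≤M with d , refl ← ℕ.m≤n⇒∃[o]m+o≡n N≤M = ℕ.<⇒≱ qr²<δ² (ℕ.≤-trans (ℕ.*-mono-≤ (ℕ.m≤n+m δ (q ℕ.* d)) (ℕ.m≤n+m δ (q ℕ.* d)))
      (ℤ.drop‿+≤+ (subst₂ ℤ._≤_ lhs rhs (deviation α γ b≢0))))
      where
      w²≡ : + w ℤ.* + w ≡ + q ℤ.* (+ N ℤ.+ + d) ℤ.+ + δ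
      w²≡ = trans (sym (ℤ.pos-* w w)) (trans (cong +_ w²≡qM+δ) (trans (ℤ.pos-+ (q ℕ.* (N ℕ.+ d)) δ)
        (cong (ℤ._+ + δ) (trans (ℤ.pos-* q (N ℕ.+ d)) (cong (+ q ℤ.*_) (ℤ.pos-+ N d))))))
      square : ∀ x n d δ → (x ℤ.* n ℤ.- (x ℤ.* (n ℤ.+ d) ℤ.+ δ)) ℤ.* (x ℤ.* n ℤ.- (x ℤ.* (n ℤ.+ d) ℤ.+ δ)) ≡ (x ℤ.* d ℤ.+ δ) ℤ.* (x ℤ.* d ℤ.+ δ)
      square = solve-∀
      lhs : (+ q ℤ.* count α γ b≢0 ℤ.- + w ℤ.* + w) ℤ.* (+ q ℤ.* count α γ b≢0 ℤ.- + w ℤ.* + w) ≡ + ((q ℕ.* d ℕ.+ δ) ℕ.* (q ℕ.* d ℕ.+ δ))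
      lhs = trans (cong₂ (λ n x → (+ q ℤ.* n ℤ.- x) ℤ.* (+ q ℤ.* n ℤ.- x)) count≡N w²≡) (trans (square (+ q) (+ N) (+ d) (+ δ))
        (sym (trans (ℤ.pos-* (q ℕ.* d ℕ.+ δ) _) (cong₂ ℤ._*_ qd+δ qd+δ))))
        where
        qd+δ : + (q ℕ.* d ℕ.+ δ) ≡ + q ℤ.* + d ℤ.+ + δ
        qd+δ = trans (ℤ.pos-+ (q ℕ.* d) δ) (cong (ℤ._+ + δ) (ℤ.pos-* q d))
      difference : + q ℤ.- + w ≡ + r
      difference = trans (cong (λ x → + x ℤ.- + w) q≡w+r) (trans (cong (ℤ._- + w) (ℤ.pos-+ w r)) (cancel (+ w) (+ r)))
        where
        cancel : ∀ x y → x ℤ.+ y ℤ.- x ≡ y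
        cancel = solve-∀
      rhs : + q ℤ.* ((+ q ℤ.- + w) ℤ.* (+ q ℤ.- + w)) ≡ + (q ℕ.* (r ℕ.* r))
      rhs = trans (cong (λ x → + q ℤ.* (x ℤ.* x)) difference) (sym (trans (ℤ.pos-* q (r ℕ.* r)) (cong (+ q ℤ.*_) (ℤ.pos-* r r))))

  a-c≡d-b : ∀ {a b c d} → a + b ≡ c + d → a - c ≡ d - b
  a-c≡d-b {a} {b} {c} {d} eq = begin
    a - c               ≡⟨ cong (_- c) (trans (sym (F.+-identityʳ a)) (trans (cong (λ s → a + s) (sym (F.-‿inverseʳ b))) (sym (F.+-assoc a b (- b))))) ⟩
    a + b - b - c       ≡⟨ cong (λ s → s - b - c) eq ⟩
    c + d - b - c       ≡⟨ cong (λ s → s - c) (F.+-assoc c d (- b)) ⟩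
    c + (d - b) - c     ≡⟨ cong (_- c) (F.+-comm c (d - b)) ⟩
    d - b + c - c       ≡⟨ F.+-assoc (d - b) c (- c) ⟩
    d - b + (c - c)     ≡⟨ cong (λ s → d - b + s) (F.-‿inverseʳ c) ⟩
    d - b + 0#          ≡⟨ F.+-identityʳ _ ⟩
    d - b               ∎
    where open ≡-Reasoning

  -- Both pairs are the roots of one quadratic: (y - y′)(y - z′) = 0.
  vieta : ∀ {y z y′ z′} → y + z ≡ y′ + z′ → y * z ≡ y′ * z′ → y ≢ y′ → y ≡ z′
  vieta {y} {z} {y′} {z′} sum product y≢y′ = *-cancelˡ y z′ (λ eq → y≢y′ (x∙y⁻¹≈ε⇒x≈y y y′ eq))
    (trans ([y-z]x≈yx-zx y y y′) (trans (a-c≡d-b yy+y′z′) (sym ([y-z]x≈yx-zx z′ y y′))))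
    where
    yy+y′z′ : y * y + y′ * z′ ≡ y′ * y + y * z′
    yy+y′z′ = begin
      y * y + y′ * z′     ≡⟨ cong (λ s → y * y + s) product ⟨
      y * y + y * z       ≡⟨ F.distribˡ y y z ⟨
      y * (y + z)         ≡⟨ cong (y *_) sum ⟩
      y * (y′ + z′)       ≡⟨ F.distribˡ y y′ z′ ⟩
      y * y′ + y * z′     ≡⟨ cong (_+ y * z′) (F.*-comm y y′) ⟩
      y′ * y + y * z′     ∎
      where open ≡-Reasoning

  square-roots : ∀ {y y′} → y * y ≡ y′ * y′ → y ≢ y′ → y ≡ - y′
  square-roots {y} {y′} eq = vieta (trans (F.-‿inverseʳ y) (sym (F.-‿inverseʳ y′)))
    (trans (sym (-‿distribʳ-* y y)) (trans (cong -_ eq) (-‿distribʳ-* y′ y′)))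

  -- A root y of Y(Y + c) = s has the companion root - (y + c).
  quadratic : ∀ {c s y y′ y″} → y * (y + c) ≡ s → y′ * (y′ + c) ≡ s → y″ * (y″ + c) ≡ s →
              y ≢ y′ → y ≢ y″ → y′ ≡ y″
  quadratic {c} {s} {y} {y′} {y″} eq eq′ eq″ y≢y′ y≢y″ = begin
    y′                   ≡⟨ companion y y′ (vieta (sums y y′) (products eq eq′) y≢y′) ⟩
    - (y + c)            ≡⟨ companion y y″ (vieta (sums y y″) (products eq eq″) y≢y″) ⟨
    y″                   ∎
    where
    open ≡-Reasoning
    open import Algebra.Properties.AbelianGroup F.+-abelianGroup using (⁻¹-∙-comm)
    y-[y+c] : ∀ y → y - (y + c) ≡ - c
    y-[y+c] y = trans (cong (λ s → y + s) (sym (⁻¹-∙-comm y c))) (trans (sym (F.+-assoc y _ _)) (trans (cong (_- c) (F.-‿inverseʳ y)) (F.+-identityˡ _)))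
    sums : ∀ y y′ → y + - (y + c) ≡ y′ + - (y′ + c)
    sums y y′ = trans (y-[y+c] y) (sym (y-[y+c] y′))
    products : ∀ {y y′} → y * (y + c) ≡ s → y′ * (y′ + c) ≡ s → y * - (y + c) ≡ y′ * - (y′ + c)
    products {y} {y′} eq eq′ = trans (sym (-‿distribʳ-* y _)) (trans (cong -_ (trans eq (sym eq′))) (-‿distribʳ-* y′ _))
    companion : ∀ y y′ → y ≡ - (y′ + c) → y′ ≡ - (y + c)
    companion y y′ eq = begin
      y′                            ≡⟨ F.+-identityʳ y′ ⟨
      y′ + 0#                       ≡⟨ cong (λ s → y′ + s) (F.-‿inverseʳ c) ⟨
      y′ + (c - c)                  ≡⟨ F.+-assoc y′ c (- c) ⟨
      y′ + c - c                    ≡⟨ cong (_- c) (trans (sym (-‿involutive (y′ + c))) (cong -_ (sym eq))) ⟩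
      - y - c                       ≡⟨ ⁻¹-∙-comm y c ⟩
      - (y + c)                     ∎

  -- Both equations give (b - y)/y the value v/u. Cross-multiplying, (b - y) y′ = (b - y′) y, and
  -- adding y y′ to both sides leaves b y′ = b y.
  ratio : ∀ {y y′ u v b} → u ≢ 0# → v ≢ 0# → b ≢ 0# →
          (b - y) * u ≡ y * v → (b - y′) * u ≡ y′ * v → y ≡ y′
  ratio {y} {y′} {u} {v} {b} u≢0 v≢0 b≢0 eq eq′ = *-cancelˡ y y′ b≢0 (begin
    b * y                   ≡⟨ cong (_* y) (complete y′) ⟨
    (b - y′ + y′) * y       ≡⟨ F.distribʳ y _ _ ⟩
    (b - y′) * y + y′ * y   ≡⟨ cong₂ _+_ (sym cross) (F.*-comm y′ y) ⟩
    (b - y) * y′ + y * y′   ≡⟨ F.distribʳ y′ _ _ ⟨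
    (b - y + y) * y′        ≡⟨ cong (_* y′) (complete y) ⟩
    b * y′                  ∎)
    where
    open ≡-Reasoning
    complete : ∀ y → b - y + y ≡ b
    complete y = trans (F.+-assoc b (- y) y) (trans (cong (λ s → b + s) (F.-‿inverseˡ y)) (F.+-identityʳ b))
    cross : (b - y) * y′ ≡ (b - y′) * y
    cross = *-cancelʳ _ _ (*-≢0 u≢0 v≢0) (begin
      (b - y) * y′ * (u * v)      ≡⟨ interchange (b - y) y′ u v ⟩
      (b - y) * u * (y′ * v)      ≡⟨ cong₂ _*_ eq (sym eq′) ⟩
      y * v * ((b - y′) * u)      ≡⟨ F.*-comm _ _ ⟩
      (b - y′) * u * (y * v)      ≡⟨ interchange (b - y′) u y v ⟩
      (b - y′) * y * (u * v)      ∎)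

-- Extending a partial block by one or two elements

module Greedy {l : ℕ} (FF : FiniteField (suc l)) (e w : ℕ) .{{_ : NonZero e}} .{{_ : NonZero w}}
              (m≡ew : suc l ≡ e ℕ.* w) where
  open Cyclotomy FF e w m≡ew
  open SidonSets FF e w m≡ew
  open import Data.Empty using (⊥-elim)
  open import Data.Fin using (Fin; _≟_)
  open import Data.List using (List; []; _∷_; length; map; cartesianProduct; _++_)
  open import Data.List.Membership.Propositional using (_∈_; find; lose)
  open import Data.List.Membership.Propositional.Properties using (∈-cartesianProduct⁺; ∈-cartesianProduct⁻; ∈-map⁺; ∈-map⁻; ∈-++⁺ˡ; ∈-++⁺ʳ; ∈-++⁻)
  open import Data.List.Properties using (length-map; length-++)
  open import Data.List.Relation.Unary.All as All using (All; []; _∷_)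
  open import Data.List.Relation.Unary.AllPairs using ([]; _∷_)
  open import Data.List.Relation.Unary.Any using (Any; here; there; any?)
  import Data.Nat.Properties as ℕ
  open import Data.Product using (_×_; _,_; proj₁; proj₂; ∃-syntax)
  open import Data.Sum using (_⊎_; inj₁; inj₂)
  open import Relation.Binary.PropositionalEquality as ≡ hiding ([_])
  open import Relation.Nullary using (¬_; Dec; yes; no; contradiction)
  open ZMod e using ([_]; _⊕_)
  open import Algebra.Properties.Ring ring using (-1*x≈-x; -‿injective; +-cancelˡ)
  private
    m = suc l
    q = suc m
    module Z = CommutativeRing (ZMod.commutativeRing e)
  open import Algebra.Properties.Group Z.+-group using (identityˡ-unique)

  -- For nonzero elements a u = b v says a/b = v/u: no quotient other than 1 is shared by `xs` and
  -- B. Quotient conditions are written as products throughout.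
  Cross : List (Fin q) → List (Fin q) → Set
  Cross xs B = ∀ {a b u v} → a ∈ xs → b ∈ xs → u ∈ B → v ∈ B → a * u ≡ b * v → a ≡ b

  record Partial (L : List (List (Fin q))) (xs : List (Fin q)) : Set where
    field
      nonzero  : ∀ {a} → a ∈ xs → a ≢ 0#
      separate : ∀ {a b} → a ∈ xs → b ∈ xs → cls a ≡ cls b → a ≡ b
      sidon    : ∀ {a b c d} → a ∈ xs → b ∈ xs → c ∈ xs → d ∈ xs → a * b ≡ c * d → a ≡ c × b ≡ d ⊎ a ≡ d × b ≡ c
      cross    : ∀ {B} → B ∈ L → Cross xs B

  record Extends (L : List (List (Fin q))) (xs : List (Fin q)) (y : Fin q) : Set where
    field
      nonzero : y ≢ 0#
      fresh   : ∀ {a} → a ∈ xs → cls y ≢ cls a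
      cross   : ∀ {B u v a} → B ∈ L → u ∈ B → v ∈ B → a ∈ xs → y * u ≢ a * v
      mixed   : ∀ {a b c} → a ∈ xs → b ∈ xs → c ∈ xs → y * c ≢ a * b
      square  : ∀ {a b} → a ∈ xs → b ∈ xs → y * y ≢ a * b

  partial-[] : ∀ L → Partial L []
  partial-[] L = record { nonzero = λ () ; separate = λ () ; sidon = λ () ; cross = λ _ () }

  -- An equation with the new element on both sides cancels to an equality of members. The others
  -- have y once, or twice on the same side; these are the shapes that `Extends` forbids.
  extend : ∀ {L xs y} → Partial L xs → Extends L xs y → Partial L (y ∷ xs)
  extend {L} {xs} {y} P E = record
    { nonzero = λ { (here refl) → E.nonzero ; (there a∈) → P.nonzero a∈ }
    ; separate = λ
      { (here refl) (here refl) _ → refl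
      ; (here refl) (there b∈) eq → ⊥-elim (E.fresh b∈ eq)
      ; (there a∈) (here refl) eq → ⊥-elim (E.fresh a∈ (sym eq))
      ; (there a∈) (there b∈) eq → P.separate a∈ b∈ eq }
    ; sidon = sidon
    ; cross = λ
      { B∈ (here refl) (here refl) _ _ _ → refl
      ; B∈ (here refl) (there b∈) u∈ v∈ eq → ⊥-elim (E.cross B∈ u∈ v∈ b∈ eq)
      ; B∈ (there a∈) (here refl) u∈ v∈ eq → ⊥-elim (E.cross B∈ v∈ u∈ a∈ (sym eq))
      ; B∈ (there a∈) (there b∈) u∈ v∈ eq → P.cross B∈ a∈ b∈ u∈ v∈ eq } }
    where
    module P = Partial P
    module E = Extends E
    cancelˡ : ∀ {a b} → y * a ≡ y * b → a ≡ b
    cancelˡ = *-cancelˡ _ _ E.nonzero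
    cancelʳ : ∀ {a b} → a * y ≡ b * y → a ≡ b
    cancelʳ = *-cancelʳ _ _ E.nonzero
    comm : ∀ {a b s} → a * b ≡ s → b * a ≡ s
    comm {a} {b} = trans (F.*-comm b a)
    sidon : ∀ {a b c d} → a ∈ y ∷ xs → b ∈ y ∷ xs → c ∈ y ∷ xs → d ∈ y ∷ xs → a * b ≡ c * d → a ≡ c × b ≡ d ⊎ a ≡ d × b ≡ c
    sidon (here refl) (here refl) (here refl) _ eq = inj₁ (refl , cancelˡ eq)
    sidon (here refl) (here refl) (there _) (here refl) eq = inj₁ (cancelʳ eq , refl)
    sidon (here refl) (here refl) (there c∈) (there d∈) eq = ⊥-elim (E.square c∈ d∈ eq)
    sidon (here refl) (there _) (here refl) _ eq = inj₁ (refl , cancelˡ eq)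
    sidon (here refl) (there _) (there _) (here refl) eq = inj₂ (refl , cancelʳ (comm eq))
    sidon (here refl) (there b∈) (there c∈) (there d∈) eq = ⊥-elim (E.mixed c∈ d∈ b∈ eq)
    sidon (there _) (here refl) (here refl) _ eq = inj₂ (cancelˡ (comm eq) , refl)
    sidon (there _) (here refl) (there _) (here refl) eq = inj₁ (cancelʳ eq , refl)
    sidon (there a∈) (here refl) (there c∈) (there d∈) eq = ⊥-elim (E.mixed c∈ d∈ a∈ (comm eq))
    sidon (there a∈) (there b∈) (here refl) (here refl) eq = ⊥-elim (E.square a∈ b∈ (sym eq))
    sidon (there a∈) (there b∈) (here refl) (there d∈) eq = ⊥-elim (E.mixed a∈ b∈ d∈ (sym eq))
    sidon (there a∈) (there b∈) (there c∈) (here refl) eq = ⊥-elim (E.mixed a∈ b∈ c∈ (comm (sym eq)))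
    sidon (there a∈) (there b∈) (there c∈) (there d∈) eq = P.sidon a∈ b∈ c∈ d∈ eq

  -- The cost of the last two elements, in the order of pruning: c + x + n for y, the same for z = b
  -- - y, f + n for their ratio, n for their product, 2 for each of two quadratics, with r
  -- candidates left over.
  obstructions : ℕ → ℕ → ℕ → ℕ → ℕ → ℕ
  obstructions c x n f r = c ℕ.+ (x ℕ.+ (n ℕ.+ (c ℕ.+ (x ℕ.+ (n ℕ.+ (f ℕ.+ (n ℕ.+ (n ℕ.+ (2 ℕ.+ (2 ℕ.+ r))))))))))

  -- The incident pairs of a block and one of its elements. They index the equations against earlier
  -- blocks, with the block kept so that the other member can be sought in it.
  flag : List (List (Fin q)) → List (List (Fin q) × Fin q)
  flag [] = []
  flag (B ∷ L) = map (B ,_) B ++ flag L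

  ∈-flag : ∀ {L B u} → B ∈ L → u ∈ B → (B , u) ∈ flag L
  ∈-flag {B ∷ L} (here refl) u∈ = ∈-++⁺ˡ (∈-map⁺ (B ,_) u∈)
  ∈-flag {B′ ∷ L} (there B∈) u∈ = ∈-++⁺ʳ (map (B′ ,_) B′) (∈-flag B∈ u∈)

  flag-∈ : ∀ {L B u} → (B , u) ∈ flag L → B ∈ L × u ∈ B
  flag-∈ {B′ ∷ L} f with ∈-++⁻ (map (B′ ,_) B′) f
  ... | inj₁ f∈ with v , v∈ , refl ← ∈-map⁻ (B′ ,_) f∈ = here refl , v∈
  ... | inj₂ f∈ with B∈ , u∈ ← flag-∈ f∈ = there B∈ , u∈

  length-flag : ∀ {L k} → All (λ B → length B ≡ k) L → length (flag L) ≡ length L ℕ.* k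
  length-flag [] = refl
  length-flag {B ∷ L} (refl ∷ sizes) = trans (length-++ (map (B ,_) B)) (cong₂ ℕ._+_ (length-map (B ,_) B) (length-flag sizes))

  Transversal : List (Fin q) → Set
  Transversal T = (∀ {u} → u ∈ T → u ≢ 0#) × (∀ {u v} → u ∈ T → v ∈ T → cls u ≡ cls v → u ≡ v)

  -- In each of the following equations the class of the member of T is determined,
  -- hence so is the member itself.
  module _ {T : List (Fin q)} (T-transversal : Transversal T) where
    private
      T≢0 = proj₁ T-transversal
      same = proj₂ T-transversal

    quotient-unique : ∀ {y y′ u u′ s α} → y ∈C α → y′ ∈C α → u ∈ T → u′ ∈ T → y * u ≡ s → y′ * u′ ≡ s → y ≡ y′
    quotient-unique (y≢0 , y∈) (y′≢0 , y′∈) u∈ u′∈ eq eq′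
      with refl ← same u∈ u′∈ (cls-cancelˡ y≢0 y′≢0 (T≢0 u∈) (T≢0 u′∈) (trans y∈ (sym y′∈)) (cong cls (trans eq (sym eq′)))) =
      *-cancelʳ _ _ (T≢0 u∈) (trans eq (sym eq′))

    member-unique : ∀ {x x′ u u′ s s′ α} → x ∈C α → x′ ∈C α → u ∈ T → u′ ∈ T → cls s ≡ cls s′ →
                    x * u ≡ s → x′ * u′ ≡ s′ → u ≡ u′
    member-unique (x≢0 , x∈) (x′≢0 , x′∈) u∈ u′∈ cls-s eq eq′ =
      same u∈ u′∈ (cls-cancelˡ x≢0 x′≢0 (T≢0 u∈) (T≢0 u′∈) (trans x∈ (sym x′∈)) (trans (cong cls eq) (trans cls-s (sym (cong cls eq′)))))

  cls-cong : ∀ {x x′ y y′ α β} → x ∈C α → x′ ∈C α → y ∈C β → y′ ∈C β → cls (x * y) ≡ cls (x′ * y′)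
  cls-cong (x≢0 , x∈) (x′≢0 , x′∈) (y≢0 , y∈) (y′≢0 , y′∈) =
    trans (cls-* x≢0 y≢0) (trans (cong₂ _⊕_ (trans x∈ (sym x′∈)) (trans y∈ (sym y′∈))) (sym (cls-* x′≢0 y′≢0)))

  module _ (-1∉K : cls (- 1#) ≢ [ 0 ]) where

    -- y² = y′² leaves y = y′ or y = - y′, and since -1 ∉ K the element - y′ lies in another class
    -- than y′.
    square-injective : ∀ {y y′ α} → y ∈C α → y′ ∈C α → y * y ≡ y′ * y′ → y ≡ y′
    square-injective {y} {y′} (y≢0 , y∈) (y′≢0 , y′∈) eq with y ≟ y′
    ... | yes y≡y′ = y≡y′
    ... | no y≢y′ = contradiction (identityˡ-unique (cls (- 1#)) (cls y′) (trans (sym (cls-* -1≢0 y′≢0))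
            (trans (cong cls (trans (-1*x≈-x y′) (sym (square-roots eq y≢y′)))) (trans y∈ (sym y′∈))))) -1∉K

    record Avoids (L : List (List (Fin q))) (xs : List (Fin q)) (x : Fin q) : Set where
      field
        cross   : ∀ {B u v a} → B ∈ L → u ∈ B → v ∈ B → a ∈ xs → x * u ≢ a * v
        mixed   : ∀ {a b c} → a ∈ xs → b ∈ xs → c ∈ xs → x * c ≢ a * b
        square  : ∀ {a b} → a ∈ xs → b ∈ xs → x * x ≢ a * b

    module _ (L : List (List (Fin q))) (L-transversal : ∀ {B} → B ∈ L → Transversal B)
             (xs : List (Fin q)) (P : Partial L xs) where
      private
        module P = Partial P
        xs-transversal : Transversal xs
        xs-transversal = P.nonzero , P.separate

      private
        crossings mixtures : ℕ
        crossings = length (cartesianProduct xs (flag L))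
        mixtures = length (cartesianProduct xs xs)

      -- The map φ is the identity for a single new element and also y ↦ b - y for the second of
      -- two. In each equation the class of φ y determines the class of the unknown partner, hence
      -- the partner, hence φ y.
      avoid : ∀ {r} {R : Fin q → Set r} (φ : Fin q → Fin q) → (∀ {y y′} → φ y ≡ φ y′ → y ≡ y′) →
              ∀ {α} → (∀ {y} → R y → φ y ∈C α) →
              ∀ {n} → Supply R (crossings ℕ.+ (mixtures ℕ.+ (length xs ℕ.+ n))) →
              Supply (λ y → R y × Avoids L xs (φ y)) n
      avoid {R = R} φ φ-injective {α} Rα S = weaken collect
        (pruneAll (λ a y → any? (λ b → φ y * φ y ≟ a * b) xs) xs square-unique
          (pruneAll (λ (a , b) y → any? (λ c → φ y * c ≟ a * b) xs) (cartesianProduct xs xs) mixed-unique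
            -- The partner u ranges over all of B inside the predicate, so the triple (a , B , v)
            -- costs one candidate rather than one for each u.
            (pruneAll (λ (a , B , v) y → any? (λ u → φ y * u ≟ a * v) B) (cartesianProduct xs (flag L)) cross-unique S)))
        where
        cross-unique : ∀ {j} → j ∈ cartesianProduct xs (flag L) → ∀ {y y′} → R y → R y′ →
                       Any (λ u → φ y * u ≡ proj₁ j * proj₂ (proj₂ j)) (proj₁ (proj₂ j)) →
                       Any (λ u → φ y′ * u ≡ proj₁ j * proj₂ (proj₂ j)) (proj₁ (proj₂ j)) → y ≡ y′
        cross-unique j∈ Ry Ry′ Py Py′
          with _ , f∈ ← ∈-cartesianProduct⁻ xs (flag L) j∈
          with u , u∈ , eq ← find Py | u′ , u′∈ , eq′ ← find Py′ =
          φ-injective (quotient-unique (L-transversal (proj₁ (flag-∈ f∈))) (Rα Ry) (Rα Ry′) u∈ u′∈ eq eq′)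
        mixed-unique : ∀ {j} → j ∈ cartesianProduct xs xs → ∀ {y y′} → R y × _ → R y′ × _ →
                       Any (λ c → φ y * c ≡ proj₁ j * proj₂ j) xs → Any (λ c → φ y′ * c ≡ proj₁ j * proj₂ j) xs → y ≡ y′
        mixed-unique _ (Ry , _) (Ry′ , _) Py Py′
          with c , c∈ , eq ← find Py | c′ , c′∈ , eq′ ← find Py′ =
          φ-injective (quotient-unique xs-transversal (Rα Ry) (Rα Ry′) c∈ c′∈ eq eq′)
        square-unique : ∀ {a} → a ∈ xs → ∀ {y y′} → (R y × _) × _ → (R y′ × _) × _ →
                        Any (λ b → φ y * φ y ≡ a * b) xs → Any (λ b → φ y′ * φ y′ ≡ a * b) xs → y ≡ y′
        square-unique a∈ ((Ry , _) , _) ((Ry′ , _) , _) Py Py′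
          with b , b∈ , eq ← find Py | b′ , b′∈ , eq′ ← find Py′
          with refl ← P.separate b∈ b′∈ (cls-cancelˡ (P.nonzero a∈) (P.nonzero a∈) (P.nonzero b∈) (P.nonzero b′∈) refl
                 (trans (sym (cong cls eq)) (trans (cls-cong (Rα Ry) (Rα Ry′) (Rα Ry) (Rα Ry′)) (cong cls eq′)))) =
          φ-injective (square-injective (Rα Ry) (Rα Ry′) (trans eq (sym eq′)))
        collect : ∀ {y} → ((R y × (∀ {j} → j ∈ cartesianProduct xs (flag L) → ¬ Any (λ u → φ y * u ≡ proj₁ j * proj₂ (proj₂ j)) (proj₁ (proj₂ j))))
                    × (∀ {j} → j ∈ cartesianProduct xs xs → ¬ Any (λ c → φ y * c ≡ proj₁ j * proj₂ j) xs))
                    × (∀ {a} → a ∈ xs → ¬ Any (λ b → φ y * φ y ≡ a * b) xs) →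
                  R y × Avoids L xs (φ y)
        collect (((Ry , ¬cross) , ¬mixed) , ¬square) = Ry , record
          { cross = λ B∈ u∈ v∈ a∈ eq → ¬cross (∈-cartesianProduct⁺ a∈ (∈-flag B∈ v∈)) (lose u∈ eq)
          ; mixed = λ a∈ b∈ c∈ eq → ¬mixed (∈-cartesianProduct⁺ a∈ b∈) (lose c∈ eq)
          ; square = λ a∈ b∈ eq → ¬square a∈ (lose b∈ eq) }

      avoids⇒extends : ∀ {y α} → y ∈C α → (∀ {a} → a ∈ xs → cls a ≢ α) → Avoids L xs y → Extends L xs y
      avoids⇒extends (y≢0 , y∈) fresh A = record
        { nonzero = y≢0
        ; fresh = λ a∈ eq → fresh a∈ (trans (sym eq) y∈)
        ; cross = cross ; mixed = mixed ; square = square }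
        where open Avoids A

      module _ {α γ : Fin e} (α≢γ : α ≢ γ) (α-fresh : ∀ {a} → a ∈ xs → cls a ≢ α) (γ-fresh : ∀ {a} → a ∈ xs → cls a ≢ γ)
               {b : Fin q} (b≢0 : b ≢ 0#) where

        Pair : Fin q → Set
        Pair y = y ∈C α × b - y ∈C γ

        b-‿injective : ∀ {y y′} → b - y ≡ b - y′ → y ≡ y′
        b-‿injective {y} {y′} eq = -‿injective (+-cancelˡ b (- y) (- y′) eq)

        y+[b-y] : ∀ y → y + (b - y) ≡ b
        y+[b-y] y = trans (F.+-comm y (b - y)) (trans (F.+-assoc b (- y) y) (trans (cong (λ s → b + s) (F.-‿inverseˡ y)) (F.+-identityʳ b)))

        -- With z = b - y, these are the equations tying y and z together: z u = y v, z y = a c, z c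
        -- = y² and z² = y a.
        Ratio : List (Fin q) → Fin q → Fin q → Set
        Ratio T v y = Any (λ u → (b - y) * u ≡ y * v) T

        Product : Fin q → Fin q → Set
        Product a y = Any (λ c → (b - y) * y ≡ a * c) xs

        Square-y Square-z : Fin q → Set
        Square-y y = Any (λ c → (b - y) * c ≡ y * y) xs
        Square-z y = Any (λ a → (b - y) * (b - y) ≡ y * a) xs

        ratio-unique : ∀ {T} → Transversal T → ∀ {v} → v ≢ 0# → ∀ {y y′} → Pair y → Pair y′ →
                       Ratio T v y → Ratio T v y′ → y ≡ y′
        ratio-unique T-transversal v≢0 {y} {y′} (y∈ , z∈) (y′∈ , z′∈) Py Py′
          with u , u∈ , eq ← find Py | u′ , u′∈ , eq′ ← find Py′
          with refl ← member-unique T-transversal z∈ z′∈ u∈ u′∈ (cls-cong y∈ y′∈ (v≢0 , refl) (v≢0 , refl)) eq eq′ =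
          ratio (proj₁ T-transversal u∈) v≢0 b≢0 eq eq′

        -- The classes of y, z and a fix c. Sum and product then determine y and z up to order, and
        -- the order is fixed because α ≢ γ.
        product-unique : ∀ {a} → a ∈ xs → ∀ {y y′} → Pair y → Pair y′ → Product a y → Product a y′ → y ≡ y′
        product-unique {a} a∈ {y} {y′} (y∈ , z∈) (y′∈ , z′∈) Py Py′
          with c , c∈ , eq ← find Py | c′ , c′∈ , eq′ ← find Py′
          with refl ← P.separate c∈ c′∈ (cls-cancelˡ (P.nonzero a∈) (P.nonzero a∈) (P.nonzero c∈) (P.nonzero c′∈) refl
                 (trans (sym (cong cls eq)) (trans (cls-cong z∈ z′∈ y∈ y′∈) (cong cls eq′)))) = by-cases (y ≟ y′)
          where
          by-cases : Dec (y ≡ y′) → y ≡ y′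
          by-cases (yes y≡y′) = y≡y′
          by-cases (no y≢y′) = contradiction (trans (sym (proj₂ y∈)) (trans (cong cls y≡z′) (proj₂ z′∈))) α≢γ
            where
            y≡z′ : y ≡ b - y′
            y≡z′ = vieta (trans (y+[b-y] y) (sym (y+[b-y] y′)))
              (trans (F.*-comm y (b - y)) (trans (trans eq (sym eq′)) (F.*-comm (b - y′) y′))) y≢y′

        -- Eliminating x̄ = b - x makes x² = x̄ c a quadratic in x alone; it is used with x = y and
        -- with x = z.
        complete-square : ∀ {x x̄ c} → x + x̄ ≡ b → x * x ≡ x̄ * c → x * (x + c) ≡ b * c
        complete-square {x} {x̄} {c} x+x̄≡b eq = begin
          x * (x + c)         ≡⟨ F.distribˡ x x c ⟩
          x * x + x * c       ≡⟨ cong (_+ x * c) eq ⟩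
          x̄ * c + x * c       ≡⟨ F.+-comm (x̄ * c) (x * c) ⟩
          x * c + x̄ * c       ≡⟨ F.distribʳ c x x̄ ⟨
          (x + x̄) * c         ≡⟨ cong (_* c) x+x̄≡b ⟩
          b * c               ∎
          where open ≡-Reasoning

        -- The classes of y and z fix c, so all solutions satisfy the same quadratic, which has at
        -- most two roots.
        square-y-unique : ∀ {y y′ y″} → Pair y → Pair y′ → Pair y″ → Square-y y → Square-y y′ → Square-y y″ →
                          y ≢ y′ → y ≢ y″ → y′ ≡ y″
        square-y-unique {y} {y′} {y″} (y∈ , z∈) (y′∈ , z′∈) (y″∈ , z″∈) Py Py′ Py″
          with c , c∈ , eq ← find Py | c′ , c′∈ , eq′ ← find Py′ | c″ , c″∈ , eq″ ← find Py″
          with refl ← member-unique xs-transversal z∈ z′∈ c∈ c′∈ (cls-cong y∈ y′∈ y∈ y′∈) eq eq′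
          with refl ← member-unique xs-transversal z∈ z″∈ c∈ c″∈ (cls-cong y∈ y″∈ y∈ y″∈) eq eq″ =
          quadratic (complete-square (y+[b-y] y) (sym eq)) (complete-square (y+[b-y] y′) (sym eq′)) (complete-square (y+[b-y] y″) (sym eq″))

        square-z-unique : ∀ {y y′ y″} → Pair y → Pair y′ → Pair y″ → Square-z y → Square-z y′ → Square-z y″ →
                          y ≢ y′ → y ≢ y″ → y′ ≡ y″
        square-z-unique {y} {y′} {y″} (y∈ , z∈) (y′∈ , z′∈) (y″∈ , z″∈) Py Py′ Py″ y≢y′ y≢y″
          with a , a∈ , eq ← find Py | a′ , a′∈ , eq′ ← find Py′ | a″ , a″∈ , eq″ ← find Py″
          with refl ← member-unique xs-transversal y∈ y′∈ a∈ a′∈ (cls-cong z∈ z′∈ z∈ z′∈) (sym eq) (sym eq′)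
          with refl ← member-unique xs-transversal y∈ y″∈ a∈ a″∈ (cls-cong z∈ z″∈ z∈ z″∈) (sym eq) (sym eq″) =
          b-‿injective (quadratic (complete-square (z+y y) eq) (complete-square (z+y y′) eq′) (complete-square (z+y y″) eq″)
            (λ eq → y≢y′ (b-‿injective eq)) (λ eq → y≢y″ (b-‿injective eq)))
          where
          z+y : ∀ y → (b - y) + y ≡ b
          z+y y = trans (F.+-comm (b - y) y) (y+[b-y] y)

        -- The subscripts of the stages count the families of equations avoided so far: two for y
        -- and z separately, two more for their ratio, then the product and the two quadratics.
        record Stage₂ (y : Fin q) : Set where
          constructor stage₂
          field
            pair : Pair y
            avoids-y : Avoids L xs y
            avoids-z : Avoids L xs (b - y)

        record Stage₄ (y : Fin q) : Set where
          constructor stage₄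
          field
            before   : Stage₂ y
            ¬ratio-L : ∀ {f} → f ∈ flag L → ¬ Ratio (proj₁ f) (proj₂ f) y
            ¬ratio   : ∀ {a} → a ∈ xs → ¬ Ratio xs a y

        record Stage₇ (y : Fin q) : Set where
          constructor stage₇
          field
            before    : Stage₄ y
            ¬product  : ∀ {a} → a ∈ xs → ¬ Product a y
            ¬square-y : ¬ Square-y y
            ¬square-z : ¬ Square-z y

        to-stage₂ : ∀ {n} → Supply Pair (crossings ℕ.+ (mixtures ℕ.+ (length xs ℕ.+ (crossings ℕ.+ (mixtures ℕ.+ (length xs ℕ.+ n)))))) →
                    Supply Stage₂ n
        to-stage₂ S = weaken (λ ((pair , Ay) , Az) → stage₂ pair Ay Az)
          (avoid (λ y → b - y) b-‿injective (λ r → proj₂ (proj₁ r)) (avoid (λ y → y) (λ eq → eq) proj₁ S))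

        to-stage₄ : ∀ {n} → Supply Stage₂ (length (flag L) ℕ.+ (length xs ℕ.+ n)) → Supply Stage₄ n
        to-stage₄ S = weaken collect₄
          (pruneAll {P = Ratio xs} (λ a y → any? (λ c → (b - y) * c ≟ y * a) xs) xs
            (λ a∈ r r′ → ratio-unique xs-transversal (P.nonzero a∈) (Stage₂.pair (proj₁ r)) (Stage₂.pair (proj₁ r′)))
          (pruneAll {P = λ f → Ratio (proj₁ f) (proj₂ f)} (λ (B , v) y → any? (λ u → (b - y) * u ≟ y * v) B) (flag L)
            (λ f∈ r r′ → let B∈ , v∈ = flag-∈ f∈ in
              ratio-unique (L-transversal B∈) (proj₁ (L-transversal B∈) v∈) (Stage₂.pair r) (Stage₂.pair r′)) S))
          where
          collect₄ : ∀ {y} → (Stage₂ y × (∀ {f} → f ∈ flag L → ¬ Ratio (proj₁ f) (proj₂ f) y)) × (∀ {a} → a ∈ xs → ¬ Ratio xs a y) → Stage₄ y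
          collect₄ ((before , ¬ratio-L) , ¬ratio) = stage₄ before ¬ratio-L ¬ratio

        to-stage₇ : ∀ {n} → Supply Stage₄ (length xs ℕ.+ (2 ℕ.+ (2 ℕ.+ n))) → Supply Stage₇ n
        to-stage₇ S = weaken collect₇
          (prune₂ {P = Square-z} (λ y → any? (λ a → (b - y) * (b - y) ≟ y * a) xs)
            (λ r r′ r″ → square-z-unique (pair (proj₁ (proj₁ r))) (pair (proj₁ (proj₁ r′))) (pair (proj₁ (proj₁ r″))))
          (prune₂ {P = Square-y} (λ y → any? (λ c → (b - y) * c ≟ y * y) xs)
            (λ r r′ r″ → square-y-unique (pair (proj₁ r)) (pair (proj₁ r′)) (pair (proj₁ r″)))
          (pruneAll {P = Product} (λ a y → any? (λ c → (b - y) * y ≟ a * c) xs) xs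
            (λ a∈ r r′ → product-unique a∈ (pair r) (pair r′)) S)))
          where
          collect₇ : ∀ {y} → ((Stage₄ y × (∀ {a} → a ∈ xs → ¬ Product a y)) × ¬ Square-y y) × ¬ Square-z y → Stage₇ y
          collect₇ (((before , ¬product) , ¬square-y) , ¬square-z) = stage₇ before ¬product ¬square-y ¬square-z
          pair : ∀ {y} → Stage₄ y → Pair y
          pair r = Stage₂.pair (Stage₄.before r)

        stage₇⇒extends : ∀ {y} → Stage₇ y → Extends L xs y × Extends L (y ∷ xs) (b - y)
        stage₇⇒extends {y} (stage₇ (stage₄ (stage₂ (y∈ , z∈) Ay Az) ¬ratio-L ¬ratio) ¬product ¬square-y ¬square-z) =
          avoids⇒extends y∈ α-fresh Ay , record
            { nonzero = proj₁ z∈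
            ; fresh = λ { (here refl) eq → α≢γ (trans (sym (proj₂ y∈)) (trans (sym eq) (proj₂ z∈)))
                        ; (there a∈) eq → γ-fresh a∈ (trans (sym eq) (proj₂ z∈)) }
            ; cross = λ { B∈ u∈ v∈ (here refl) eq → ¬ratio-L (∈-flag B∈ v∈) (lose u∈ eq)
                        ; B∈ u∈ v∈ (there a∈) eq → Az.cross B∈ u∈ v∈ a∈ eq }
            ; mixed = mixed
            ; square = square }
          where
          module Az = Avoids Az
          z-new : ∀ {a} → a ∈ y ∷ xs → b - y ≢ a
          z-new (here refl) eq = α≢γ (trans (sym (proj₂ y∈)) (trans (cong cls (sym eq)) (proj₂ z∈)))
          z-new (there a∈) eq = γ-fresh a∈ (trans (cong cls (sym eq)) (proj₂ z∈))
          mixed : ∀ {a a′ c} → a ∈ y ∷ xs → a′ ∈ y ∷ xs → c ∈ y ∷ xs → (b - y) * c ≢ a * a′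
          -- With y on both sides the equation cancels to z = a′, which the classes exclude.
          mixed (here refl) a′∈ (here refl) eq = z-new a′∈ (*-cancelˡ _ _ (proj₁ y∈) (trans (F.*-comm y (b - y)) eq))
          mixed (there a∈) (here refl) (here refl) eq = z-new (there a∈) (*-cancelʳ _ _ (proj₁ y∈) eq)
          mixed (there a∈) (there a′∈) (here refl) eq = ¬product a∈ (lose a′∈ eq)
          mixed (here refl) (here refl) (there c∈) eq = ¬square-y (lose c∈ eq)
          mixed (here refl) (there a′∈) (there c∈) eq = ¬ratio a′∈ (lose c∈ eq)
          mixed {a} (there a∈) (here refl) (there c∈) eq = ¬ratio a∈ (lose c∈ (trans eq (F.*-comm a y)))
          mixed (there a∈) (there a′∈) (there c∈) eq = Az.mixed a∈ a′∈ c∈ eq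
          square : ∀ {a a′} → a ∈ y ∷ xs → a′ ∈ y ∷ xs → (b - y) * (b - y) ≢ a * a′
          -- z² = y² with z ≠ y leaves z = - y, that is b = 0.
          square (here refl) (here refl) eq = b≢0 (trans (sym (y+[b-y] y))
            (trans (cong (λ s → y + s) (square-roots eq (z-new (here refl)))) (F.-‿inverseʳ y)))
          square (here refl) (there a′∈) eq = ¬square-z (lose a′∈ eq)
          square {a} (there a∈) (here refl) eq = ¬square-z (lose a∈ (trans eq (F.*-comm a y)))
          square (there a∈) (there a′∈) eq = Az.square a∈ a′∈ eq

        completion : Supply Pair (obstructions crossings mixtures (length xs) (length (flag L)) 1) → ∃[ y ] Pair y × Extends L xs y × Extends L (y ∷ xs) (b - y)
        completion S = let y , s = choose (to-stage₇ (to-stage₄ (to-stage₂ S)))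
                       in y , Stage₂.pair (Stage₄.before (Stage₇.before s)) , stage₇⇒extends s

-- Zero-sum transversals with distinct quotients

module BaseBlocks {l : ℕ} (FF : FiniteField (suc l)) (k n w : ℕ) .{{_ : NonZero (2 ℕ.* k)}} .{{_ : NonZero w}}
                  (k≡2+n : k ≡ suc (suc n)) (0<n : 0 ℕ.< n) (m≡2kw : suc l ≡ (2 ℕ.* k) ℕ.* w) where
  private
    q = suc (suc l)

  open Cyclotomy FF (2 ℕ.* k) w m≡2kw
  open SidonSets FF (2 ℕ.* k) w m≡2kw
  open Greedy FF (2 ℕ.* k) w m≡2kw
  open import Data.Empty using (⊥-elim)
  open import Data.Fin using (Fin; toℕ; _≟_)
  open import Data.List using (List; []; _∷_; length; foldr; cartesianProduct)
  open import Data.List.Membership.Propositional using (_∈_)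
  open import Data.List.Properties using (length-++; length-map)
  open import Data.List.Relation.Unary.All as All using (All; []; _∷_)
  open import Data.List.Relation.Unary.AllPairs using (AllPairs; []; _∷_)
  open import Data.List.Relation.Unary.Any using (here; there)
  open import Data.Nat using (_≤_; _<_)
  open import Data.Nat.DivMod using (m<n⇒m%n≡m)
  import Data.Nat.Properties as ℕ
  open import Data.Nat.Tactic.RingSolver using (solve-∀)
  open import Data.Product using (_×_; _,_; proj₁; proj₂; ∃-syntax)
  open import Data.Sum using (_⊎_)
  open import Data.Unit using (⊤; tt)
  open import Relation.Binary.PropositionalEquality as ≡ hiding ([_])
  open import Relation.Nullary using (¬_)
  open ZMod (2 ℕ.* k) using ([_]; toℕ-[])
  open import Algebra.Properties.Ring ring using (-‿involutive; -0#≈0#)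
  open import Algebra.Properties.Group F.+-group using (∙-cancelʳ)

  length-cartesianProduct : ∀ {a b} {A : Set a} {B : Set b} (xs : List A) (ys : List B) →
                            length (cartesianProduct xs ys) ≡ length xs ℕ.* length ys
  length-cartesianProduct [] ys = refl
  length-cartesianProduct (x ∷ xs) ys = trans (length-++ (Data.List.map (x ,_) ys))
    (cong₂ ℕ._+_ (length-map (x ,_) ys) (length-cartesianProduct xs ys))

  sum : List (Fin q) → Fin q
  sum = foldr _+_ 0#

  1+n<k : suc n < k
  1+n<k = ℕ.≤-reflexive (sym k≡2+n)

  n<k : n < k
  n<k = ℕ.<-trans ℕ.≤-refl 1+n<k

  abstract
    -- For i < k these are the even classes modulo 2k, that is the cosets of K consisting of
    -- squares.
    position : ℕ → Fin (2 ℕ.* k)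
    position i = [ 2 ℕ.* i ]

    position≡ : ∀ i → position i ≡ [ 2 ℕ.* i ]
    position≡ i = refl

  position-injective : ∀ {i j} → i < k → j < k → position i ≡ position j → i ≡ j
  position-injective {i} {j} i<k j<k eq = ℕ.*-cancelˡ-≡ i j 2
    (trans (sym (small i<k)) (trans (cong toℕ eq) (small j<k)))
    where
    small : ∀ {i} → i < k → toℕ (position i) ≡ 2 ℕ.* i
    small {i} i<k = trans (cong toℕ (position≡ i)) (trans (toℕ-[] (2 ℕ.* i)) (m<n⇒m%n≡m (ℕ.*-monoʳ-< 2 i<k)))

  -- New elements go to the front, so the class of an entry is given by the number of entries chosen
  -- before it. A graded list of length k meets every even class exactly once.
  Graded : List (Fin q) → Set
  Graded [] = ⊤
  Graded (x ∷ xs) = x ∈C position (length xs) × Graded xs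

  graded-∈ : ∀ {xs a} → Graded xs → a ∈ xs → ∃[ i ] i < length xs × a ∈C position i
  graded-∈ {x ∷ xs} (x∈ , _) (here refl) = length xs , ℕ.≤-refl , x∈
  graded-∈ (_ , graded) (there a∈) with i , i< , a∈C ← graded-∈ graded a∈ = i , ℕ.m<n⇒m<1+n i< , a∈C

  graded-fresh : ∀ {xs} → Graded xs → ∀ {j} → length xs ≤ j → j < k → ∀ {a} → a ∈ xs → cls a ≢ position j
  graded-fresh graded len≤j j<k a∈ eq with i , i<len , (_ , a∈C) ← graded-∈ graded a∈ =
    ℕ.<-irrefl (position-injective (ℕ.<-trans i<j j<k) j<k (trans (sym a∈C) eq)) i<j
    where i<j = ℕ.<-≤-trans i<len len≤j

  graded-separate : ∀ {xs} → Graded xs → length xs ≤ k → ∀ {a b} → a ∈ xs → b ∈ xs → cls a ≡ cls b → a ≡ b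
  graded-separate (x∈ , graded) len (here refl) (here refl) _ = refl
  graded-separate (x∈ , graded) len (here refl) (there b∈) eq = ⊥-elim (graded-fresh graded ℕ.≤-refl len b∈ (trans (sym eq) (proj₂ x∈)))
  graded-separate (x∈ , graded) len (there a∈) (here refl) eq = ⊥-elim (graded-fresh graded ℕ.≤-refl len a∈ (trans eq (proj₂ x∈)))
  graded-separate (x∈ , graded) len (there a∈) (there b∈) eq = graded-separate graded (ℕ.<⇒≤ len) a∈ b∈ eq

  record BaseBlock (B : List (Fin q)) : Set where
    field
      size     : length B ≡ k
      graded   : Graded B
      zero-sum : sum B ≡ 0#
      sidon    : ∀ {a b c d} → a ∈ B → b ∈ B → c ∈ B → d ∈ B → a * b ≡ c * d → a ≡ c × b ≡ d ⊎ a ≡ d × b ≡ c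

  transversal : ∀ {B} → BaseBlock B → Transversal B
  transversal BB = (λ a∈ → proj₁ (proj₂ (proj₂ (graded-∈ graded a∈)))) , graded-separate graded (ℕ.≤-reflexive size)
    where open BaseBlock BB

  -- The value of `obstructions` without the final candidate, for t earlier blocks: they have f = t
  -- k flags, and the prefix has n elements.
  bad : ℕ → ℕ
  bad t = let f = t ℕ.* k in
    2 ℕ.* (n ℕ.* f) ℕ.+ f ℕ.+ 2 ℕ.* (n ℕ.* n) ℕ.+ 4 ℕ.* n ℕ.+ 4

  module _ (-1∉K : cls (- 1#) ≢ [ 0 ]) {L : List (List (Fin q))} (base : All BaseBlock L) where

    L-transversal : ∀ {B} → B ∈ L → Transversal B
    L-transversal B∈ = transversal (All.lookup base B∈)

    flags : length (flag L) ≡ length L ℕ.* k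
    flags = length-flag (All.map BaseBlock.size base)

    record Prefix (j : ℕ) : Set where
      field
        xs      : List (Fin q)
        size    : length xs ≡ j
        partial : Partial L xs
        graded  : Graded xs
        -- The empty prefix has sum 0, hence the condition 1 ≤ j. At j = n this makes the prescribed
        -- sum of the last two elements nonzero.
        sum≢0   : 1 ≤ j → sum xs ≢ 0#

    -- The summand 2 pays for excluding y = - sum and for the candidate finally taken; the other
    -- terms are the cost of `avoid`.
    step : ∀ {j} → j < k → j ℕ.* (length L ℕ.* k) ℕ.+ (j ℕ.* j ℕ.+ (j ℕ.+ 2)) ≤ w → Prefix j → Prefix (suc j)
    step j<k enough record { xs = xs ; size = refl ; partial = partial ; graded = graded } = record
      { xs = y ∷ xs ; size = refl
      ; partial = extend partial (avoids⇒extends -1∉K L L-transversal xs partial y∈ (graded-fresh graded ℕ.≤-refl j<k) avoids)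
      ; graded = y∈ , graded ; sum≢0 = λ _ → y+sum≢0 }
      where
      j = length xs
      available : Supply (λ y → (y ∈C position j × Avoids -1∉K L xs y) × ¬ y + sum xs ≡ 0#) 1
      available = prune (λ y → y + sum xs ≟ 0#) (λ _ _ eq eq′ → ∙-cancelʳ (sum xs) _ _ (trans eq (sym eq′)))
        (avoid -1∉K L L-transversal xs partial (λ y → y) (λ eq → eq) (λ y∈ → y∈)
          (fewer (ℕ.≤-trans (ℕ.≤-reflexive (cong₂ ℕ._+_
              (trans (length-cartesianProduct xs (flag L)) (cong (length xs ℕ.*_) flags))
              (cong (ℕ._+ (length xs ℕ.+ 2)) (length-cartesianProduct xs xs)))) enough)
            (classSupply (position j))))
      chosen = choose available
      y = proj₁ chosen
      y∈ = proj₁ (proj₁ (proj₂ chosen))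
      avoids = proj₂ (proj₁ (proj₂ chosen))
      y+sum≢0 = proj₂ (proj₂ chosen)

    prefix : ∀ j → j ≤ n → (∀ i → i < n → i ℕ.* (length L ℕ.* k) ℕ.+ (i ℕ.* i ℕ.+ (i ℕ.+ 2)) ≤ w) → Prefix j
    prefix ℕ.zero _ _ = record { xs = [] ; size = refl ; partial = partial-[] L ; graded = tt ; sum≢0 = λ () }
    prefix (suc j) j<n enough = step (ℕ.<-trans j<n n<k) (enough j j<n) (prefix j (ℕ.<⇒≤ j<n) enough)

    obstruction-count : ∀ (xs : List (Fin q)) → length xs ≡ n →
      obstructions (length (cartesianProduct xs (flag L))) (length (cartesianProduct xs xs)) (length xs) (length (flag L)) 1 ≡ suc (bad (length L))
    obstruction-count xs size = trans
      (cong₂ (λ c x → obstructions c x (length xs) (length (flag L)) 1)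
        (trans (length-cartesianProduct xs (flag L)) (cong₂ ℕ._*_ size flags))
        (trans (length-cartesianProduct xs xs) (cong₂ ℕ._*_ size size)))
      (trans (cong₂ (λ a f → obstructions (n ℕ.* (length L ℕ.* k)) (n ℕ.* n) a f 1) size flags) (count n (length L ℕ.* k)))
      where
      count : ∀ n f → n ℕ.* f ℕ.+ (n ℕ.* n ℕ.+ (n ℕ.+ (n ℕ.* f ℕ.+ (n ℕ.* n ℕ.+ (n ℕ.+ (f ℕ.+ (n ℕ.+ (n ℕ.+ 5)))))))) ≡
              suc (2 ℕ.* (n ℕ.* f) ℕ.+ f ℕ.+ 2 ℕ.* (n ℕ.* n) ℕ.+ 4 ℕ.* n ℕ.+ 4)
      count = solve-∀

    module _ (xs : List (Fin q)) (size : length xs ≡ n) (partial : Partial L xs) (graded : Graded xs)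
             (b : Fin q) (b≢0 : b ≢ 0#) (b+sum≡0 : b + sum xs ≡ 0#) where

      assemble : ∀ y → y ∈C position n → b - y ∈C position (suc n) → Extends L xs y → Extends L (y ∷ xs) (b - y) →
                 ∃[ B ] BaseBlock B × All (Cross B) L
      assemble y y∈ z∈ Ey Ez = b - y ∷ y ∷ xs , record
          { size = trans (cong (λ n → suc (suc n)) size) (sym k≡2+n)
          ; graded = subst (λ n → b - y ∈C position (suc n)) (sym size) z∈ , subst (λ n → y ∈C position n) (sym size) y∈ , graded
          ; zero-sum = total
          ; sidon = Partial.sidon whole }
        , All.tabulate (Partial.cross whole)
        where
        whole : Partial L (b - y ∷ y ∷ xs)
        whole = extend (extend partial Ey) Ez
        total : b - y + (y + sum xs) ≡ 0#
        total = begin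
          b - y + (y + sum xs)      ≡⟨ F.+-assoc (b - y) y (sum xs) ⟨
          b - y + y + sum xs        ≡⟨ cong (_+ sum xs) (trans (F.+-assoc b (- y) y) (trans (cong (λ s → b + s) (F.-‿inverseˡ y)) (F.+-identityʳ b))) ⟩
          b + sum xs                ≡⟨ b+sum≡0 ⟩
          0#                        ∎
          where open ≡-Reasoning

      complete : Supply (λ y → y ∈C position n × b - y ∈C position (suc n)) (suc (bad (length L))) →
                 ∃[ B ] BaseBlock B × All (Cross B) L
      complete S = finish (completion -1∉K L L-transversal xs partial α≢γ α-fresh γ-fresh b≢0
                            (fewer (ℕ.≤-reflexive (obstruction-count xs size)) S))
        where
        finish : ∃[ y ] (y ∈C position n × b - y ∈C position (suc n)) × Extends L xs y × Extends L (y ∷ xs) (b - y) →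
                 ∃[ B ] BaseBlock B × All (Cross B) L
        finish (y , (y∈ , z∈) , Ey , Ez) = assemble y y∈ z∈ Ey Ez
        α≢γ : position n ≢ position (suc n)
        α≢γ eq = ℕ.<-irrefl (position-injective n<k 1+n<k eq) ℕ.≤-refl
        α-fresh : ∀ {a} → a ∈ xs → cls a ≢ position n
        α-fresh = graded-fresh graded (ℕ.≤-reflexive size) n<k
        γ-fresh : ∀ {a} → a ∈ xs → cls a ≢ position (suc n)
        γ-fresh = graded-fresh graded (ℕ.≤-trans (ℕ.≤-reflexive size) (ℕ.n≤1+n n)) 1+n<k

    -- The last two elements must sum to b = - sum xs, which is nonzero since n ≥ 1.
    fromPrefix : Prefix n → ∀ {r δ} → q ≡ w ℕ.+ r → w ℕ.* w ≡ q ℕ.* bad (length L) ℕ.+ δ →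
                 q ℕ.* (r ℕ.* r) < δ ℕ.* δ → ∃[ B ] BaseBlock B × All (Cross B) L
    fromPrefix record { xs = xs ; size = size ; partial = partial ; graded = graded ; sum≢0 = sum≢0 } q≡ w²≡ bound =
      complete xs size partial graded (- sum xs) -sum≢0 (F.-‿inverseˡ (sum xs))
        (pairSupply (position n) (position (suc n)) -sum≢0 (bad (length L)) q≡ w²≡ bound)
      where
      -sum≢0 : - sum xs ≢ 0#
      -sum≢0 eq = sum≢0 0<n (trans (sym (-‿involutive (sum xs))) (trans (cong -_ eq) -0#≈0#))

    nextBlock : (∀ i → i < n → i ℕ.* (length L ℕ.* k) ℕ.+ (i ℕ.* i ℕ.+ (i ℕ.+ 2)) ≤ w) →
                ∀ {r δ} → q ≡ w ℕ.+ r → w ℕ.* w ≡ q ℕ.* bad (length L) ℕ.+ δ → q ℕ.* (r ℕ.* r) < δ ℕ.* δ →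
                ∃[ B ] BaseBlock B × All (Cross B) L
    nextBlock enough = fromPrefix (prefix n ℕ.≤-refl enough)

  record Family (t : ℕ) : Set where
    constructor mkFamily
    field
      members   : List (List (Fin q))
      size      : length members ≡ t
      base      : All BaseBlock members
      crossings : AllPairs Cross members

  module _ (-1∉K : cls (- 1#) ≢ [ 0 ]) where

    insert : ∀ {L} → All BaseBlock L → AllPairs Cross L → ∃[ B ] BaseBlock B × All (Cross B) L → Family (suc (length L))
    insert {L} base cross (B , BB , B-cross) = mkFamily (B ∷ L) refl (BB ∷ base) (B-cross ∷ cross)

    grow : ∀ {t} → Family t → (∀ i → i < n → i ℕ.* (t ℕ.* k) ℕ.+ (i ℕ.* i ℕ.+ (i ℕ.+ 2)) ≤ w) →
           ∃[ r ] ∃[ δ ] q ≡ w ℕ.+ r × w ℕ.* w ≡ q ℕ.* bad t ℕ.+ δ × q ℕ.* (r ℕ.* r) < δ ℕ.* δ → Family (suc t)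
    grow (mkFamily L refl base cross) enough (r , δ , q≡ , w²≡ , bound) =
      insert base cross (nextBlock -1∉K base enough q≡ w²≡ bound)

    family : ∀ t →
      (∀ s → s < t → ∀ i → i < n → i ℕ.* (s ℕ.* k) ℕ.+ (i ℕ.* i ℕ.+ (i ℕ.+ 2)) ≤ w) →
      (∀ s → s < t → ∃[ r ] ∃[ δ ] q ≡ w ℕ.+ r × w ℕ.* w ≡ q ℕ.* bad s ℕ.+ δ × q ℕ.* (r ℕ.* r) < δ ℕ.* δ) →
      Family t
    family ℕ.zero _ _ = mkFamily [] refl [] []
    family (suc t) enough spread = grow (family t (λ s s<t → enough s (ℕ.m<n⇒m<1+n s<t)) (λ s s<t → spread s (ℕ.m<n⇒m<1+n s<t)))
      (enough t ℕ.≤-refl) (spread t ℕ.≤-refl)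

-- Numerical estimates

module Estimates (p k n w t : ℕ) (k≡3+p : k ≡ 3 ℕ.+ p) (n≡1+p : n ≡ 1 ℕ.+ p) where
  open import Data.Nat
  open import Data.Nat.Properties
  open import Data.Nat.Tactic.RingSolver using (solve-∀)
  open import Data.Product using (_×_; _,_; ∃-syntax)
  open import Relation.Binary.PropositionalEquality

  private
    k⁴ = k * k * (k * k)
    -- A t bounds the number of excluded pairs. As B = 2k - 1, r = B w + 1 is q - w. E collects the
    -- coefficient of w² in q r² once the terms in w and 1 are raised to w².
    A = (2 * n + 3) * (n + 1)
    B = 2 * n + 3
    E = 2 * k * (2 * B + 1) + (B * B + 2 * B + 1)
    q = suc (2 * k * w)
    r = suc (B * w)

  -- The witness c is the difference of the two sides. In the polynomial inequalities it is expanded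
  -- in p = k - 3, where all its coefficients are nonnegative.
  ≡+⇒≤ : ∀ {a b} c → b ≡ a + c → a ≤ b
  ≡+⇒≤ {a} c eq = ≤-trans (m≤m+n a c) (≤-reflexive (sym eq))

  2kA+1≤k⁴ : 2 * k * A + 1 ≤ k⁴
  2kA+1≤k⁴ = ≡+⇒≤ (20 + 34 * p + 24 * (p * p) + 8 * (p * p * p) + 1 * (p * p * p * p)) (general k n k≡3+p n≡1+p)
    where
    identity : ∀ p → (3 + p) * (3 + p) * ((3 + p) * (3 + p)) ≡ 2 * (3 + p) * ((2 * (1 + p) + 3) * ((1 + p) + 1)) + 1 + (20 + 34 * p + 24 * (p * p) + 8 * (p * p * p) + 1 * (p * p * p * p))
    identity = solve-∀
    general : ∀ k n → k ≡ 3 + p → n ≡ 1 + p → k * k * (k * k) ≡ 2 * k * ((2 * n + 3) * (n + 1)) + 1 + (20 + 34 * p + 24 * (p * p) + 8 * (p * p * p) + 1 * (p * p * p * p))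
    general _ _ refl refl = identity p

  E≤4k⁴ : E ≤ 4 * k⁴
  E≤4k⁴ = ≡+⇒≤ (222 + 362 * p + 204 * (p * p) + 48 * (p * p * p) + 4 * (p * p * p * p)) (general k n k≡3+p n≡1+p)
    where
    identity : ∀ p → 4 * ((3 + p) * (3 + p) * ((3 + p) * (3 + p))) ≡ 2 * (3 + p) * (2 * (2 * (1 + p) + 3) + 1) + ((2 * (1 + p) + 3) * (2 * (1 + p) + 3) + 2 * (2 * (1 + p) + 3) + 1) + (222 + 362 * p + 204 * (p * p) + 48 * (p * p * p) + 4 * (p * p * p * p))
    identity = solve-∀
    general : ∀ k n → k ≡ 3 + p → n ≡ 1 + p → 4 * (k * k * (k * k)) ≡ 2 * k * (2 * (2 * n + 3) + 1) + ((2 * n + 3) * (2 * n + 3) + 2 * (2 * n + 3) + 1) + (222 + 362 * p + 204 * (p * p) + 48 * (p * p * p) + 4 * (p * p * p * p))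
    general _ _ refl refl = identity p

  16[2kB²+1]<36k⁴ : 16 * (2 * k * (B * B) + 1) < 36 * k⁴
  16[2kB²+1]<36k⁴ = ≡+⇒≤ (499 + 1168 * p + 920 * (p * p) + 304 * (p * p * p) + 36 * (p * p * p * p)) (general k n k≡3+p n≡1+p)
    where
    identity : ∀ p → 36 * ((3 + p) * (3 + p) * ((3 + p) * (3 + p))) ≡ 1 + 16 * (2 * (3 + p) * ((2 * (1 + p) + 3) * (2 * (1 + p) + 3)) + 1) + (499 + 1168 * p + 920 * (p * p) + 304 * (p * p * p) + 36 * (p * p * p * p))
    identity = solve-∀
    general : ∀ k n → k ≡ 3 + p → n ≡ 1 + p → 36 * (k * k * (k * k)) ≡ 1 + 16 * (2 * k * ((2 * n + 3) * (2 * n + 3)) + 1) + (499 + 1168 * p + 920 * (p * p) + 304 * (p * p * p) + 36 * (p * p * p * p))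
    general _ _ refl refl = identity p

  A≤4k⁴ : A ≤ 4 * k⁴
  A≤4k⁴ = ≡+⇒≤ (314 + 423 * p + 214 * (p * p) + 48 * (p * p * p) + 4 * (p * p * p * p)) (general k n k≡3+p n≡1+p)
    where
    identity : ∀ p → 4 * ((3 + p) * (3 + p) * ((3 + p) * (3 + p))) ≡ (2 * (1 + p) + 3) * ((1 + p) + 1) + (314 + 423 * p + 214 * (p * p) + 48 * (p * p * p) + 4 * (p * p * p * p))
    identity = solve-∀
    general : ∀ k n → k ≡ 3 + p → n ≡ 1 + p → 4 * (k * k * (k * k)) ≡ (2 * n + 3) * (n + 1) + (314 + 423 * p + 214 * (p * p) + 48 * (p * p * p) + 4 * (p * p * p * p))
    general _ _ refl refl = identity p

  module _ (4k⁴t≤w : 4 * k⁴ * t ≤ w) (s : ℕ) (s<t : s < t) where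

    4k⁴≤w : 4 * k⁴ ≤ w
    4k⁴≤w = ≤-trans (m≤m*n (4 * k⁴) t {{>-nonZero (≤-trans (s≤s z≤n) s<t)}}) 4k⁴t≤w

    prefix-estimate : ∀ i → i < n → i * (s * k) + (i * i + (i + 2)) ≤ w
    prefix-estimate i i<n = begin
      i * (s * k) + (i * i + (i + 2))   ≤⟨ +-mono-≤ (*-mono-≤ i≤k ≤-refl) (+-mono-≤ (*-mono-≤ i≤k i≤k) i+2≤k) ⟩
      k * (s * k) + (k * k + k)         ≡⟨ regroup k s ⟩
      k * k * suc s + k                 ≤⟨ +-mono-≤ (*-monoʳ-≤ (k * k) s<t) (m≤m*n k (k * t) {{m*n≢0 k t}}) ⟩
      k * k * t + k * (k * t)           ≡⟨ double k t ⟩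
      2 * (k * k) * t                   ≤⟨ *-monoˡ-≤ t (*-mono-≤ (s≤s (s≤s (z≤n {2}))) (m≤m*n (k * k) (k * k))) ⟩
      4 * k⁴ * t                        ≤⟨ 4k⁴t≤w ⟩
      w                                 ∎
      where
      open ≤-Reasoning
      instance
        t-nonZero : NonZero t
        t-nonZero = >-nonZero (≤-trans (s≤s z≤n) s<t)
        k-nonZero : NonZero k
        k-nonZero = subst NonZero (sym k≡3+p) _
        k²-nonZero : NonZero (k * k)
        k²-nonZero = m*n≢0 k k
      i+2≤k : i + 2 ≤ k
      i+2≤k = begin
        i + 2       ≤⟨ +-monoˡ-≤ 2 (≤-pred (≤-trans i<n (≤-reflexive n≡1+p))) ⟩
        p + 2       ≡⟨ +-comm p 2 ⟩
        2 + p       ≤⟨ n≤1+n (2 + p) ⟩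
        3 + p       ≡⟨ k≡3+p ⟨
        k           ∎
      i≤k : i ≤ k
      i≤k = ≤-trans (m≤m+n i 2) i+2≤k
      regroup : ∀ k s → k * (s * k) + (k * k + k) ≡ k * k * suc s + k
      regroup = solve-∀
      double : ∀ k t → k * k * t + k * (k * t) ≡ 2 * (k * k) * t
      double = solve-∀

    M = 2 * (n * (s * k)) + s * k + 2 * (n * n) + 4 * n + 4

    M≤At : M ≤ A * t
    M≤At = ≤-trans (≡+⇒≤ (s + p) (general k n k≡3+p n≡1+p)) (*-monoʳ-≤ A s<t)
      where
      identity : ∀ p s → (2 * (1 + p) + 3) * (1 + p + 1) * suc s ≡
        2 * ((1 + p) * (s * (3 + p))) + s * (3 + p) + 2 * ((1 + p) * (1 + p)) + 4 * (1 + p) + 4 + (s + p)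
      identity = solve-∀
      general : ∀ k n → k ≡ 3 + p → n ≡ 1 + p → (2 * n + 3) * (n + 1) * suc s ≡
        2 * (n * (s * k)) + s * k + 2 * (n * n) + 4 * n + 4 + (s + p)
      general _ _ refl refl = identity p s

    -- The excluded pairs use up at most a quarter of w², so δ = w² - q M is at least 3w²/4.
    4qM≤w² : 4 * (q * M) ≤ w * w
    4qM≤w² = begin
      4 * (q * M)                           ≤⟨ *-monoʳ-≤ 4 (*-monoʳ-≤ q M≤At) ⟩
      4 * (q * (A * t))                     ≡⟨ regroup (2 * k) w A t ⟩
      -- The surplus A, from the 1 in q = 2kw + 1, is at most 4k⁴ ≤ w.
      4 * (2 * k * A * w + A) * t           ≤⟨ *-monoˡ-≤ t (*-monoʳ-≤ 4 (+-monoʳ-≤ (2 * k * A * w) (≤-trans A≤4k⁴ 4k⁴≤w))) ⟩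
      4 * (2 * k * A * w + w) * t           ≡⟨ collect (2 * k * A) w t ⟩
      4 * ((2 * k * A + 1) * w) * t         ≤⟨ *-monoˡ-≤ t (*-monoʳ-≤ 4 (*-monoˡ-≤ w 2kA+1≤k⁴)) ⟩
      4 * (k⁴ * w) * t                      ≡⟨ swap k⁴ w t ⟩
      4 * k⁴ * t * w                        ≤⟨ *-monoˡ-≤ w 4k⁴t≤w ⟩
      w * w                                 ∎
      where
      open ≤-Reasoning
      regroup : ∀ x w a t → 4 * (suc (x * w) * (a * t)) ≡ 4 * (x * a * w + a) * t
      regroup = solve-∀
      collect : ∀ x w t → 4 * (x * w + w) * t ≡ 4 * ((x + 1) * w) * t
      collect = solve-∀
      swap : ∀ x w t → 4 * (x * w) * t ≡ 4 * x * t * w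
      swap = solve-∀

    -- q r² has leading term 2k B² w³, and E w² ≤ w³ absorbs the rest; one factor w ≥ 4k⁴ of w⁴ then
    -- outweighs the coefficient 2k B² + 1. The ratio 9/16 is the square of the 3/4 left for δ.
    16qr²<9w⁴ : 16 * (q * (r * r)) < 9 * (w * w * (w * w))
    16qr²<9w⁴ = begin-strict
      16 * (q * (r * r))                                ≡⟨ cong (16 *_) (expand (2 * k) B w) ⟩
      16 * (2 * k * (B * B) * w³ + (2 * k * (2 * B) + B * B) * (w * w) + (2 * k + 2 * B) * w + 1)
        ≤⟨ *-monoʳ-≤ 16 (≤-trans (≤-reflexive (+-assoc (2 * k * (B * B) * w³ + (2 * k * (2 * B) + B * B) * (w * w)) _ 1))
             (+-monoʳ-≤ (2 * k * (B * B) * w³ + (2 * k * (2 * B) + B * B) * (w * w)) (+-mono-≤ (*-monoʳ-≤ (2 * k + 2 * B) w≤w²) (*-mono-≤ 1≤w 1≤w)))) ⟩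
      16 * (2 * k * (B * B) * w³ + (2 * k * (2 * B) + B * B) * (w * w) + ((2 * k + 2 * B) * (w * w) + w * w))
        ≡⟨ cong (16 *_) (collect (2 * k) B w) ⟩
      16 * (2 * k * (B * B) * w³ + E * (w * w))
        ≤⟨ *-monoʳ-≤ 16 (+-monoʳ-≤ (2 * k * (B * B) * w³) (*-monoˡ-≤ (w * w) (≤-trans E≤4k⁴ 4k⁴≤w))) ⟩
      16 * (2 * k * (B * B) * w³ + w³)                  ≡⟨ factor (2 * k * (B * B)) w³ ⟩
      16 * (2 * k * (B * B) + 1) * w³                   <⟨ *-monoˡ-< w³ {{m*n≢0 w (w * w) {{w-nonZero}} {{m*n≢0 w w {{w-nonZero}} {{w-nonZero}}}}}} 16[2kB²+1]<36k⁴ ⟩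
      36 * k⁴ * w³                                      ≡⟨ split k⁴ w³ ⟩
      9 * (4 * k⁴ * w³)                                 ≤⟨ *-monoʳ-≤ 9 (*-monoˡ-≤ w³ 4k⁴≤w) ⟩
      9 * (w * w³)                                      ≡⟨ cong (9 *_) (sym (*-assoc w w (w * w))) ⟩
      9 * (w * w * (w * w))                             ∎
      where
      open ≤-Reasoning
      w³ = w * (w * w)
      1≤w : 1 ≤ w
      1≤w = ≤-trans (≤-trans (m≤n+m 1 (B * B + 2 * B)) (m≤n+m (B * B + 2 * B + 1) (2 * k * (2 * B + 1)))) (≤-trans E≤4k⁴ 4k⁴≤w)
      w-nonZero : NonZero w
      w-nonZero = >-nonZero 1≤w
      w≤w² : w ≤ w * w
      w≤w² = m≤m*n w w {{w-nonZero}}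
      expand : ∀ x b w → suc (x * w) * (suc (b * w) * suc (b * w)) ≡
        x * (b * b) * (w * (w * w)) + (x * (2 * b) + b * b) * (w * w) + (x + 2 * b) * w + 1
      expand = solve-∀
      collect : ∀ x b w → x * (b * b) * (w * (w * w)) + (x * (2 * b) + b * b) * (w * w) + ((x + 2 * b) * (w * w) + w * w) ≡
        x * (b * b) * (w * (w * w)) + (x * (2 * b + 1) + (b * b + 2 * b + 1)) * (w * w)
      collect = solve-∀
      factor : ∀ x y → 16 * (x * y + y) ≡ 16 * (x + 1) * y
      factor = solve-∀
      split : ∀ x y → 36 * x * y ≡ 9 * (4 * x * y)
      split = solve-∀

    pair-estimate : ∃[ r ] ∃[ δ ] q ≡ w + r × w * w ≡ q * M + δ × q * (r * r) < δ * δ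
    pair-estimate with δ , qM+δ≡w² ← m≤n⇒∃[o]m+o≡n (≤-trans (m≤n*m (q * M) 4) 4qM≤w²) =
      r , δ , general k n k≡3+p n≡1+p , sym qM+δ≡w² , *-cancelˡ-< 16 (q * (r * r)) (δ * δ) (begin-strict
        16 * (q * (r * r))           <⟨ 16qr²<9w⁴ ⟩
        9 * (w * w * (w * w))        ≡⟨ nine (w * w) ⟩
        3 * (w * w) * (3 * (w * w))  ≤⟨ *-mono-≤ 3w²≤4δ 3w²≤4δ ⟩
        4 * δ * (4 * δ)              ≡⟨ sixteen δ ⟩
        16 * (δ * δ)                 ∎)
      where
      open ≤-Reasoning
      q≡w+r : ∀ p w → suc (2 * (3 + p) * w) ≡ w + suc ((2 * (1 + p) + 3) * w)
      q≡w+r = solve-∀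
      general : ∀ k n → k ≡ 3 + p → n ≡ 1 + p → suc (2 * k * w) ≡ w + suc ((2 * n + 3) * w)
      general _ _ refl refl = q≡w+r p w
      nine : ∀ x → 9 * (x * x) ≡ 3 * x * (3 * x)
      nine = solve-∀
      sixteen : ∀ x → 4 * x * (4 * x) ≡ 16 * (x * x)
      sixteen = solve-∀
      3w²≤4δ : 3 * (w * w) ≤ 4 * δ
      3w²≤4δ = +-cancelˡ-≤ (4 * (q * M)) _ _ (begin
        4 * (q * M) + 3 * (w * w)    ≤⟨ +-monoˡ-≤ (3 * (w * w)) 4qM≤w² ⟩
        w * w + 3 * (w * w)          ≡⟨⟩
        4 * (w * w)                  ≡⟨ cong (4 *_) qM+δ≡w² ⟨
        4 * (q * M + δ)              ≡⟨ *-distribˡ-+ 4 (q * M) δ ⟩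
        4 * (q * M) + 4 * δ          ∎)

-- Heffter systems

module Development {l : ℕ} (FF : FiniteField (suc l)) (k n w : ℕ) .{{_ : NonZero (2 ℕ.* k)}} .{{_ : NonZero w}}
                   (k≡2+n : k ≡ suc (suc n)) (0<n : 0 ℕ.< n) (m≡2kw : suc l ≡ (2 ℕ.* k) ℕ.* w)
                   (kw-odd : ¬ 2 ∣ k ℕ.* w) where
  private
    m = suc l
    q = suc m
    e = 2 ℕ.* k
  open Cyclotomy FF e w m≡2kw
  open SidonSets FF e w m≡2kw using (square-roots)
  open Greedy FF e w m≡2kw using (Cross)
  open BaseBlocks FF k n w k≡2+n 0<n m≡2kw
  open import Data.Empty using (⊥)
  open import Data.Fin as Fin using (Fin; toℕ; remQuot; combine; inject≤)
  open import Data.Fin.Properties using (toℕ<n; toℕ-injective; combine-remQuot; inject≤-injective)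
  open import Data.List using (List; []; _∷_; length; map; foldr; applyUpTo; lookup)
  open import Data.List.Membership.Propositional using (_∈_)
  open import Data.List.Membership.Propositional.Properties using (∈-map⁻; ∈-map⁺; ∈-lookup)
  open import Data.List.Properties using (length-map)
  open import Data.List.Relation.Unary.All as All using (All; []; _∷_)
  import Data.List.Relation.Unary.All.Properties as All
  open import Data.List.Relation.Unary.AllPairs using (AllPairs; []; _∷_)
  import Data.List.Relation.Unary.AllPairs.Properties as AllPairs
  open import Data.List.Relation.Unary.Any using (Any; here; there)
  import Data.List.Relation.Unary.Any.Properties as Any
  open import Data.List.Relation.Unary.Unique.Propositional using (Unique)
  import Data.List.Relation.Unary.Unique.Propositional.Properties as Unique
  open import Data.Nat using (_≤_; _<_; _∸_; s≤s)
  open import Data.Nat.Divisibility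
  open import Data.Nat.DivMod using (_%_; _/_; m%n<n; m≡m%n+[m/n]*n; %-distribˡ-+)
  import Data.Nat.Properties as ℕ
  open import Data.Product using (_×_; _,_; proj₁; proj₂; ∃-syntax)
  open import Data.Sum using (_⊎_; inj₁; inj₂; [_,_]′)
  open import Relation.Binary.PropositionalEquality as ≡ hiding ([_])
  open import Relation.Nullary using (Dec; yes; no; contradiction)
  open import Algebra.Properties.CommutativeSemiring.Exp commutativeSemiring using (^-homo-*)
  open import Algebra.Properties.CommutativeSemigroup *-commutativeSemigroup using (interchange)
  open import Algebra.Properties.Ring ring using (-1*x≈-x)
  open ZMod e using ([_]; _⊕_; []-+; []-toℕ; ⊕-identityˡ)
  open ModularArithmetic using (∣toℕ[]⇒∣; ∣⇒∣toℕ[]; ∣-⊕)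

  2∣e : 2 ∣ e
  2∣e = m∣m*n k

  Even : Fin e → Set
  Even α = 2 ∣ toℕ α

  even-cancel : ∀ α β → Even (α ⊕ β) → Even α → Even β
  even-cancel α β αβ-even α-even = ∣m+n∣m⇒∣n (∣toℕ[]⇒∣ e 2∣e αβ-even) α-even

  odd+odd : ∀ a b → ¬ 2 ∣ a → ¬ 2 ∣ b → 2 ∣ a ℕ.+ b
  odd+odd a b a-odd b-odd = m%n≡0⇒n∣m (a ℕ.+ b) 2 (trans (%-distribˡ-+ a b 2) (cong₂ (λ x y → (x ℕ.+ y) % 2) (odd a a-odd) (odd b b-odd)))
    where
    odd : ∀ a → ¬ 2 ∣ a → a % 2 ≡ 1
    odd a ¬2∣a with a % 2 in eq | m%n<n a 2
    ... | 0 | _ = contradiction (m%n≡0⇒n∣m a 2 eq) ¬2∣a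
    ... | 1 | _ = refl
    ... | suc (suc _) | s≤s (s≤s ())

  m≡kw+kw : m ≡ k ℕ.* w ℕ.+ k ℕ.* w
  m≡kw+kw = trans m≡2kw (trans (ℕ.*-assoc 2 k w) (cong (k ℕ.* w ℕ.+_) (ℕ.+-identityʳ (k ℕ.* w))))

  ζ^-injective-< : ∀ a {d} → 0 < d → d < m → ζ ^ a ≢ ζ ^ (a ℕ.+ d)
  ζ^-injective-< a {d} 0<d d<m eq = ℕ.<⇒≱ d<m (∣⇒≤ {{ℕ.>-nonZero 0<d}} (ζ^d≡1⇒m∣d d
    (*-cancelˡ _ _ (ζ^≢0 a) (trans (sym (^-homo-* ζ a d)) (trans (sym eq) (sym (F.*-identityʳ _)))))))

  ζ^kw≡-1 : ζ ^ (k ℕ.* w) ≡ - 1#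
  ζ^kw≡-1 = square-roots (trans (sym (^-homo-* ζ (k ℕ.* w) (k ℕ.* w))) (trans (cong (ζ ^_) (sym m≡kw+kw)) (trans ζ^m≡1 (sym (F.*-identityʳ 1#)))))
    (λ eq → ζ^-injective-< 0 0<kw kw<m (sym eq))
    where
    0<kw : 0 < k ℕ.* w
    0<kw = ℕ.n≢0⇒n>0 (λ kw≡0 → kw-odd (subst (2 ∣_) (sym kw≡0) (2 ∣0)))
    kw<m : k ℕ.* w < m
    kw<m = subst (k ℕ.* w <_) (sym m≡kw+kw) (ℕ.m<m+n (k ℕ.* w) 0<kw)

  -- -1 = ζ^(kw) with kw odd, and parity survives reduction modulo the even number e = 2k.
  -1-odd : ¬ Even (cls (- 1#))
  -1-odd even = kw-odd (∣toℕ[]⇒∣ e 2∣e (subst Even (trans (cong cls (sym ζ^kw≡-1)) (cls-ζ^ (k ℕ.* w))) even))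

  -1∉K : cls (- 1#) ≢ [ 0 ]
  -1∉K eq = -1-odd (subst Even (sym eq) (∣⇒∣toℕ[] e 2∣e (2 ∣0)))

  G = F.+-abelianGroup

  V : Fin q → Set
  V x = x ≢ 0# × Even (cls x)

  halfSet : IsHalfSet G V
  halfSet = record
    { respects = λ { refl Vx → Vx }
    ; 0∉V = λ V0 → proj₁ V0 refl
    ; exactly-one = λ g g≢0 → by-cases g g≢0 (2 ∣? toℕ (cls g)) }
    where
    cls-neg : ∀ {g} → g ≢ 0# → cls (- g) ≡ cls (- 1#) ⊕ cls g
    cls-neg {g} g≢0 = trans (cong cls (sym (-1*x≈-x g))) (cls-* -1≢0 g≢0)
    neg≢0 : ∀ {g} → g ≢ 0# → - g ≢ 0#
    neg≢0 {g} g≢0 eq = *-≢0 -1≢0 g≢0 (trans (-1*x≈-x g) eq)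
    by-cases : ∀ g → g ≢ 0# → Dec (Even (cls g)) → (V g × ¬ V (- g)) ⊎ (¬ V g × V (- g))
    by-cases g g≢0 (yes even) = inj₁ ((g≢0 , even) , λ (_ , neg-even) →
      -1-odd (even-cancel (cls g) (cls (- 1#)) (subst Even (trans (cls-neg g≢0) (ZMod.⊕-comm e (cls (- 1#)) (cls g))) neg-even) even))
    by-cases g g≢0 (no odd) = inj₂ ((λ Vg → odd (proj₂ Vg)) , neg≢0 g≢0 ,
      subst Even (sym (cls-neg g≢0)) (∣⇒∣toℕ[] e 2∣e (odd+odd (toℕ (cls (- 1#))) (toℕ (cls g)) -1-odd odd)))

  abstract
    -- The factor ζ^(2c) κ with κ = ζ^(2kj); as j runs below w, κ runs through K once.
    shift : ℕ → ℕ → Fin q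
    shift c j = ζ ^ (2 ℕ.* c ℕ.+ e ℕ.* j)

    shift≡ : ∀ c j → shift c j ≡ ζ ^ (2 ℕ.* c ℕ.+ e ℕ.* j)
    shift≡ c j = refl

  shift≢0 : ∀ c j → shift c j ≢ 0#
  shift≢0 c j eq = ζ^≢0 (2 ℕ.* c ℕ.+ e ℕ.* j) (trans (sym (shift≡ c j)) eq)

  cls-shift : ∀ c j → cls (shift c j) ≡ [ 2 ℕ.* c ]
  cls-shift c j = trans (cong cls (shift≡ c j)) (trans (cls-ζ^ (2 ℕ.* c ℕ.+ e ℕ.* j)) (trans ([]-+ (2 ℕ.* c) (e ℕ.* j))
    (trans (cong ([ 2 ℕ.* c ] ⊕_) (∣⇒[]≡0 (m∣m*n j))) (trans (ZMod.⊕-comm e [ 2 ℕ.* c ] [ 0 ]) (⊕-identityˡ [ 2 ℕ.* c ])))))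

  shift-even : ∀ c j → Even (cls (shift c j))
  shift-even c j = subst Even (sym (cls-shift c j)) (∣⇒∣toℕ[] e 2∣e (m∣m*n c))

  translate : ℕ → ℕ → List (Fin q) → List (Fin q)
  translate c j = map (shift c j *_)

  develop : ℕ → List (Fin q) → List (List (Fin q))
  develop c B = applyUpTo (λ j → translate c j B) w

  graded-unique : ∀ {xs} → Graded xs → length xs ≤ k → Unique xs
  graded-unique {[]} _ _ = []
  graded-unique {x ∷ xs} (x∈ , graded) len =
    All.tabulate (λ a∈ x≡a → graded-fresh graded ℕ.≤-refl len a∈ (trans (cong cls (sym x≡a)) (proj₂ x∈)))
      ∷ graded-unique graded (ℕ.<⇒≤ len)

  graded-hits : ∀ {xs} → Graded xs → ∀ {i} → i < length xs → ∃[ a ] a ∈ xs × a ∈C position i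
  graded-hits {x ∷ xs} (x∈ , graded) {i} i< with ℕ.m<1+n⇒m<n∨m≡n i<
  ... | inj₂ refl = x , here refl , x∈
  ... | inj₁ i<len with a , a∈ , a∈C ← graded-hits graded i<len = a , there a∈ , a∈C

  sum-scale : ∀ u xs → foldr _+_ 0# (map (u *_) xs) ≡ u * sum xs
  sum-scale u [] = sym (F.zeroʳ u)
  sum-scale u (x ∷ xs) = trans (cong (λ s → u * x + s) (sum-scale u xs)) (sym (F.distribˡ u x (sum xs)))

  position-even : ∀ i → Even (position i)
  position-even i = subst Even (sym (position≡ i)) (∣⇒∣toℕ[] e 2∣e (m∣m*n i))

  -- The exponent of κ is a multiple e i, and i may be reduced modulo w because e w = m.
  K-power : ∀ {κ} → κ ≢ 0# → cls κ ≡ [ 0 ] → ∃[ j ] j < w × κ ≡ ζ ^ (e ℕ.* j)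
  K-power {κ} κ≢0 κ∈K = from-quotient (∣toℕ[]⇒∣ e ∣-refl (subst (λ α → e ∣ toℕ α) (trans (sym κ∈K) (cls≡[lg] κ)) (∣⇒∣toℕ[] e ∣-refl (e ∣0))))
    where
    from-quotient : e ∣ lg κ → ∃[ j ] j < w × κ ≡ ζ ^ (e ℕ.* j)
    from-quotient (divides i lg≡ie) = i % w , m%n<n i w , (begin
      κ                                                   ≡⟨ ζ^lg κ≢0 ⟨
      ζ ^ lg κ                                            ≡⟨ cong (ζ ^_) (trans lg≡ie (ℕ.*-comm i e)) ⟩
      ζ ^ (e ℕ.* i)                                       ≡⟨ cong (λ i → ζ ^ (e ℕ.* i)) (m≡m%n+[m/n]*n i w) ⟩
      ζ ^ (e ℕ.* (i % w ℕ.+ i / w ℕ.* w))                 ≡⟨ cong (ζ ^_) (trans (ℕ.*-distribˡ-+ e (i % w) (i / w ℕ.* w)) (cong (e ℕ.* (i % w) ℕ.+_) (multiple (i / w)))) ⟩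
      ζ ^ (e ℕ.* (i % w) ℕ.+ i / w ℕ.* m)                 ≡⟨ ^-homo-* ζ (e ℕ.* (i % w)) (i / w ℕ.* m) ⟩
      ζ ^ (e ℕ.* (i % w)) * ζ ^ (i / w ℕ.* m)             ≡⟨ cong (ζ ^ (e ℕ.* (i % w)) *_) (ζ^[*m] (i / w)) ⟩
      ζ ^ (e ℕ.* (i % w)) * 1#                            ≡⟨ F.*-identityʳ (ζ ^ (e ℕ.* (i % w))) ⟩
      ζ ^ (e ℕ.* (i % w))                                 ∎)
      where
      open ≡-Reasoning
      multiple : ∀ h → e ℕ.* (h ℕ.* w) ≡ h ℕ.* m
      multiple h = trans (cong (e ℕ.*_) (ℕ.*-comm h w)) (trans (sym (ℕ.*-assoc e w h)) (trans (cong (ℕ._* h) (sym m≡2kw)) (ℕ.*-comm m h)))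

  same-coset : ∀ {y b} → y ≢ 0# → b ≢ 0# → cls y ≡ cls b → ∃[ j ] j < w × y ≡ ζ ^ (e ℕ.* j) * b
  same-coset {y} {b} y≢0 b≢0 eq = scale (K-power κ≢0 κ∈K)
    where
    κ = b ⁻¹ * y
    bκ≡y : b * κ ≡ y
    bκ≡y = x*[x⁻¹*y] b≢0 y
    κ≢0 : κ ≢ 0#
    κ≢0 κ≡0 = y≢0 (trans (sym bκ≡y) (trans (cong (b *_) κ≡0) (F.zeroʳ b)))
    κ∈K : cls κ ≡ [ 0 ]
    κ∈K = trans (cls-cancelˡ b≢0 b≢0 κ≢0 1≢0 refl (trans (cong cls bκ≡y) (trans eq (cong cls (sym (F.*-identityʳ b)))))) (cls-ζ^ 0)
    scale : ∃[ j ] j < w × κ ≡ ζ ^ (e ℕ.* j) → ∃[ j ] j < w × y ≡ ζ ^ (e ℕ.* j) * b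
    scale (j , j<w , κ≡) = j , j<w , trans (sym bκ≡y) (trans (F.*-comm b κ) (cong (_* b) κ≡))

  module _ (c : ℕ) {B : List (Fin q)} (base : BaseBlock B) where
    open BaseBlock base

    translate-isBlock : ∀ j → IsBlock G V k (translate c j B)
    translate-isBlock j = record
      { unique = Unique.map⁺ (λ eq → *-cancelˡ _ _ (shift≢0 c j) eq) (graded-unique graded (ℕ.≤-reflexive size))
      ; size = trans (length-map _ B) size
      ; inside = inside
      ; zero-sum = trans (sum-scale (shift c j) B) (trans (cong (shift c j *_) zero-sum) (F.zeroʳ (shift c j))) }
      where
      inside : ∀ {x} → x ∈ translate c j B → V x
      inside x∈ with b , b∈ , refl ← ∈-map⁻ (shift c j *_) x∈ with i , _ , b≢0 , b∈C ← graded-∈ graded b∈ =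
        *-≢0 (shift≢0 c j) b≢0 , subst Even (sym (cls-* (shift≢0 c j) b≢0))
          (∣-⊕ e 2∣e (shift-even c j) (subst Even (sym b∈C) (position-even i)))

    -- All factors with the same c lie in one class, so a common element comes from the same b in
    -- both translates. The factors then agree, although their exponents differ by e (j - i), which
    -- lies strictly between 0 and m.
    translates-disjoint : ∀ {i j} → i < j → j < w → ∀ {x} → x ∈ translate c i B × x ∈ translate c j B → ⊥
    translates-disjoint {i} {j} i<j j<w (x∈ , x∈′)
      with b , b∈ , x≡ ← ∈-map⁻ (shift c i *_) x∈ | b′ , b′∈ , x≡′ ← ∈-map⁻ (shift c j *_) x∈′
      with refl ← proj₂ (transversal base) b∈ b′∈ (cls-cancelˡ (shift≢0 c i) (shift≢0 c j)
             (proj₁ (transversal base) b∈) (proj₁ (transversal base) b′∈)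
             (trans (cls-shift c i) (sym (cls-shift c j))) (cong cls (trans (sym x≡) x≡′))) =
      ζ^-injective-< (2 ℕ.* c ℕ.+ e ℕ.* i) 0<d d<m
        (trans (sym (shift≡ c i)) (trans (*-cancelʳ _ _ (proj₁ (transversal base) b∈) (trans (sym x≡) x≡′)) (trans (shift≡ c j) (cong (ζ ^_) split))))
      where
      d = e ℕ.* (j ∸ i)
      split : 2 ℕ.* c ℕ.+ e ℕ.* j ≡ 2 ℕ.* c ℕ.+ e ℕ.* i ℕ.+ d
      split = trans (cong (λ x → 2 ℕ.* c ℕ.+ e ℕ.* x) (sym (ℕ.m+[n∸m]≡n (ℕ.<⇒≤ i<j))))
        (trans (cong (2 ℕ.* c ℕ.+_) (ℕ.*-distribˡ-+ e i (j ∸ i))) (sym (ℕ.+-assoc (2 ℕ.* c) (e ℕ.* i) d)))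
      0<d : 0 < d
      0<d = ℕ.>-nonZero⁻¹ d {{ℕ.m*n≢0 e (j ∸ i) {{it}} {{ℕ.>-nonZero (ℕ.m<n⇒0<n∸m i<j)}}}}
        where open import Function using (it)
      d<m : d < m
      d<m = subst (d <_) (sym m≡2kw) (ℕ.*-monoʳ-< e (ℕ.≤-<-trans (ℕ.m∸n≤m j i) j<w))

    even-hit : ∀ {y} → Even (cls y) → ∃[ b ] b ∈ B × b ≢ 0# × cls y ≡ cls b
    even-hit {y} (divides i toℕ≡i2) with graded-hits graded (subst (i <_) (sym size) i<k)
      where
      i<k : i < k
      i<k = ℕ.*-cancelʳ-< 2 i k (subst₂ _<_ toℕ≡i2 (ℕ.*-comm 2 k) (toℕ<n (cls y)))
    ... | b , b∈ , b≢0 , b∈C = b , b∈ , b≢0 ,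
          trans (sym ([]-toℕ (cls y))) (trans (cong [_] (trans toℕ≡i2 (ℕ.*-comm i 2))) (trans (sym (position≡ i)) (sym b∈C)))

    -- x/ζ^(2c) is again a square, so it lies in the class of some b ∈ B and equals κ b with κ ∈ K.
    translates-cover : ∀ {x} → V x → Any (x ∈_) (develop c B)
    translates-cover {x} (x≢0 , x-even) = from-hit (even-hit y-even)
      where
      u₀ = ζ ^ (2 ℕ.* c)
      y = u₀ ⁻¹ * x
      u₀y≡x : u₀ * y ≡ x
      u₀y≡x = x*[x⁻¹*y] (ζ^≢0 (2 ℕ.* c)) x
      y≢0 : y ≢ 0#
      y≢0 eq = x≢0 (trans (sym u₀y≡x) (trans (cong (u₀ *_) eq) (F.zeroʳ u₀)))
      y-even : Even (cls y)
      y-even = even-cancel (cls u₀) (cls y) (subst Even (trans (cong cls (sym u₀y≡x)) (cls-* (ζ^≢0 (2 ℕ.* c)) y≢0)) x-even)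
        (subst Even (sym (cls-ζ^ (2 ℕ.* c))) (∣⇒∣toℕ[] e 2∣e (m∣m*n c)))
      from-coset : ∀ {b} → b ∈ B → ∃[ j ] j < w × y ≡ ζ ^ (e ℕ.* j) * b → Any (x ∈_) (develop c B)
      from-coset {b} b∈ (j , j<w , y≡) = Any.applyUpTo⁺ (λ j → translate c j B)
        (subst (_∈ translate c j B) (sym x≡) (∈-map⁺ (shift c j *_) b∈)) j<w
        where
        x≡ : x ≡ shift c j * b
        x≡ = trans (sym u₀y≡x) (trans (cong (u₀ *_) y≡) (trans (sym (F.*-assoc u₀ (ζ ^ (e ℕ.* j)) b))
          (cong (_* b) (trans (sym (^-homo-* ζ (2 ℕ.* c) (e ℕ.* j))) (sym (shift≡ c j))))))
      from-hit : ∃[ b ] b ∈ B × b ≢ 0# × cls y ≡ cls b → Any (x ∈_) (develop c B)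
      from-hit (b , b∈ , b≢0 , eq) = from-coset b∈ (same-coset y≢0 b≢0 eq)

    develop-isHeffter : IsHeffterSystem G V k (develop c B)
    develop-isHeffter = record
      { blocks = All.applyUpTo⁺₁ _ w (λ {j} _ → translate-isBlock j)
      ; disjoint = AllPairs.applyUpTo⁺₁ _ w translates-disjoint
      ; covers = translates-cover }

  Meet≤1 : List (Fin q) → List (Fin q) → Set
  Meet≤1 T T′ = ∀ {x y} → x ∈ T → x ∈ T′ → y ∈ T → y ∈ T′ → x ≡ y

  -- Two common elements u b₁ = u′ b₁′ and u b₂ = u′ b₂′ give b₁ b₂′ = b₂ b₁′.
  translates-meet : ∀ {c c′ j j′ B B′} →
    (∀ {b₁ b₂ b₁′ b₂′} → b₁ ∈ B → b₂ ∈ B → b₁′ ∈ B′ → b₂′ ∈ B′ → b₁ * b₂′ ≡ b₂ * b₁′ →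
      shift c j * b₁ ≡ shift c′ j′ * b₁′ → b₁ ≡ b₂ ⊎ b₁′ ≡ b₂′) →
    Meet≤1 (translate c j B) (translate c′ j′ B′)
  translates-meet {c} {c′} {j} {j′} separated x∈ x∈′ y∈ y∈′
    with b₁ , b₁∈ , x≡ ← ∈-map⁻ (shift c j *_) x∈ | b₁′ , b₁′∈ , x≡′ ← ∈-map⁻ (shift c′ j′ *_) x∈′
       | b₂ , b₂∈ , y≡ ← ∈-map⁻ (shift c j *_) y∈ | b₂′ , b₂′∈ , y≡′ ← ∈-map⁻ (shift c′ j′ *_) y∈′ =
    [ (λ b₁≡b₂ → trans x≡ (trans (cong (u *_) b₁≡b₂) (sym y≡)))
    , (λ b₁′≡b₂′ → trans x≡′ (trans (cong (u′ *_) b₁′≡b₂′) (sym y≡′))) ]′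
      (separated b₁∈ b₂∈ b₁′∈ b₂′∈ cross (trans (sym x≡) x≡′))
    where
    u = shift c j
    u′ = shift c′ j′
    cross : b₁ * b₂′ ≡ b₂ * b₁′
    cross = *-cancelˡ _ _ (*-≢0 (shift≢0 c j) (shift≢0 c′ j′)) (begin
      u * u′ * (b₁ * b₂′)       ≡⟨ interchange u u′ b₁ b₂′ ⟩
      u * b₁ * (u′ * b₂′)       ≡⟨ cong₂ _*_ (trans (sym x≡) x≡′) (trans (sym y≡′) y≡) ⟩
      u′ * b₁′ * (u * b₂)       ≡⟨ F.*-comm _ _ ⟩
      u * b₂ * (u′ * b₁′)       ≡⟨ interchange u b₂ u′ b₁′ ⟩
      u * u′ * (b₂ * b₁′)       ∎)
      where open ≡-Reasoning

  develop-orthogonal : ∀ c c′ {B B′} → (∀ j j′ → Meet≤1 (translate c j B) (translate c′ j′ B′)) →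
                       Orthogonal G (develop c B) (develop c′ B′)
  develop-orthogonal c c′ meet = All.applyUpTo⁺₁ _ w (λ {j} _ → All.applyUpTo⁺₁ _ w (λ {j′} _ → meet j j′))

  -- A list of blocks compares each pair in one order only. Either order serves: one equates the two
  -- elements of B, the other the two elements of B′, and both equate the common points.
  cross-orthogonal : ∀ c c′ {B B′} → Cross B B′ ⊎ Cross B′ B → Orthogonal G (develop c B) (develop c′ B′)
  cross-orthogonal c c′ {B} {B′} cross = develop-orthogonal c c′ λ j j′ → translates-meet {c} {c′} {j} {j′} λ b₁∈ b₂∈ b₁′∈ b₂′∈ eq _ →
    [ (λ BB′ → inj₁ (BB′ b₁∈ b₂∈ b₂′∈ b₁′∈ eq))
    , (λ B′B → inj₂ (B′B b₁′∈ b₂′∈ b₂∈ b₁∈ (trans (F.*-comm _ _) (trans (sym eq) (F.*-comm _ _))))) ]′ cross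

  -- The Sidon property leaves b₁ = b₂, as wanted, or b₁ = b₁′. In the second case the two factors
  -- coincide, and their classes 2c and 2c′ would too.
  coset-orthogonal : ∀ {c c′} → c < k → c′ < k → c ≢ c′ → ∀ {B} → BaseBlock B → Orthogonal G (develop c B) (develop c′ B)
  coset-orthogonal {c} {c′} c<k c′<k c≢c′ {B} base = develop-orthogonal c c′ λ j j′ → translates-meet {c} {c′} {j} {j′} (separated j j′)
    where
    separated : ∀ j j′ {b₁ b₂ b₁′ b₂′} → b₁ ∈ B → b₂ ∈ B → b₁′ ∈ B → b₂′ ∈ B → b₁ * b₂′ ≡ b₂ * b₁′ →
      shift c j * b₁ ≡ shift c′ j′ * b₁′ → b₁ ≡ b₂ ⊎ b₁′ ≡ b₂′
    separated j j′ b₁∈ b₂∈ b₁′∈ b₂′∈ eq ub≡u′b′ with BaseBlock.sidon base b₁∈ b₂′∈ b₂∈ b₁′∈ eq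
    ... | inj₁ (b₁≡b₂ , _) = inj₁ b₁≡b₂
    ... | inj₂ (refl , _) = contradiction (position-injective c<k c′<k (trans (position≡ c) (trans (sym (cls-shift c j))
            (trans (cong cls (*-cancelʳ _ _ (proj₁ (transversal base) b₁∈) ub≡u′b′)) (trans (cls-shift c′ j′) (sym (position≡ c′))))))) c≢c′

  lookup-cross : ∀ {L} → AllPairs Cross L → ∀ s s′ → s ≢ s′ → Cross (lookup L s) (lookup L s′) ⊎ Cross (lookup L s′) (lookup L s)
  lookup-cross (B-cross ∷ _) Fin.zero Fin.zero s≢s′ = contradiction refl s≢s′
  lookup-cross {B ∷ L} (B-cross ∷ _) Fin.zero (Fin.suc s′) _ = inj₁ (All.lookup B-cross (∈-lookup s′))
  lookup-cross {B ∷ L} (B-cross ∷ _) (Fin.suc s) Fin.zero _ = inj₂ (All.lookup B-cross (∈-lookup s))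
  lookup-cross (_ ∷ crosses) (Fin.suc s) (Fin.suc s′) s≢s′ = lookup-cross crosses s s′ (λ eq → s≢s′ (cong Fin.suc eq))

  module _ {r : ℕ} {L : List (List (Fin q))} (base : All BaseBlock L) (crosses : AllPairs Cross L) (r≤tk : r ≤ length L ℕ.* k) where
    -- Each system is given by a block and an exponent c < k; there are k choices of c because V/K
    -- has k cosets.
    index : Fin r → Fin (length L) × Fin k
    index i = remQuot k (inject≤ i r≤tk)

    index-injective : ∀ i j → index i ≡ index j → i ≡ j
    index-injective i j eq = inject≤-injective r≤tk r≤tk i j
      (trans (sym (combine-remQuot {length L} k _)) (trans (cong (λ (s , c) → combine s c) eq) (combine-remQuot {length L} k _)))

    systemAt : Fin (length L) × Fin k → List (List (Fin q))
    systemAt (s , c) = develop (toℕ c) (lookup L s)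

    base-lookup : ∀ s → BaseBlock (lookup L s)
    base-lookup s = All.lookup base (∈-lookup s)

    systemAt-orthogonal : ∀ i j → i ≢ j → Orthogonal G (systemAt i) (systemAt j)
    systemAt-orthogonal (s , c) (s′ , c′) i≢j with s Fin.≟ s′
    ... | no s≢s′ = cross-orthogonal (toℕ c) (toℕ c′) (lookup-cross crosses s s′ s≢s′)
    ... | yes refl = coset-orthogonal (toℕ<n c) (toℕ<n c′) (λ eq → i≢j (cong (s ,_) (toℕ-injective eq))) (base-lookup s)

    mohs : ∀ {v} → suc (2 ℕ.* v) ≡ q → 7 ≤ q → MOHS v k r
    mohs 1+2v≡q 7≤q = record
      { G = G
      ; order = subst (HasOrder G) (sym 1+2v≡q) (record
        { to = λ x → x ; from = λ x → x ; to-cong = λ eq → eq ; from-cong = λ eq → eq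
        ; inverse = (λ eq → eq) , (λ eq → eq) })
      ; order≥7 = subst (7 ≤_) (sym 1+2v≡q) 7≤q
      ; V = V
      ; halfSet = halfSet
      ; system = λ i → systemAt (index i)
      ; isHeffter = λ i → develop-isHeffter (toℕ (proj₂ (index i))) (base-lookup (proj₁ (index i)))
      ; orthogonal = λ i j i≢j → systemAt-orthogonal (index i) (index j) (λ eq → i≢j (index-injective i j eq)) }

-- Putting field, blocks and systems together

module Assembly where
  open import Data.Nat using (_≤_; _<_; z≤n; s≤s)
  open import Data.Nat.Divisibility using (divides)
  open import Data.Nat.Primality using (prime[2]; euclidsLemma)
  import Data.Nat.Properties as ℕ
  open import Data.Product using (_×_; _,_; ∃-syntax)
  open import Data.Sum using ([_,_]′)
  open import Relation.Binary.PropositionalEquality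

  module _ {p} (p-prime : Prime p) (N k n d w t : ℕ) (k≡3+d : k ≡ 3 ℕ.+ d) (n≡1+d : n ≡ 1 ℕ.+ d) (k-odd : ¬ 2 ∣ k) (w-odd : ¬ 2 ∣ w)
           (1+2kw≡pᴺ : suc (2 ℕ.* k ℕ.* w) ≡ p ℕ.^ N) (4k⁴t≤w : 4 ℕ.* (k ℕ.* k ℕ.* (k ℕ.* k)) ℕ.* t ≤ w) where
    private
      instance
        k-nonZero : NonZero k
        k-nonZero = subst NonZero (sym k≡3+d) _
        2k-nonZero : NonZero (2 ℕ.* k)
        2k-nonZero = ℕ.m*n≢0 2 k
        w-nonZero : NonZero w
        w-nonZero = ℕ.≢-nonZero (λ w≡0 → w-odd (divides 0 w≡0))
        2kw-nonZero : NonZero (2 ℕ.* k ℕ.* w)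
        2kw-nonZero = ℕ.m*n≢0 (2 ℕ.* k) w

    k≡2+n : k ≡ 2 ℕ.+ n
    k≡2+n = trans k≡3+d (cong (2 ℕ.+_) (sym n≡1+d))

    0<n : 0 < n
    0<n = subst (0 <_) (sym n≡1+d) (s≤s z≤n)

    predecessor : ∃[ l ] suc l ≡ 2 ℕ.* k ℕ.* w
    predecessor = ℕ.pred (2 ℕ.* k ℕ.* w) , ℕ.suc-pred (2 ℕ.* k ℕ.* w)

    module _ {l} (m≡2kw : suc l ≡ 2 ℕ.* k ℕ.* w) where
      abstract
        field-of-order-q : FiniteField (suc l)
        field-of-order-q = GaloisField.galoisField p-prime N (trans (cong suc m≡2kw) 1+2kw≡pᴺ)

      kw-odd : ¬ 2 ∣ k ℕ.* w
      kw-odd 2∣kw = [ k-odd , w-odd ]′ (euclidsLemma k w prime[2] 2∣kw)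

      module Blocks = BaseBlocks field-of-order-q k n w k≡2+n 0<n m≡2kw
      module Systems = Development field-of-order-q k n w k≡2+n 0<n m≡2kw kw-odd

      blocks : Blocks.Family t
      blocks = Blocks.family Systems.-1∉K t
        (λ s s<t → prefix-estimate 4k⁴t≤w s s<t)
        (λ s s<t → subst (λ x → ∃[ r ] ∃[ δ ] suc x ≡ w ℕ.+ r × w ℕ.* w ≡ suc x ℕ.* Blocks.bad s ℕ.+ δ × suc x ℕ.* (r ℕ.* r) < δ ℕ.* δ)
          (sym m≡2kw) (pair-estimate 4k⁴t≤w s s<t))
        where open Estimates d k n w t k≡3+d n≡1+d

      7≤q : 7 ≤ suc (suc l)
      7≤q = s≤s (ℕ.≤-trans (ℕ.≤-trans (ℕ.*-monoʳ-≤ 2 (subst (3 ≤_) (sym k≡3+d) (ℕ.m≤m+n 3 d))) (ℕ.m≤m*n (2 ℕ.* k) w)) (ℕ.≤-reflexive (sym m≡2kw)))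

      fromFamily : Blocks.Family t → ∀ {r v} → r ≤ t ℕ.* k → suc (2 ℕ.* v) ≡ suc (suc l) → MOHS v k r
      fromFamily (Blocks.mkFamily L refl base crossings) r≤tk 1+2v≡q = Systems.mohs base crossings r≤tk 1+2v≡q 7≤q

    mohs : ∀ {r} v → r ≤ t ℕ.* k → v ≡ k ℕ.* w → MOHS v k r
    mohs v r≤tk v≡kw = from-predecessor predecessor
      where
      from-predecessor : ∃[ l ] suc l ≡ 2 ℕ.* k ℕ.* w → MOHS v k _
      from-predecessor (l , m≡2kw) = fromFamily m≡2kw (blocks m≡2kw) r≤tk
        (cong suc (trans (cong (2 ℕ.*_) v≡kw) (trans (sym (ℕ.*-assoc 2 k w)) (sym m≡2kw))))

open import Data.Integer as ℤ using (+_)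
open import Data.Integer.Divisibility as ℤ∣ using ()
open import Data.Nat using (ℕ; _+_; _*_; _∸_; _^_; _≤_; NonZero)
open import Data.Nat.DivMod using (_/_; _%_)
open import Data.Rational.Unnormalised as ℚᵘ using (ceiling)
open import Relation.Binary.PropositionalEquality using (_≡_)

-- Extracting w and t from the hypotheses

module Parameters where
  import Data.Integer.DivMod as ℤ
  import Data.Integer.Properties as ℤ
  import Data.Integer.Tactic.RingSolver as ℤ-Solver
  open import Data.Nat using (suc; _<_; z≤n; s≤s; >-nonZero; >-nonZero⁻¹)
  open import Data.Nat.Divisibility using (_∣_; divides; n∣m⇒m%n≡0)
  open import Data.Nat.DivMod using (m*n/n≡m; [m+kn]%n≡m%n)
  import Data.Nat.Properties as ℕ
  open import Data.Nat.Tactic.RingSolver using (solve-∀)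
  open import Data.Product using (_×_; _,_; ∃-syntax)
  open import Relation.Binary.PropositionalEquality
  open import Relation.Nullary using (¬_; contradiction)

  -- The ceiling is minus the floor of -r/k, and the floor satisfies ⌊-r/k⌋ k ≤ -r.
  ≤⌈/⌉* : ∀ r k .{{_ : NonZero k}} → + r ℤ.≤ ⌈ + r ℚᵘ./ k ⌉ ℤ.* + k
  ≤⌈/⌉* r k@(suc _) = subst₂ ℤ._≤_ (ℤ.neg-involutive (+ r)) (ℤ.neg-distribˡ-* (ℤ.- (+ r) ℤ./ + k) (+ k))
    (ℤ.neg-mono-≤ (ℤ.[n/d]*d≤n (ℤ.- (+ r)) (+ k)))

  -- From 1 ≤ r ≤ T k the integer T is positive, so it is a natural number t and the bounds become
  -- inequalities in ℕ.
  natural-ceiling : ∀ {r k q} .{{_ : NonZero k}} c (T : ℤ.ℤ) → 1 ≤ r → + r ℤ.≤ T ℤ.* + k → + q ℤ.> + c ℤ.* T →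
                    ∃[ t ] 1 ≤ t × r ≤ t * k × c * t < q
  natural-ceiling {r} {k} c (+ 0) 1≤r r≤Tk _ = contradiction (ℕ.≤-trans 1≤r (ℤ.drop‿+≤+ r≤Tk)) λ ()
  natural-ceiling {r} {k} {q} c (+ suc t) 1≤r r≤Tk cT<q = suc t , s≤s z≤n
    , ℤ.drop‿+≤+ (subst (+ r ℤ.≤_) (sym (ℤ.pos-* (suc t) k)) r≤Tk)
    , ℤ.drop‿+<+ (subst (ℤ._< + q) (sym (ℤ.pos-* c (suc t))) cT<q)
  natural-ceiling {r} {suc _} c ℤ.-[1+ _ ] _ ()

  pos-difference : ∀ a x → ℤ.∣ + (a + x) ℤ.- + a ∣ ≡ x
  pos-difference a x = cong ℤ.∣_∣ (trans (cong (ℤ._- + a) (ℤ.pos-+ a x)) (cancel (+ a) (+ x)))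
    where
    cancel : ∀ a x → a ℤ.+ x ℤ.- a ≡ x
    cancel = ℤ-Solver.solve-∀

  odd : ∀ a → a % 2 ≡ 1 → ¬ 2 ∣ a
  odd a a%2≡1 2∣a = contradiction (trans (sym a%2≡1) (n∣m⇒m%n≡0 a 2 2∣a)) λ ()

  -- Integer divisibility concerns the absolute value of q - (2k + 1), which by 2k + 1 ≤ q is the
  -- natural difference 4kj. Then q = 2k (1 + 2j) + 1, with w = 1 + 2j odd.
  odd-cofactor : ∀ {k q} → 2 * k + 1 ≤ q → + (4 * k) ℤ∣.∣ (+ q ℤ.- + (2 * k + 1)) →
                 ∃[ w ] ¬ 2 ∣ w × q ≡ suc (2 * k * w)
  odd-cofactor {k} 2k+1≤q 4k∣ with x , refl ← ℕ.m≤n⇒∃[o]m+o≡n 2k+1≤q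
                                | divides j eq ← 4k∣ =
    1 + j * 2 , odd (1 + j * 2) ([m+kn]%n≡m%n 1 j 2)
    , trans (cong (λ y → 2 * k + 1 + y) (trans (sym (pos-difference (2 * k + 1) x)) eq)) (identity k j)
    where
    identity : ∀ k j → 2 * k + 1 + j * (4 * k) ≡ suc (2 * k * (1 + j * 2))
    identity = solve-∀

  k≤k⁵ : ∀ k .{{_ : NonZero k}} → k ≤ k ^ 5
  k≤k⁵ k = ℕ.m≤m*n k (k ^ 4) {{ℕ.m^n≢0 k 4}}

  -- 2k · 4k⁴t = 8k⁵t ≤ q - 1 = 2kw, and 2k cancels.
  large-cofactor : ∀ k .{{_ : NonZero k}} t w → 8 * k ^ 5 * t < suc (2 * k * w) → 4 * (k * k * (k * k)) * t ≤ w
  large-cofactor k t w bound = ℕ.*-cancelˡ-≤ (2 * k) {{ℕ.m*n≢0 2 k}} (ℕ.≤-trans (ℕ.≤-reflexive (identity k t)) (ℕ.≤-pred bound))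
    where
    identity : ∀ k t → 2 * k * (4 * (k * k * (k * k)) * t) ≡ 8 * (k * (k * (k * (k * (k * 1))))) * t
    identity = solve-∀

  2k+1≤q : ∀ {k q t} .{{_ : NonZero k}} → 1 ≤ t → 8 * k ^ 5 * t < q → 2 * k + 1 ≤ q
  2k+1≤q {k} {q} {t} 1≤t bound = ℕ.<⇒≤ (begin-strict
      2 * k + 1         ≤⟨ ℕ.+-monoʳ-≤ (2 * k) (>-nonZero⁻¹ k) ⟩
      2 * k + k         ≡⟨ ℕ.+-comm (2 * k) k ⟩
      3 * k             ≤⟨ ℕ.*-mono-≤ (ℕ.m≤m+n 3 5) (k≤k⁵ k) ⟩
      8 * k ^ 5         ≤⟨ ℕ.m≤m*n (8 * k ^ 5) t {{>-nonZero 1≤t}} ⟩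
      8 * k ^ 5 * t     <⟨ bound ⟩
      q                 ∎)
    where open ℕ.≤-Reasoning

  assemble : ∀ {k r q} .{{_ : NonZero k}} → 3 ≤ k → ¬ 2 ∣ k → PrimePower q → + (4 * k) ℤ∣.∣ (+ q ℤ.- + (2 * k + 1)) →
             ∃[ t ] 1 ≤ t × r ≤ t * k × 8 * k ^ 5 * t < q → MOHS ((q ∸ 1) / 2) k r
  assemble {k} {r} {q} 3≤k k-odd (p , n , p-prime , _ , q≡pⁿ) 4k∣ (t , 1≤t , r≤tk , bound)
    with d , 3+d≡k ← ℕ.m≤n⇒∃[o]m+o≡n 3≤k
       | w , w-odd , refl ← odd-cofactor {k} {q} (2k+1≤q 1≤t bound) 4k∣ =
    Assembly.mohs p-prime n k (1 + d) d w t (sym 3+d≡k) refl k-odd w-odd q≡pⁿ (large-cofactor k t w bound) _ r≤tk half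
    where
    half : 2 * k * w / 2 ≡ k * w
    half = trans (cong (_/ 2) (trans (ℕ.*-assoc 2 k w) (ℕ.*-comm 2 (k * w)))) (m*n/n≡m (k * w) 2)

theorem1p14 : (k r q : ℕ) .{{_ : NonZero k}} → 3 ≤ k → k % 2 ≡ 1 → 1 ≤ r → PrimePower q
    → (+ (4 * k)) ℤ∣.∣ (+ q ℤ.- + (2 * k + 1))
    → (+ q) ℤ.> (+ (8 * k ^ 5)) ℤ.* ⌈ (+ r) ℚᵘ./ k ⌉
    → MOHS ((q ∸ 1) / 2) k r
theorem1p14 k r q 3≤k k-odd 1≤r q-primePower 4k∣ bound =
  Parameters.assemble 3≤k (Parameters.odd k k-odd) q-primePower 4k∣
    (Parameters.natural-ceiling (8 * k ^ 5) ⌈ (+ r) ℚᵘ./ k ⌉ 1≤r (Parameters.≤⌈/⌉* r k) bound)
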